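{- Let $m\ge2$, $r=\frac1{4m}$, and for real $v$ let $$\Psi_r(v)=\frac{1+v-\sqrt{(1-v)^2+\frac1m}}{2}.$$ Define $w_0:=\frac12$ and $w_{k+1}:=\Psi_r(w_k)$ for $k=0,1,\dots,m-2$. Then the limit $p_\top(m):=\lim_{n\to\infty}g_n^{(m-1)}/g_n$ exists and $$p_\top(m)=\prod_{k=0}^{m-2}\partial_v\Psi_r(w_k)=\prod_{k=0}^{m-2}\frac12\left(1+\frac{1-w_k}{\sqrt{(1-w_k)^2+\frac1m}}\right).$$
   Context: For an integer $m\ge2$ let $V_m=\{v_0<v_1<\cdots<v_{m-1}\}$ ($v_0=0$, $v_{m-1}=1$) be an $m$-element chain with Gödel implication $v_p\Rightarrow_G v_q=v_{m-1}$ if $p\le q$ and $v_p\Rightarrow_G v_q=v_q$ if $p>q$. For $n\ge1$, consider the $C_{n-1}$ full bracketings of $p_1\Rightarrow_G\cdots\Rightarrow_G p_n$ in $n$ distinct variables (full binary trees with $n$ ordered leaves), $C_k$ being the Catalan numbers. Let $g_n^{(j)}$ be the number of pairs (bracketing, valuation $\{p_1,\dots,p_n\}\to V_m$) for which the bracketed formula evaluates to $v_j$, and $g_n=\sum_{j=0}^{m-1}g_n^{(j)}=m^nC_{n-1}$. -}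

module Defs where

open import Data.Fin.Base as Fin using (Fin; fromℕ)
import Data.Fin.Properties as Fin
open import Data.Integer.Base as ℤ using (ℤ; +_; -[1+_])
import Data.Integer.Properties as ℤ
open import Data.List.Base as List
  using (List; []; _∷_; _++_; map; concatMap; cartesianProduct; cartesianProductWith; filter; length; allFin)
open import Data.List.Membership.Propositional using (_∈_)
open import Data.List.Membership.Propositional.Properties
  using (∈-++⁺ʳ; ∈-concatMap⁺; ∈-concatMap⁻; ∈-cartesianProductWith⁺; ∈-cartesianProductWith⁻; ∈-cartesianProduct⁺; ∈-filter⁺; ∈-allFin; ∈-map⁺; ∈-length)
open import Data.List.Relation.Unary.All as All using (All; []; _∷_)
import Data.List.Relation.Unary.All.Properties as All
open import Data.List.Relation.Unary.AllPairs as AllPairs using (AllPairs; []; _∷_)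
import Data.List.Relation.Unary.AllPairs.Properties as AllPairs
open import Data.List.Relation.Unary.Any as Any using (Any; here; there)
open import Data.List.Relation.Unary.Unique.Propositional using (Unique)
import Data.List.Relation.Unary.Unique.Propositional.Properties as Unique
open import Data.Maybe.Base using (Maybe; just; nothing)
open import Data.Nat.Base as ℕ using (ℕ; zero; suc; NonZero; NonTrivial; z≤n; s≤s)
open import Data.Nat.ListAction using (sum)
import Data.Nat.Properties as ℕ
open import Data.Product.Base using (∃; ∃₂; ∃-syntax; _×_; _,_; proj₁; proj₂)
open import Data.Rational.Base as ℚ using (ℚ; mkℚ; 0ℚ; 1ℚ; ½)
import Data.Rational.Properties as ℚ
open import Data.Rational.Solver using (module +-*-Solver)
import Data.Rational.Unnormalised.Base as ℚᵘ
import Data.Rational.Unnormalised.Properties as ℚᵘ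
open import Data.Sum.Base using (_⊎_; inj₁; inj₂; [_,_]′)
open import Data.Vec.Base as Vec using (Vec; []; _∷_)
open import Relation.Binary.PropositionalEquality
open import Relation.Nullary using (yes; no; ¬_; contradiction)

-- Indexed by the number of leaves.
infixr 5 _⇒_
data Bracketing : ℕ → Set where
  leaf : Bracketing 1
  _⇒_  : ∀ {a b} → Bracketing a → Bracketing b → Bracketing (a ℕ.+ b)

-- The chain v₀ < ⋯ < v_{m-1} is Fin m with its usual order.
top : ∀ {m} .{{_ : NonTrivial m}} → Fin m
top {suc k} = fromℕ k

infixr 5 _⇒ᴳ_
_⇒ᴳ_ : ∀ {m} .{{_ : NonTrivial m}} → Fin m → Fin m → Fin m
p ⇒ᴳ q with p Fin.≤? q
... | yes _ = top
... | no  _ = q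

Valuation : ℕ → ℕ → Set
Valuation m n = Vec (Fin m) n

eval : ∀ {m n} .{{_ : NonTrivial m}} → Bracketing n → Valuation m n → Fin m
eval leaf            ρ = Vec.head ρ
eval (_⇒_ {a} s t) ρ = eval s (Vec.take a ρ) ⇒ᴳ eval t (Vec.drop a ρ)

valuations : ∀ m n → List (Valuation m n)
valuations m zero    = [] ∷ []
valuations m (suc n) = cartesianProductWith _∷_ (allFin m) (valuations m n)

splits : ∀ n → List (∃₂ λ a b → a ℕ.+ b ≡ n)
splits zero    = (0 , 0 , refl) ∷ []
splits (suc n) = (0 , suc n , refl) ∷ map (λ (a , b , e) → suc a , b , cong suc e) (splits n)

atoms : ∀ n → List (Bracketing n)
atoms 1 = leaf ∷ []
atoms _ = []

mutual
  -- Bounding the height by h makes the recursion structural.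
  bracketings≤ : ∀ (h n : ℕ) → List (Bracketing n)
  bracketings≤ zero    n = atoms n
  bracketings≤ (suc h) n = atoms n ++ concatMap (join h) (splits n)

  join : ∀ (h : ℕ) {n} → (∃₂ λ a b → a ℕ.+ b ≡ n) → List (Bracketing n)
  join h (a , b , refl) = cartesianProductWith _⇒_ (bracketings≤ h a) (bracketings≤ h b)

-- Lists every bracketing exactly once: see height<, bracketings-complete and
-- bracketings-unique.
bracketings : ∀ n → List (Bracketing n)
bracketings n = bracketings≤ n n

height : ∀ {n} → Bracketing n → ℕ
height leaf    = 0
height (s ⇒ t) = suc (height s ℕ.⊔ height t)

height< : ∀ {n} (t : Bracketing n) → height t ℕ.< n
height< leaf = s≤s z≤n
height< (_⇒_ {a} {b} s t) = bound (height< s) (height< t)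
  where
  bound : ∀ {x y a b} → x ℕ.< a → y ℕ.< b → suc (x ℕ.⊔ y) ℕ.< a ℕ.+ b
  bound {x} {y} {suc a} {suc b} (s≤s p) (s≤s q) =
    s≤s (ℕ.≤-trans (s≤s (ℕ.⊔-lub (ℕ.≤-trans p (ℕ.m≤m+n a b)) (ℕ.≤-trans q (ℕ.m≤n+m b a))))
                   (ℕ.≤-reflexive (sym (ℕ.+-suc a b))))

split∈ : ∀ a b → (a , b , refl) ∈ splits (a ℕ.+ b)
split∈ zero    zero    = here refl
split∈ zero    (suc b) = here refl
split∈ (suc a) b       = there (∈-map⁺ _ (split∈ a b))

complete≤ : ∀ h {n} (t : Bracketing n) → height t ℕ.≤ h → t ∈ bracketings≤ h n
complete≤ zero    leaf _ = here refl
complete≤ (suc h) leaf _ = here refl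
complete≤ (suc h) (_⇒_ {a} {b} s t) (s≤s p) =
  ∈-++⁺ʳ (atoms (a ℕ.+ b)) (∈-concatMap⁺ (join h) (Any.map step (split∈ a b)))
  where
  step : ∀ {x} → (a , b , refl) ≡ x → (s ⇒ t) ∈ join h x
  step refl = ∈-cartesianProductWith⁺ _⇒_
    (complete≤ h s (ℕ.≤-trans (ℕ.m≤m⊔n (height s) (height t)) p))
    (complete≤ h t (ℕ.≤-trans (ℕ.m≤n⊔m (height s) (height t)) p))

bracketings-complete : ∀ {n} (t : Bracketing n) → t ∈ bracketings n
bracketings-complete t = complete≤ _ t (ℕ.<⇒≤ (height< t))

children : ∀ {n} → Bracketing n → Maybe (∃₂ λ a b → Bracketing a × Bracketing b)
children leaf    = nothing
children (s ⇒ t) = just (_ , _ , s , t)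

⇒-injective : ∀ {a b} {s s′ : Bracketing a} {t t′ : Bracketing b} →
              s ⇒ t ≡ s′ ⇒ t′ → s ≡ s′ × t ≡ t′
⇒-injective eq with refl ← cong children eq = refl , refl

splits-unique : ∀ n → AllPairs (λ x y → proj₁ x ≢ proj₁ y) (splits n)
splits-unique zero    = [] ∷ []
splits-unique (suc n) =
  All.map⁺ (All.universal (λ _ ()) (splits n)) ∷
  AllPairs.map⁺ (AllPairs.map (λ ne eq → ne (ℕ.suc-injective eq)) (splits-unique n))

join-children : ∀ h {n} (x : ∃₂ λ a b → a ℕ.+ b ≡ n) {t} → t ∈ join h x →
                ∃₂ λ l r → children t ≡ just (proj₁ x , proj₁ (proj₂ x) , l , r)
join-children h (a , b , refl) t∈
  with l , r , _ , _ , refl ← ∈-cartesianProductWith⁻ _⇒_ (bracketings≤ h a) (bracketings≤ h b) t∈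
  = l , r , refl

atoms-children : ∀ n {t} → t ∈ atoms n → children t ≡ nothing
atoms-children 1 (here refl) = refl

atoms-unique : ∀ n → Unique (atoms n)
atoms-unique zero          = []
atoms-unique 1             = [] ∷ []
atoms-unique (suc (suc n)) = []

unique≤ : ∀ h n → Unique (bracketings≤ h n)
unique≤ zero    n = atoms-unique n
unique≤ (suc h) n = Unique.++⁺ (atoms-unique n)
  (Unique.concat⁺
    (All.map⁺ (All.universal join-unique (splits n)))
    (AllPairs.map⁺ (AllPairs.map (λ {x} {y} → disjoint x y) (splits-unique n))))
  (λ (t∈atoms , t∈joins) → node≢leaf t∈atoms (Any.satisfied (∈-concatMap⁻ (join h) {xs = splits n} t∈joins)))
  where
  join-unique : ∀ x → Unique (join h x)
  join-unique (a , b , refl) =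
    Unique.cartesianProductWith⁺ _⇒_ ⇒-injective (unique≤ h a) (unique≤ h b)

  disjoint : ∀ x y → proj₁ x ≢ proj₁ y → ∀ {t} → ¬ (t ∈ join h x × t ∈ join h y)
  disjoint x y ne (t∈x , t∈y)
    with _ , _ , e ← join-children h x t∈x | _ , _ , e′ ← join-children h y t∈y
    = ne (left (trans (sym e) e′))
    where
    left : ∀ {a b a′ b′ l r l′ r′} →
           _≡_ {A = Maybe (∃₂ λ a b → Bracketing a × Bracketing b)}
             (just (a , b , l , r)) (just (a′ , b′ , l′ , r′)) → a ≡ a′
    left refl = refl

  node≢leaf : ∀ {t} → t ∈ atoms n → ¬ ∃ λ x → t ∈ join h x
  node≢leaf t∈ (x , t∈x) with _ , _ , e ← join-children h x t∈x
    with () ← trans (sym (atoms-children n t∈)) e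

bracketings-unique : ∀ n → Unique (bracketings n)
bracketings-unique n = unique≤ n n

-- gₙ⁽ʲ⁾
g : ∀ m n .{{_ : NonTrivial m}} → Fin m → ℕ
g m n j = length (filter (λ (t , ρ) → eval t ρ Fin.≟ j)
                         (cartesianProduct (bracketings n) (valuations m n)))

-- gₙ
total : ∀ m n .{{_ : NonTrivial m}} → ℕ
total m n = sum (map (g m n) (allFin m))

valuations-complete : ∀ {m n} (ρ : Valuation m n) → ρ ∈ valuations m n
valuations-complete []      = here refl
valuations-complete (v ∷ ρ) =
  ∈-cartesianProductWith⁺ _∷_ (∈-allFin v) (valuations-complete ρ)

total-nonZero : ∀ m n .{{_ : NonTrivial m}} → NonZero (total m (suc n))
total-nonZero m n = ℕ.>-nonZero (ℕ.<-≤-trans occurs (≤sum (∈-map⁺ (g m (suc n)) (∈-allFin v))))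
  where
  comb : ∀ n → Bracketing (suc n)
  comb zero    = leaf
  comb (suc n) = leaf ⇒ comb n

  ρ = Vec.replicate (suc n) (top {m})
  v = eval (comb n) ρ

  occurs : 0 ℕ.< g m (suc n) v
  occurs = ∈-length (∈-filter⁺ (λ (t , ρ) → eval t ρ Fin.≟ v)
    (∈-cartesianProduct⁺ (bracketings-complete (comb n)) (valuations-complete ρ)) refl)

  ≤sum : ∀ {x xs} → x ∈ xs → x ℕ.≤ sum xs
  ≤sum {xs = y ∷ ys} (here refl) = ℕ.m≤m+n y (sum ys)
  ≤sum {xs = y ∷ ys} (there p)   = ℕ.≤-trans (≤sum p) (ℕ.m≤n+m (sum ys) y)

-- gₙ⁽ᵐ⁻¹⁾ / gₙ, with a dummy value at n = 0, where g₀ = 0.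
topShare : ∀ m .{{_ : NonTrivial m}} → ℕ → ℚ
topShare m zero    = 0ℚ
topShare m (suc n) = (+ g m (suc n) top ℚ./ total m (suc n)) {{total-nonZero m n}}

module Rational where
  open import Data.Rational.Base using (_+_; _-_; _*_; -_; _≤_; _<_; _⊔_; _⊓_; _/_; ∣_∣)
  open +-*-Solver using (solve; _:=_; _:+_; _:*_; _:-_; :-_; con)

  *-mono-≤ : ∀ {a b c d} → 0ℚ ≤ a → a ≤ b → 0ℚ ≤ c → c ≤ d → a * c ≤ b * d
  *-mono-≤ {a} {b} {c} {d} 0≤a a≤b 0≤c c≤d = ℚ.≤-trans
    (ℚ.*-monoʳ-≤-nonNeg c {{ℚ.nonNegative 0≤c}} a≤b)
    (ℚ.*-monoˡ-≤-nonNeg b {{ℚ.nonNegative (ℚ.≤-trans 0≤a a≤b)}} c≤d)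

  0≤* : ∀ {a b} → 0ℚ ≤ a → 0ℚ ≤ b → 0ℚ ≤ a * b
  0≤* {a} {b} 0≤a 0≤b = *-mono-≤ ℚ.≤-refl 0≤a ℚ.≤-refl 0≤b

  0<* : ∀ {a b} → 0ℚ < a → 0ℚ < b → 0ℚ < a * b
  0<* {a} {b} 0<a 0<b = ℚ.positive⁻¹ (a * b)
    {{ℚ.pos*pos⇒pos a {{ℚ.positive 0<a}} b {{ℚ.positive 0<b}}}}

  0<½ : 0ℚ < ½
  0<½ = ℚ.positive⁻¹ ½

  half+half : ∀ ε → ½ * ε + ½ * ε ≡ ε
  half+half = solve 1 (λ ε → con ½ :* ε :+ con ½ :* ε := ε) refl

  0≤square : ∀ a → 0ℚ ≤ a * a
  0≤square a with ℚ.≤-total 0ℚ a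
  ... | inj₁ 0≤a = 0≤* 0≤a 0≤a
  ... | inj₂ a≤0 = subst (0ℚ ≤_) (solve 1 (λ a → :- a :* :- a := a :* a) refl a)
                     (0≤* (ℚ.neg-antimono-≤ a≤0) (ℚ.neg-antimono-≤ a≤0))

  <⇒0<- : ∀ {a b} → a < b → 0ℚ < b - a
  <⇒0<- {a} {b} a<b = subst (_< b - a) (ℚ.+-inverseʳ a) (ℚ.+-monoˡ-< (- a) a<b)

  ≤∣∣ : ∀ a → a ≤ ∣ a ∣
  ≤∣∣ a with ℚ.≤-total 0ℚ a
  ... | inj₁ 0≤a = ℚ.≤-reflexive (sym (ℚ.0≤p⇒∣p∣≡p 0≤a))
  ... | inj₂ a≤0 = ℚ.≤-trans a≤0 (ℚ.0≤∣p∣ a)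

  ∣-∣-swap : ∀ a b → ∣ a - b ∣ ≡ ∣ b - a ∣
  ∣-∣-swap a b = trans (sym (ℚ.∣-p∣≡∣p∣ (a - b)))
    (cong ∣_∣ (solve 2 (λ a b → :- (a :- b) := b :- a) refl a b))

  ∣∣< : ∀ {a b ε} → a < b + ε → b < a + ε → ∣ a - b ∣ < ε
  ∣∣< {a} {b} {ε} a<b+ε b<a+ε with ℚ.∣p∣≡p∨∣p∣≡-p (a - b)
  ... | inj₁ e = subst₂ _<_ (sym e) (solve 2 (λ b ε → b :+ ε :- b := ε) refl b ε)
                   (ℚ.+-monoˡ-< (- b) a<b+ε)
  ... | inj₂ e = subst₂ _<_ (trans (solve 2 (λ a b → b :- a := :- (a :- b)) refl a b) (sym e))
                   (solve 2 (λ b ε → b :+ ε :- b := ε) refl a ε)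
                   (ℚ.+-monoˡ-< (- a) b<a+ε)

  ∣∣-∣∣≤ : ∀ a b → ∣ a ∣ - ∣ b ∣ ≤ ∣ a - b ∣
  ∣∣-∣∣≤ a b = subst₂ _≤_
    (cong (λ c → ∣ c ∣ - ∣ b ∣) (solve 2 (λ a b → a :- b :+ b := a) refl a b))
    (solve 2 (λ x y → x :+ y :- y := x) refl ∣ a - b ∣ ∣ b ∣)
    (ℚ.+-monoˡ-≤ (- ∣ b ∣) (ℚ.∣p+q∣≤∣p∣+∣q∣ (a - b) b))

  ∣∣-Lipschitz : ∀ a b → ∣ ∣ a ∣ - ∣ b ∣ ∣ ≤ ∣ a - b ∣
  ∣∣-Lipschitz a b with ℚ.∣p∣≡p∨∣p∣≡-p (∣ a ∣ - ∣ b ∣)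
  ... | inj₁ e = subst (_≤ ∣ a - b ∣) (sym e) (∣∣-∣∣≤ a b)
  ... | inj₂ e = subst₂ _≤_
      (trans (solve 2 (λ x y → y :- x := :- (x :- y)) refl ∣ a ∣ ∣ b ∣) (sym e))
      (∣-∣-swap b a) (∣∣-∣∣≤ b a)

  -- Zero is sent to zero.
  recip : ℚ → ℚ
  recip p with p ℚ.≟ 0ℚ
  ... | yes _   = 0ℚ
  ... | no  p≢0 = (ℚ.1/ p) {{ℚ.≢-nonZero p≢0}}

  recip-inverse : ∀ {p} → p ≢ 0ℚ → recip p * p ≡ 1ℚ
  recip-inverse {p} p≢0 with p ℚ.≟ 0ℚ
  ... | yes p≡0 = contradiction p≡0 p≢0
  ... | no  ne  = ℚ.*-inverseˡ p {{ℚ.≢-nonZero ne}}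

  0<recip : ∀ {p} → 0ℚ < p → 0ℚ < recip p
  0<recip {p} 0<p with p ℚ.≟ 0ℚ
  ... | yes p≡0 = contradiction (sym p≡0) (ℚ.<⇒≢ 0<p)
  ... | no  p≢0 = ℚ.positive⁻¹ _ {{ℚ.1/pos⇒pos p {{ℚ.positive 0<p}}}}

  mesh : ℕ → ℚ
  mesh n = + 1 / suc n

  0<mesh : ∀ n → 0ℚ < mesh n
  0<mesh n = ℚ.positive⁻¹ (mesh n) {{ℚ.normalize-pos 1 (suc n)}}

  archimedean : ∀ {ε} → 0ℚ < ε → ∃[ N ] (∀ n → N ℕ.≤ n → mesh n < ε)
  archimedean {mkℚ (+ zero) d _}   0<ε = contradiction (ℚ.positive 0<ε) λ ()
  archimedean {mkℚ (+ suc p) d c} _ = suc d , λ n d<n → ℚ.toℚᵘ-cancel-<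
    (ℚᵘ.<-respˡ-≃ (ℚᵘ.≃-sym (ℚ.toℚᵘ-fromℚᵘ (ℚᵘ.mkℚᵘ (+ 1) n)))
      (ℚᵘ.*<* (ℤ.+<+ (s≤s (ℕ.≤-trans (s≤s (ℕ.≤-reflexive (ℕ.+-identityʳ d)))
        (ℕ.≤-trans d<n (ℕ.m≤m+n n _)))))))
  archimedean {mkℚ -[1+ p ] d _} 0<ε = contradiction (ℚ.positive 0<ε) λ ()

  -- The largest multiple iδ, with i at most the last argument, whose square
  -- does not exceed q.
  climb : ℚ → ℚ → ℕ → ℚ
  climb q δ zero    = 0ℚ
  climb q δ (suc i) with (climb q δ i + δ) * (climb q δ i + δ) ℚ.≤? q
  ... | yes _ = climb q δ i + δ
  ... | no  _ = climb q δ i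

  -- Rational square root of q ⊔ 0 from below, to within 1/(n+1).
  root : ℚ → ℕ → ℚ
  root q n = climb q (mesh n) (suc n ℕ.* suc ℤ.∣ ℚ.↥ q ∣)

  climb-nonNeg : ∀ q {δ} → 0ℚ < δ → ∀ i → 0ℚ ≤ climb q δ i
  climb-nonNeg q {δ} 0<δ zero = ℚ.≤-refl
  climb-nonNeg q {δ} 0<δ (suc i) with (climb q δ i + δ) * (climb q δ i + δ) ℚ.≤? q
  ... | yes _ = ℚ.+-mono-≤ (climb-nonNeg q 0<δ i) (ℚ.<⇒≤ 0<δ)
  ... | no  _ = climb-nonNeg q 0<δ i

  climb-lower : ∀ q δ i → climb q δ i * climb q δ i ≤ q ⊔ 0ℚ
  climb-lower q δ zero = ℚ.p≤q⊔p q 0ℚ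
  climb-lower q δ (suc i) with (climb q δ i + δ) * (climb q δ i + δ) ℚ.≤? q
  ... | yes p = ℚ.≤-trans p (ℚ.p≤p⊔q q 0ℚ)
  ... | no  _ = climb-lower q δ i

  nat : ℕ → ℚ
  nat i = + i / 1

  nat-suc : ∀ i → nat (suc i) ≡ nat i + 1ℚ
  nat-suc i = ℚ.toℚᵘ-injective (begin
    ℚ.toℚᵘ (nat (suc i))                ≈⟨ ℚ.toℚᵘ-fromℚᵘ (ℚᵘ.mkℚᵘ (+ suc i) 0) ⟩
    ℚᵘ.mkℚᵘ (+ suc i) 0                 ≈⟨ ℚᵘ.*≡* lemma ⟩
    ℚᵘ.mkℚᵘ (+ i) 0 ℚᵘ.+ ℚ.toℚᵘ 1ℚ      ≈⟨ ℚᵘ.+-congˡ (ℚ.toℚᵘ 1ℚ) (ℚ.toℚᵘ-fromℚᵘ (ℚᵘ.mkℚᵘ (+ i) 0)) ⟨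
    ℚ.toℚᵘ (nat i) ℚᵘ.+ ℚ.toℚᵘ 1ℚ       ≈⟨ ℚ.toℚᵘ-homo-+ (nat i) 1ℚ ⟨
    ℚ.toℚᵘ (nat i + 1ℚ)                 ∎)
    where
    open ℚᵘ.≃-Reasoning
    lemma : + suc i ℤ.* + 1 ≡ (+ i ℤ.* + 1 ℤ.+ + 1) ℤ.* + 1
    lemma = cong (ℤ._* + 1)
      (trans (cong +_ (ℕ.+-comm 1 i)) (cong (ℤ._+ + 1) (sym (ℤ.*-identityʳ (+ i)))))


  nat-*-mesh : ∀ n c → nat (suc n ℕ.* c) * mesh n ≡ nat c
  nat-*-mesh n c = ℚ.toℚᵘ-injective (begin
    ℚ.toℚᵘ (nat (suc n ℕ.* c) * mesh n)
      ≈⟨ ℚ.toℚᵘ-homo-* (nat (suc n ℕ.* c)) (mesh n) ⟩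
    ℚ.toℚᵘ (nat (suc n ℕ.* c)) ℚᵘ.* ℚ.toℚᵘ (mesh n)
      ≈⟨ ℚᵘ.*-cong (ℚ.toℚᵘ-fromℚᵘ (ℚᵘ.mkℚᵘ (+ (suc n ℕ.* c)) 0)) (ℚ.toℚᵘ-fromℚᵘ (ℚᵘ.mkℚᵘ (+ 1) n)) ⟩
    ℚᵘ.mkℚᵘ (+ (suc n ℕ.* c)) 0 ℚᵘ.* ℚᵘ.mkℚᵘ (+ 1) n
      ≈⟨ ℚᵘ.*≡* lemma ⟩
    ℚᵘ.mkℚᵘ (+ c) 0
      ≈⟨ ℚ.toℚᵘ-fromℚᵘ (ℚᵘ.mkℚᵘ (+ c) 0) ⟨
    ℚ.toℚᵘ (nat c) ∎)
    where
    open ℚᵘ.≃-Reasoning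
    lemma : + (suc n ℕ.* c) ℤ.* + 1 ℤ.* + 1 ≡ + c ℤ.* (+ 1 ℤ.* + suc n)
    lemma = trans (ℤ.*-identityʳ (+ (suc n ℕ.* c) ℤ.* + 1))
      (trans (ℤ.*-identityʳ (+ (suc n ℕ.* c)))
      (trans (cong +_ (ℕ.*-comm (suc n) c))
      (trans (ℤ.pos-* c (suc n)) (cong (+ c ℤ.*_) (sym (ℤ.*-identityˡ (+ suc n)))))))

  <nat : ∀ q → q < nat (suc ℤ.∣ ℚ.↥ q ∣)
  <nat q@(mkℚ p d _) = ℚ.toℚᵘ-cancel-<
    (ℚᵘ.<-respʳ-≃ (ℚᵘ.≃-sym (ℚ.toℚᵘ-fromℚᵘ (ℚᵘ.mkℚᵘ (+ suc ℤ.∣ p ∣) 0))) (ℚᵘ.*<* (lemma p)))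
    where
    lemma : ∀ p → p ℤ.* + 1 ℤ.< + suc ℤ.∣ p ∣ ℤ.* + suc d
    lemma (+ n) = subst (ℤ._< + suc n ℤ.* + suc d) (sym (ℤ.*-identityʳ (+ n)))
      (ℤ.+<+ (ℕ.m≤m*n (suc n) (suc d)))
    lemma -[1+ n ] = ℤ.-<+

  1≤nat : ∀ c → 1ℚ ≤ nat (suc c)
  1≤nat zero    = ℚ.≤-refl
  1≤nat (suc c) = subst (1ℚ ≤_) (sym (nat-suc (suc c)))
    (ℚ.≤-trans (1≤nat c) (subst (_≤ nat (suc c) + 1ℚ) (ℚ.+-identityʳ (nat (suc c)))
      (ℚ.+-monoʳ-≤ (nat (suc c)) (ℚ.<⇒≤ (ℚ.positive⁻¹ 1ℚ)))))

  climb-upper : ∀ q δ i →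
    q < (climb q δ i + δ) * (climb q δ i + δ) ⊎ climb q δ i ≡ nat i * δ
  climb-upper q δ zero = inj₂ (sym (ℚ.*-zeroˡ δ))
  climb-upper q δ (suc i) with (climb q δ i + δ) * (climb q δ i + δ) ℚ.≤? q | climb-upper q δ i
  ... | no  p | _      = inj₁ (ℚ.≰⇒> p)
  ... | yes p | inj₁ u = contradiction (ℚ.≤-<-trans p u) (ℚ.<-irrefl refl)
  ... | yes _ | inj₂ e = inj₂ (trans (cong (_+ δ) e)
    (trans (solve 2 (λ x δ → x :* δ :+ δ := (x :+ con 1ℚ) :* δ) refl (nat i) δ)
           (cong (_* δ) (sym (nat-suc i)))))

  root-nonNeg : ∀ q n → 0ℚ ≤ root q n
  root-nonNeg q n = climb-nonNeg q (0<mesh n) (suc n ℕ.* suc ℤ.∣ ℚ.↥ q ∣)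

  root-lower : ∀ q n → root q n * root q n ≤ q ⊔ 0ℚ
  root-lower q n = climb-lower q (mesh n) (suc n ℕ.* suc ℤ.∣ ℚ.↥ q ∣)

  ⊔0-< : ∀ {q x} → q < x → 0ℚ < x → q ⊔ 0ℚ < x
  ⊔0-< {q} {x} q<x 0<x with ℚ.⊔-sel q 0ℚ
  ... | inj₁ e = subst (_< x) (sym e) q<x
  ... | inj₂ e = subst (_< x) (sym e) 0<x

  climb-exceeds : ∀ q {δ} → 0ℚ < δ → ∀ i {c} → 1ℚ ≤ c → q < c → nat i * δ ≡ c →
                  q ⊔ 0ℚ < (climb q δ i + δ) * (climb q δ i + δ)
  climb-exceeds q {δ} 0<δ i {c} 1≤c q<c e =
    ⊔0-< ([ (λ u → u) , exhausted ]′ (climb-upper q δ i)) (0<* 0<s+δ 0<s+δ)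
    where
    0<s+δ : 0ℚ < climb q δ i + δ
    0<s+δ = ℚ.+-mono-≤-< (climb-nonNeg q 0<δ i) 0<δ

    0≤c : 0ℚ ≤ c
    0≤c = ℚ.≤-trans (ℚ.<⇒≤ (ℚ.positive⁻¹ 1ℚ)) 1≤c

    exhausted : climb q δ i ≡ nat i * δ → q < (climb q δ i + δ) * (climb q δ i + δ)
    exhausted s≡ = ℚ.<-≤-trans q<c (ℚ.≤-trans c≤c*c (*-mono-≤ 0≤c c≤s+δ 0≤c c≤s+δ))
      where
      c≤c*c : c ≤ c * c
      c≤c*c = subst (_≤ c * c) (ℚ.*-identityʳ c)
        (*-mono-≤ 0≤c ℚ.≤-refl (ℚ.<⇒≤ (ℚ.positive⁻¹ 1ℚ)) 1≤c)

      c≤s+δ : c ≤ climb q δ i + δ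
      c≤s+δ = subst₂ _≤_ (ℚ.+-identityʳ c) (cong (_+ δ) (sym (trans s≡ e)))
        (ℚ.+-monoʳ-≤ c (ℚ.<⇒≤ 0<δ))

  root-upper : ∀ q n → q ⊔ 0ℚ < (root q n + mesh n) * (root q n + mesh n)
  root-upper q n = climb-exceeds q (0<mesh n) (suc n ℕ.* suc ℤ.∣ ℚ.↥ q ∣)
    (1≤nat ℤ.∣ ℚ.↥ q ∣) (<nat q) (nat-*-mesh n (suc ℤ.∣ ℚ.↥ q ∣))

  IsCauchy : (ℕ → ℚ) → Set
  IsCauchy f = ∀ {ε} → 0ℚ < ε → ∃[ N ] (∀ i j → N ℕ.≤ i → N ℕ.≤ j → ∣ f i - f j ∣ < ε)

  ⊔≤ˡ : ∀ {a b i} → a ℕ.⊔ b ℕ.≤ i → a ℕ.≤ i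
  ⊔≤ˡ {a} {b} = ℕ.≤-trans (ℕ.m≤m⊔n a b)

  ⊔≤ʳ : ∀ {a b i} → a ℕ.⊔ b ℕ.≤ i → b ℕ.≤ i
  ⊔≤ʳ {a} {b} = ℕ.≤-trans (ℕ.m≤n⊔m a b)

  const-cauchy : ∀ q → IsCauchy (λ _ → q)
  const-cauchy q {ε} 0<ε = 0 , λ _ _ _ _ →
    subst (λ d → ∣ d ∣ < ε) (sym (ℚ.+-inverseʳ q)) 0<ε

  neg-cauchy : ∀ f → IsCauchy f → IsCauchy (λ n → - f n)
  neg-cauchy f cf {ε} 0<ε = let N , F = cf 0<ε in N , λ i j p q →
    subst (_< ε) (trans (∣-∣-swap (f i) (f j))
      (cong ∣_∣ (solve 2 (λ a b → b :- a := :- a :- :- b) refl (f i) (f j)))) (F i j p q)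

  ∣∣-cauchy : ∀ f → IsCauchy f → IsCauchy (λ n → ∣ f n ∣)
  ∣∣-cauchy f cf 0<ε = let N , F = cf 0<ε in N , λ i j p q →
    ℚ.≤-<-trans (∣∣-Lipschitz (f i) (f j)) (F i j p q)

  +-cauchy : ∀ f g → IsCauchy f → IsCauchy g → IsCauchy (λ n → f n + g n)
  +-cauchy f g cf cg {ε} 0<ε =
    let M , F = cf (0<* 0<½ 0<ε); N , G = cg (0<* 0<½ 0<ε)
    in M ℕ.⊔ N , λ i j p q → subst (∣ f i + g i - (f j + g j) ∣ <_) (half+half ε)
      (ℚ.≤-<-trans
        (subst (_≤ ∣ f i - f j ∣ + ∣ g i - g j ∣)
          (cong ∣_∣ (solve 4 (λ a b c d → a :- b :+ (c :- d) := a :+ c :- (b :+ d)) refl (f i) (f j) (g i) (g j)))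
          (ℚ.∣p+q∣≤∣p∣+∣q∣ (f i - f j) (g i - g j)))
        (ℚ.+-mono-< (F i j (⊔≤ˡ p) (⊔≤ˡ q)) (G i j (⊔≤ʳ p) (⊔≤ʳ q))))

  bounded : ∀ f → IsCauchy f → ∃[ B ] 0ℚ < B × ∃[ N ] (∀ i → N ℕ.≤ i → ∣ f i ∣ ≤ B)
  bounded f cf = let N , F = cf (ℚ.positive⁻¹ 1ℚ) in
    ∣ f N ∣ + 1ℚ , ℚ.+-mono-≤-< (ℚ.0≤∣p∣ (f N)) (ℚ.positive⁻¹ 1ℚ) , N , λ i p →
    ℚ.≤-trans
      (subst (λ a → ∣ a ∣ ≤ ∣ f N ∣ + ∣ f i - f N ∣)
        (solve 2 (λ a b → b :+ (a :- b) := a) refl (f i) (f N))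
        (ℚ.∣p+q∣≤∣p∣+∣q∣ (f N) (f i - f N)))
      (ℚ.+-monoʳ-≤ ∣ f N ∣ (ℚ.<⇒≤ (F i N p ℕ.≤-refl)))

  *-small : ∀ B ε {d} → 0ℚ < B → d < ½ * ε * recip B → B * d < ½ * ε
  *-small B ε {d} 0<B d< = subst (B * d <_)
    (trans (solve 3 (λ B e r → B :* (e :* r) := e :* (r :* B)) refl B (½ * ε) (recip B))
      (trans (cong (½ * ε *_) (recip-inverse (λ B≡0 → ℚ.<⇒≢ 0<B (sym B≡0)))) (ℚ.*-identityʳ (½ * ε))))
    (ℚ.*-monoʳ-<-pos B {{ℚ.positive 0<B}} d<)

  *-cauchy : ∀ f g → IsCauchy f → IsCauchy g → IsCauchy (λ n → f n * g n)
  *-cauchy f g cf cg {ε} 0<ε =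
    let A , 0<A , K , bf = bounded f cf
        B , 0<B , L , bg = bounded g cg
        M , F = cf {½ * ε * recip B} (0<* (0<* 0<½ 0<ε) (0<recip 0<B))
        N , G = cg {½ * ε * recip A} (0<* (0<* 0<½ 0<ε) (0<recip 0<A))
    in (K ℕ.⊔ L) ℕ.⊔ (M ℕ.⊔ N) , λ i j p q →
      subst (∣ f i * g i - f j * g j ∣ <_) (half+half ε)
        (ℚ.≤-<-trans
          (ℚ.≤-trans
            (subst (_≤ ∣ f i * (g i - g j) ∣ + ∣ g j * (f i - f j) ∣)
              (cong ∣_∣ (solve 4 (λ a b c d → a :* (c :- d) :+ d :* (a :- b) := a :* c :- b :* d)
                refl (f i) (f j) (g i) (g j)))
              (ℚ.∣p+q∣≤∣p∣+∣q∣ (f i * (g i - g j)) (g j * (f i - f j))))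
            (ℚ.+-mono-≤
              (scaled (bf i (⊔≤ˡ {K} {L} (⊔≤ˡ p))) (g i - g j))
              (scaled (bg j (⊔≤ʳ {K} {L} (⊔≤ˡ q))) (f i - f j))))
          (ℚ.+-mono-<
            (*-small A ε 0<A (G i j (⊔≤ʳ {M} {N} (⊔≤ʳ {K ℕ.⊔ L} p)) (⊔≤ʳ {M} {N} (⊔≤ʳ {K ℕ.⊔ L} q))))
            (*-small B ε 0<B (F i j (⊔≤ˡ {M} {N} (⊔≤ʳ {K ℕ.⊔ L} p)) (⊔≤ˡ {M} {N} (⊔≤ʳ {K ℕ.⊔ L} q))))))
    where
    scaled : ∀ {a C} → ∣ a ∣ ≤ C → ∀ d → ∣ a * d ∣ ≤ C * ∣ d ∣
    scaled {a} {C} a≤C d = subst (_≤ C * ∣ d ∣) (sym (ℚ.∣p*q∣≡∣p∣*∣q∣ a d))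
      (*-mono-≤ (ℚ.0≤∣p∣ a) a≤C (ℚ.0≤∣p∣ d) ℚ.≤-refl)

  IsPositive : (ℕ → ℚ) → Set
  IsPositive f = ∃[ δ ] 0ℚ < δ × ∃[ N ] (∀ n → N ℕ.≤ n → δ ≤ f n)

  recip-antitone : ∀ {δ a} → 0ℚ < δ → δ ≤ a → recip a ≤ recip δ
  recip-antitone {δ} {a} 0<δ δ≤a = subst₂ _≤_
    (trans (cong (_* recip a) (recip-inverse (≢0 0<δ))) (ℚ.*-identityˡ (recip a)))
    (trans (solve 3 (λ r s a → r :* a :* s := r :* (s :* a)) refl (recip δ) (recip a) a)
      (trans (cong (recip δ *_) (recip-inverse (≢0 0<a))) (ℚ.*-identityʳ (recip δ))))
    (*-mono-≤ (0≤* (ℚ.<⇒≤ (0<recip 0<δ)) (ℚ.<⇒≤ 0<δ))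
      (*-mono-≤ (ℚ.<⇒≤ (0<recip 0<δ)) ℚ.≤-refl (ℚ.<⇒≤ 0<δ) δ≤a)
      (ℚ.<⇒≤ (0<recip 0<a)) ℚ.≤-refl)
    where
    0<a = ℚ.<-≤-trans 0<δ δ≤a
    ≢0 : ∀ {p} → 0ℚ < p → p ≢ 0ℚ
    ≢0 0<p p≡0 = ℚ.<⇒≢ 0<p (sym p≡0)

  recip-cauchy : ∀ f → IsCauchy f → IsPositive f → IsCauchy (λ n → recip (f n))
  recip-cauchy f cf (δ , 0<δ , M , F) {ε} 0<ε =
    let N , G = cf {ε * (δ * δ)} (0<* 0<ε (0<* 0<δ 0<δ))
    in M ℕ.⊔ N , λ i j p q → bound i j (F i (⊔≤ˡ p)) (F j (⊔≤ˡ q)) (G i j (⊔≤ʳ p) (⊔≤ʳ q))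
    where
    open ℚ.≤-Reasoning
    bound : ∀ i j → δ ≤ f i → δ ≤ f j → ∣ f i - f j ∣ < ε * (δ * δ) →
            ∣ recip (f i) - recip (f j) ∣ < ε
    bound i j δ≤a δ≤b close = begin-strict
      ∣ r - s ∣             ≡⟨ cong ∣_∣ difference ⟩
      ∣ r * s * (b - a) ∣   ≡⟨ ℚ.∣p*q∣≡∣p∣*∣q∣ (r * s) (b - a) ⟩
      ∣ r * s ∣ * ∣ b - a ∣ ≡⟨ cong₂ _*_ (ℚ.0≤p⇒∣p∣≡p (0≤* 0≤r 0≤s)) (∣-∣-swap b a) ⟩
      r * s * ∣ a - b ∣     ≤⟨ *-mono-≤ (0≤* 0≤r 0≤s)
                                 (*-mono-≤ 0≤r (recip-antitone 0<δ δ≤a) 0≤s (recip-antitone 0<δ δ≤b))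
                                 (ℚ.0≤∣p∣ (a - b)) ℚ.≤-refl ⟩
      t * t * ∣ a - b ∣     <⟨ ℚ.*-monoʳ-<-pos (t * t) {{ℚ.positive (0<* 0<t 0<t)}} close ⟩
      t * t * (ε * (δ * δ)) ≡⟨ solve 3 (λ t e d → t :* t :* (e :* (d :* d)) := e :* ((t :* d) :* (t :* d)))
                                 refl t ε δ ⟩
      ε * (t * δ * (t * δ)) ≡⟨ cong (λ u → ε * (u * u)) (recip-inverse (≢0 0<δ)) ⟩
      ε * (1ℚ * 1ℚ)         ≡⟨ ℚ.*-identityʳ ε ⟩
      ε                     ∎
      where
      ≢0 : ∀ {p} → 0ℚ < p → p ≢ 0ℚ
      ≢0 0<p p≡0 = ℚ.<⇒≢ 0<p (sym p≡0)
      a = f i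
      b = f j
      r = recip a
      s = recip b
      t = recip δ
      0<t = 0<recip 0<δ
      0<a = ℚ.<-≤-trans 0<δ δ≤a
      0<b = ℚ.<-≤-trans 0<δ δ≤b
      0≤r = ℚ.<⇒≤ (0<recip 0<a)
      0≤s = ℚ.<⇒≤ (0<recip 0<b)
      difference : r - s ≡ r * s * (b - a)
      difference = trans
        (cong₂ _-_ (trans (sym (ℚ.*-identityʳ r)) (cong (r *_) (sym (recip-inverse (≢0 0<b)))))
                   (trans (sym (ℚ.*-identityʳ s)) (cong (s *_) (sym (recip-inverse (≢0 0<a))))))
        (solve 4 (λ r s a b → r :* (s :* b) :- s :* (r :* a) := r :* s :* (b :- a)) refl r s a b)

  root-cauchy : ∀ f → IsCauchy f → IsCauchy (λ n → root (f n) n)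
  root-cauchy f cf {ε} 0<ε =
    let M , F = cf {h * h} (0<* 0<h 0<h)
        N , G = archimedean 0<h
    in M ℕ.⊔ N , λ i j p q → ∣∣<
      (below i j (G j (⊔≤ʳ q)) (F i j (⊔≤ˡ p) (⊔≤ˡ q)))
      (below j i (G i (⊔≤ʳ p)) (F j i (⊔≤ˡ q) (⊔≤ˡ p)))
    where
    open ℚ.≤-Reasoning
    h = ½ * ε
    0<h = 0<* 0<½ 0<ε

    close⇒ : ∀ a b → ∣ a - b ∣ < h * h → a ⊔ 0ℚ < (b ⊔ 0ℚ) + h * h
    close⇒ a b close = ⊔0-<
      (begin-strict
        a                  ≡⟨ solve 2 (λ a b → a := b :+ (a :- b)) refl a b ⟩
        b + (a - b)        ≤⟨ ℚ.+-monoʳ-≤ b (≤∣∣ (a - b)) ⟩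
        b + ∣ a - b ∣      <⟨ ℚ.+-monoʳ-< b close ⟩
        b + h * h          ≤⟨ ℚ.+-monoˡ-≤ (h * h) (ℚ.p≤p⊔q b 0ℚ) ⟩
        (b ⊔ 0ℚ) + h * h   ∎)
      (ℚ.+-mono-≤-< (ℚ.p≤q⊔p b 0ℚ) (0<* 0<h 0<h))

    below : ∀ i j → mesh j < h → ∣ f i - f j ∣ < h * h → root (f i) i < root (f j) j + ε
    below i j mesh<h close = ℚ.≰⇒> λ far → ℚ.<-irrefl refl (begin-strict
      (f j ⊔ 0ℚ) + h * h
        <⟨ ℚ.+-monoˡ-< (h * h) (root-upper (f j) j) ⟩
      (r + mesh j) * (r + mesh j) + h * h
        ≤⟨ ℚ.+-monoˡ-≤ (h * h) (*-mono-≤ 0≤r+mesh r+mesh≤ 0≤r+mesh r+mesh≤) ⟩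
      (r + h) * (r + h) + h * h
        ≡⟨ ℚ.+-identityʳ _ ⟨
      (r + h) * (r + h) + h * h + 0ℚ
        ≤⟨ ℚ.+-monoʳ-≤ ((r + h) * (r + h) + h * h) (0≤* 0≤h+h 0≤r+h) ⟩
      (r + h) * (r + h) + h * h + (h + h) * (r + h)
        ≡⟨ solve 2 (λ r h → (r :+ h) :* (r :+ h) :+ h :* h :+ (h :+ h) :* (r :+ h)
                         := (r :+ (h :+ h)) :* (r :+ (h :+ h))) refl r h ⟩
      (r + (h + h)) * (r + (h + h))
        ≡⟨ cong (λ e → (r + e) * (r + e)) (half+half ε) ⟩
      (r + ε) * (r + ε)
        ≤⟨ *-mono-≤ 0≤r+ε far 0≤r+ε far ⟩
      root (f i) i * root (f i) i
        ≤⟨ root-lower (f i) i ⟩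
      f i ⊔ 0ℚ
        <⟨ close⇒ (f i) (f j) close ⟩
      (f j ⊔ 0ℚ) + h * h ∎)
      where
      r = root (f j) j
      0≤r = root-nonNeg (f j) j
      0≤h+h = ℚ.+-mono-≤ (ℚ.<⇒≤ 0<h) (ℚ.<⇒≤ 0<h)
      0≤r+h = ℚ.+-mono-≤ 0≤r (ℚ.<⇒≤ 0<h)
      0≤r+ε = ℚ.+-mono-≤ 0≤r (ℚ.<⇒≤ 0<ε)
      0≤r+mesh = ℚ.+-mono-≤ 0≤r (ℚ.<⇒≤ (0<mesh j))
      r+mesh≤ = ℚ.+-monoʳ-≤ r (ℚ.<⇒≤ mesh<h)

  root-positive : ∀ f → IsPositive f → IsPositive (λ n → root (f n) n)
  root-positive f (δ , 0<δ , M , F) =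
    let N , G = archimedean 0<h
    in h , 0<h , M ℕ.⊔ N , λ n p → ℚ.≮⇒≥ λ r<h → ℚ.<-irrefl refl (begin-strict
      f n                                               ≤⟨ ℚ.p≤p⊔q (f n) 0ℚ ⟩
      f n ⊔ 0ℚ                                          <⟨ root-upper (f n) n ⟩
      (root (f n) n + mesh n) * (root (f n) n + mesh n)
        ≤⟨ *-mono-≤ (0≤r+mesh n) (r+mesh≤ n r<h (G n (⊔≤ʳ p))) (0≤r+mesh n) (r+mesh≤ n r<h (G n (⊔≤ʳ p))) ⟩
      (h + h) * (h + h)                                 ≡⟨ cong (λ c → c * c) (half+half (δ ⊓ 1ℚ)) ⟩
      (δ ⊓ 1ℚ) * (δ ⊓ 1ℚ)
        ≤⟨ *-mono-≤ (ℚ.<⇒≤ 0<m) (ℚ.p⊓q≤p δ 1ℚ) (ℚ.<⇒≤ 0<m) (ℚ.p⊓q≤q δ 1ℚ) ⟩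
      δ * 1ℚ                                            ≡⟨ ℚ.*-identityʳ δ ⟩
      δ                                                 ≤⟨ F n (⊔≤ˡ p) ⟩
      f n                                               ∎)
    where
    open ℚ.≤-Reasoning
    h = ½ * (δ ⊓ 1ℚ)
    0<m : 0ℚ < δ ⊓ 1ℚ
    0<m with ℚ.⊓-sel δ 1ℚ
    ... | inj₁ e = subst (0ℚ <_) (sym e) 0<δ
    ... | inj₂ e = subst (0ℚ <_) (sym e) (ℚ.positive⁻¹ 1ℚ)
    0<h = 0<* 0<½ 0<m
    0≤r+mesh : ∀ n → 0ℚ ≤ root (f n) n + mesh n
    0≤r+mesh n = ℚ.+-mono-≤ (root-nonNeg (f n) n) (ℚ.<⇒≤ (0<mesh n))
    r+mesh≤ : ∀ n → root (f n) n < h → mesh n < h → root (f n) n + mesh n ≤ h + h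
    r+mesh≤ n r<h mesh<h = ℚ.+-mono-≤ (ℚ.<⇒≤ r<h) (ℚ.<⇒≤ mesh<h)

  square+positive : ∀ (f : ℕ → ℚ) {c} → 0ℚ < c → IsPositive (λ n → f n * f n + c)
  square+positive f {c} 0<c = c , 0<c , 0 , λ n _ →
    subst (_≤ f n * f n + c) (ℚ.+-identityˡ c) (ℚ.+-monoˡ-≤ c (0≤square (f n)))

open Rational using (IsCauchy; IsPositive)

-- Real numbers are Cauchy sequences of rationals compared by _≃_, not _≡_.
record ℝ : Set where
  constructor mkℝ
  field
    seq    : ℕ → ℚ
    cauchy : IsCauchy seq

open ℝ public

infix  8 -_ √_ 1/_
infixl 7 _*_ _/_[_]
infixl 6 _+_ _-_
infix  4 _≃_ _≤_ _⟶_

_≃_ : ℝ → ℝ → Set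
x ≃ y = ∀ {ε} → 0ℚ ℚ.< ε → ∃[ N ] (∀ n → N ℕ.≤ n → ℚ.∣ seq x n ℚ.- seq y n ∣ ℚ.< ε)

_≤_ : ℝ → ℝ → Set
x ≤ y = ∀ {ε} → 0ℚ ℚ.< ε → ∃[ N ] (∀ n → N ℕ.≤ n → seq x n ℚ.≤ seq y n ℚ.+ ε)

Positive : ℝ → Set
Positive x = IsPositive (seq x)

fromℚ : ℚ → ℝ
fromℚ q = mkℝ (λ _ → q) (Rational.const-cauchy q)

1ℝ ½ℝ : ℝ
1ℝ = fromℚ 1ℚ
½ℝ = fromℚ ½

_+_ _*_ : ℝ → ℝ → ℝ
x + y = mkℝ (λ n → seq x n ℚ.+ seq y n) (Rational.+-cauchy (seq x) (seq y) (cauchy x) (cauchy y))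
x * y = mkℝ (λ n → seq x n ℚ.* seq y n) (Rational.*-cauchy (seq x) (seq y) (cauchy x) (cauchy y))

-_ : ℝ → ℝ
- x = mkℝ (λ n → ℚ.- seq x n) (Rational.neg-cauchy (seq x) (cauchy x))

∣_∣ : ℝ → ℝ
∣ x ∣ = mkℝ (λ n → ℚ.∣ seq x n ∣) (Rational.∣∣-cauchy (seq x) (cauchy x))

_-_ : ℝ → ℝ → ℝ
x - y = x + (- y)

-- Total: the square root of the maximum of x and 0, by root-nonNeg, root-lower
-- and root-upper.
√_ : ℝ → ℝ
√ x = mkℝ (λ n → Rational.root (seq x n) n) (Rational.root-cauchy (seq x) (cauchy x))

√-positive : ∀ x → Positive x → Positive (√ x)
√-positive x = Rational.root-positive (seq x)

_/_[_] : ∀ x y → Positive y → ℝ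
x / y [ y>0 ] = x * mkℝ (λ n → Rational.recip (seq y n)) (Rational.recip-cauchy (seq y) (cauchy y) y>0)

∏ : ℕ → (ℕ → ℝ) → ℝ
∏ zero    f = 1ℝ
∏ (suc n) f = ∏ n f * f n

syntax ∏ n (λ k → e) = ∏[ k < n ] e

_⟶_ : (ℕ → ℝ) → ℝ → Set
a ⟶ L = ∀ {ε} → 0ℚ ℚ.< ε → ∃[ N ] (∀ n → N ℕ.≤ n → ∣ a n - L ∣ ≤ fromℚ ε)

HasDerivativeAt : (ℝ → ℝ) → ℝ → ℝ → Set
HasDerivativeAt f x d = ∀ {ε} → 0ℚ ℚ.< ε → ∃[ δ ] 0ℚ ℚ.< δ ×
  (∀ y → ∣ y - x ∣ ≤ fromℚ δ → ∣ f y - f x - d * (y - x) ∣ ≤ fromℚ ε * ∣ y - x ∣)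

1/_ : ∀ m .{{_ : NonTrivial m}} → ℚ
1/ m = (+ 1 ℚ./ m) {{ℕ.nonTrivial⇒nonZero m}}

0<1/ : ∀ m .{{_ : NonTrivial m}} → 0ℚ ℚ.< 1/ m
0<1/ (suc m) = Rational.0<mesh m

discriminant : ∀ m .{{_ : NonTrivial m}} → ℝ → ℝ
discriminant m v = (1ℝ - v) * (1ℝ - v) + fromℚ (1/ m)

discriminant-positive : ∀ m .{{_ : NonTrivial m}} v → Positive (discriminant m v)
discriminant-positive m v = Rational.square+positive (seq (1ℝ - v)) (0<1/ m)

-- Ψ_r at r = 1/(4m).
Ψ : ∀ m .{{_ : NonTrivial m}} → ℝ → ℝ
Ψ m v = ½ℝ * (1ℝ + v - √ (discriminant m v))

w : ∀ m .{{_ : NonTrivial m}} → ℕ → ℝ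
w m zero    = ½ℝ
w m (suc k) = Ψ m (w m k)

explicitFactor : ∀ m .{{_ : NonTrivial m}} → ℝ → ℝ
explicitFactor m v =
  ½ℝ * (1ℝ + (1ℝ - v) / √ (discriminant m v) [ √-positive (discriminant m v) (discriminant-positive m v) ])

{-# OPTIONS --safe #-}

-- Let F_k(z) = Σ_n (g_n^{(k)} + ⋯ + g_n^{(m-1)}) (z/4m)^n, so that F_0 = z/4 + F_0²
-- and, for k < m-1, D_k := F_k - F_{k+1} = z/(4m) + D_k F_{k+1}.  At z = 1 this
-- quadratic relation reads F_{k+1}(1) = Ψ(F_k(1)), and F_0(1) = 1/2, so F_k(1) = w_k.
-- No singularity analysis is needed for the coefficients: those a_n of F_0 satisfy
-- (n+1) a_{n+1} = (n-1/2) a_n, hence a_{n+1}/a_n → 1, and a ⊛ a = a beyond degree 1,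
-- so in a convolution of two sequences dominated by a only the two ends matter.
-- If [zⁿ]F_k ~ s a_n, the relation for D_k expresses u_n = [zⁿ]F_{k+1} - t a_n, where
-- t = s (1-F_{k+1})/(1-F_{k+1}+D_k) at z = 1, as a combination of earlier u_i up to
-- o(a_n), with coefficients of total mass at most F_k(1) ≤ 1/2: a contraction, whence
-- u_n = o(a_n).  The factor t/s is Ψ′(w_k).
module Submission where

open import Data.Fin.Base as Fin using (Fin; toℕ; fromℕ<)
import Data.Fin.Properties as Fin
open import Data.Integer.Base as ℤ using ()
import Data.Integer.Properties as ℤ
open import Data.List.Base as List
  using (List; []; _∷_; _++_; map; concatMap; cartesianProduct; cartesianProductWith; filter; length; allFin; tabulate)
import Data.List.Properties as List
open import Data.Nat.Base as ℕ using (ℕ; zero; suc; z≤n; s≤s; NonZero; NonTrivial)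
open import Data.Nat.Induction using (<-rec)
open import Data.Nat.ListAction using (sum)
import Data.Nat.Properties as ℕ
open import Data.Product.Base using (Σ-syntax; ∃-syntax; ∃₂; _×_; _,_; proj₁; proj₂)
open import Data.Rational.Base as ℚ using (ℚ; 0ℚ; 1ℚ; ½)
import Data.Rational.Properties as ℚ
open import Data.Rational.Solver using (module +-*-Solver)
import Data.Rational.Unnormalised.Base as ℚᵘ
import Data.Rational.Unnormalised.Properties as ℚᵘ
open import Data.Sum.Base using (inj₁; inj₂)
open import Data.Vec.Base as Vec using (Vec; []; _∷_)
open import Relation.Binary.Bundles using (Preorder)
open import Relation.Binary.Definitions using (tri<; tri≈; tri>)
import Relation.Binary.Reasoning.Preorder as PreorderReasoning
open import Relation.Binary.PropositionalEquality hiding ([_])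
open import Relation.Nullary using (Dec; yes; no; contradiction)
open import Defs using (module Rational; Bracketing; leaf; _⇒_; _⇒ᴳ_; top; eval; valuations; splits; atoms;
  bracketings≤; join; bracketings; g; total; total-nonZero; topShare; 1/_; 0<1/)

-- The ratios s and t are irrational in general and given only by Cauchy sequences, while the
-- coefficient estimates are run over the rationals. So equivalence to a multiple of `a` is replaced
-- by `Near`: a rational ratio with a fixed tolerance ε. One index K then plays three roles: it is
-- the length of the two ends of a convolution, the degree at which the values at z = 1 are cut off,
-- and the index of the rational approximant of the ratio. With this choice the relation between s
-- and t holds exactly at every K, so the only truncation error is the middle of the convolution,
-- which `tail K` controls. The contraction compares the error at n with errors at n - i for i up to
-- K. A limsup that is at most 3/4 of itself plus O(ε) is avoided: the trivial bound is improved in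
-- finitely many rounds, each valid from a later index on.

-- Inequalities between rationals

module Order where
  open import Data.Rational.Base using (_+_; _-_; _*_; -_; _≤_; _<_; ∣_∣)
  open +-*-Solver using (solve; _:=_; _:+_; _:*_; _:-_; :-_; con)
  open Rational

  -- Inequalities below are mostly certificates: an explicit excess e, an identity b = a + e left to
  -- the ring solver, and nonnegativity of e assembled from `gap`, `_⊕_` and `_⊗_`.
  slack : ∀ {a b e} → 0ℚ ≤ e → b ≡ a + e → a ≤ b
  slack {a} {b} {e} 0≤e eq = subst₂ _≤_ (ℚ.+-identityʳ a) (sym eq) (ℚ.+-monoʳ-≤ a 0≤e)

  gap : ∀ {a b} → a ≤ b → 0ℚ ≤ b - a
  gap {a} {b} a≤b = subst (_≤ b - a) (ℚ.+-inverseʳ a) (ℚ.+-monoˡ-≤ (- a) a≤b)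

  infixl 6 _⊕_
  infixl 7 _⊗_

  _⊕_ : ∀ {a b} → 0ℚ ≤ a → 0ℚ ≤ b → 0ℚ ≤ a + b
  _⊕_ = ℚ.+-mono-≤

  _⊗_ : ∀ {a b} → 0ℚ ≤ a → 0ℚ ≤ b → 0ℚ ≤ a * b
  _⊗_ = 0≤*

  0≤1 : 0ℚ ≤ 1ℚ
  0≤1 = ℚ.nonNegative⁻¹ 1ℚ

  0≤½ : 0ℚ ≤ ½
  0≤½ = ℚ.nonNegative⁻¹ ½

  ∣∣≤ : ∀ {a b} → a ≤ b → - a ≤ b → ∣ a ∣ ≤ b
  ∣∣≤ {a} p q with ℚ.∣p∣≡p∨∣p∣≡-p a
  ... | inj₁ e = subst (_≤ _) (sym e) p
  ... | inj₂ e = subst (_≤ _) (sym e) q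

  ∣-∣≤⇒≤ : ∀ {a b c} → ∣ a - b ∣ ≤ c → a ≤ b + c
  ∣-∣≤⇒≤ {a} {b} {c} p = slack (gap (ℚ.≤-trans (≤∣∣ (a - b)) p))
    (solve 3 (λ a b c → b :+ c := a :+ (c :- (a :- b))) refl a b c)

  infixl 6 _⊞_
  _⊞_ : ∀ {x y d e} → ∣ x ∣ ≤ d → ∣ y ∣ ≤ e → ∣ x + y ∣ ≤ d + e
  _⊞_ {x} {y} p q = ℚ.≤-trans (ℚ.∣p+q∣≤∣p∣+∣q∣ x y) (ℚ.+-mono-≤ p q)

  ∣∣-neg : ∀ {x e} → ∣ x ∣ ≤ e → ∣ - x ∣ ≤ e
  ∣∣-neg {x} = subst (_≤ _) (sym (ℚ.∣-p∣≡∣p∣ x))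

  ∣∣-bound : ∀ {x e} → 0ℚ ≤ x → x ≤ e → ∣ x ∣ ≤ e
  ∣∣-bound 0≤x x≤e = subst (_≤ _) (sym (ℚ.0≤p⇒∣p∣≡p 0≤x)) x≤e

  *-cancel-≤ : ∀ {a b c} → 0ℚ < c → a * c ≤ b * c → a ≤ b
  *-cancel-≤ {c = c} 0<c = ℚ.*-cancelʳ-≤-pos c {{ℚ.positive 0<c}}

  *-cancel-≡ : ∀ {a b c} → 0ℚ < c → a * c ≡ b * c → a ≡ b
  *-cancel-≡ 0<c e = ℚ.≤-antisym (*-cancel-≤ 0<c (ℚ.≤-reflexive e)) (*-cancel-≤ 0<c (ℚ.≤-reflexive (sym e)))

  square-cancel-≤ : ∀ {a b} → 0ℚ ≤ b → a * a ≤ b * b → a ≤ b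
  square-cancel-≤ {a} {b} 0≤b p = ℚ.≮⇒≥ λ b<a → ℚ.<-irrefl refl
    (ℚ.<-≤-trans (ℚ.≤-<-trans (*-mono-≤ 0≤b ℚ.≤-refl 0≤b (ℚ.<⇒≤ b<a))
      (ℚ.*-monoˡ-<-pos a {{ℚ.positive (ℚ.≤-<-trans 0≤b b<a)}} b<a)) p)

  0<nat : ∀ n → 0ℚ < nat (suc n)
  0<nat n = ℚ.<-≤-trans (ℚ.positive⁻¹ 1ℚ) (1≤nat n)

  0≤nat : ∀ n → 0ℚ ≤ nat n
  0≤nat zero    = ℚ.≤-refl
  0≤nat (suc n) = ℚ.<⇒≤ (0<nat n)

  mesh-inverse : ∀ n → nat (suc n) * mesh n ≡ 1ℚ
  mesh-inverse n = trans (cong (λ k → nat k * mesh n) (sym (ℕ.*-identityʳ (suc n)))) (nat-*-mesh n 1)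

  nat-∸ : ∀ {i n} → i ℕ.≤ n → nat i + nat (n ℕ.∸ i) ≡ nat n
  nat-∸ {i} {zero}  z≤n = refl
  nat-∸ {zero} {suc n} z≤n = ℚ.+-identityˡ _
  nat-∸ {suc i} {suc n} (s≤s p) = begin
    nat (suc i) + nat (n ℕ.∸ i)   ≡⟨ cong (_+ nat (n ℕ.∸ i)) (nat-suc i) ⟩
    nat i + 1ℚ + nat (n ℕ.∸ i)    ≡⟨ solve 2 (λ x y → x :+ con 1ℚ :+ y := x :+ y :+ con 1ℚ) refl (nat i) _ ⟩
    nat i + nat (n ℕ.∸ i) + 1ℚ    ≡⟨ cong (_+ 1ℚ) (nat-∸ p) ⟩
    nat n + 1ℚ                    ≡⟨ nat-suc n ⟨
    nat (suc n)                   ∎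
    where open ≡-Reasoning

  nat-+ : ∀ i j → nat (i ℕ.+ j) ≡ nat i + nat j
  nat-+ zero    j = sym (ℚ.+-identityˡ (nat j))
  nat-+ (suc i) j = begin
    nat (suc (i ℕ.+ j))  ≡⟨ nat-suc (i ℕ.+ j) ⟩
    nat (i ℕ.+ j) + 1ℚ   ≡⟨ cong (_+ 1ℚ) (nat-+ i j) ⟩
    nat i + nat j + 1ℚ   ≡⟨ solve 2 (λ i j → i :+ j :+ con 1ℚ := i :+ con 1ℚ :+ j) refl (nat i) (nat j) ⟩
    nat i + 1ℚ + nat j   ≡⟨ cong (_+ nat j) (nat-suc i) ⟨
    nat (suc i) + nat j  ∎
    where open ≡-Reasoning

  nat-mono : ∀ {i k} → i ℕ.≤ k → nat i ≤ nat k
  nat-mono {k = k} z≤n = 0≤nat k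
  nat-mono {suc i} {suc k} (s≤s p) = subst₂ _≤_ (sym (nat-suc i)) (sym (nat-suc k)) (ℚ.+-monoˡ-≤ 1ℚ (nat-mono p))

  mesh-antitone : ∀ n → mesh (suc n) ≤ mesh n
  mesh-antitone n = *-cancel-≤ (0<nat (suc n)) (slack (ℚ.<⇒≤ (0<mesh n)) (begin
    mesh n * nat (suc (suc n))  ≡⟨ cong (mesh n *_) (nat-suc (suc n)) ⟩
    mesh n * (nat (suc n) + 1ℚ) ≡⟨ solve 2 (λ m k → m :* (k :+ con 1ℚ) := k :* m :+ m) refl (mesh n) (nat (suc n)) ⟩
    nat (suc n) * mesh n + mesh n ≡⟨ cong (_+ mesh n)
        (trans (mesh-inverse n) (trans (sym (mesh-inverse (suc n))) (ℚ.*-comm (nat (suc (suc n))) (mesh (suc n))))) ⟩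
    mesh (suc n) * nat (suc (suc n)) + mesh n ∎))
    where open ≡-Reasoning

  mesh-antitone⁺ : ∀ n k → mesh (k ℕ.+ n) ≤ mesh n
  mesh-antitone⁺ n zero    = ℚ.≤-refl
  mesh-antitone⁺ n (suc k) = ℚ.≤-trans (mesh-antitone (k ℕ.+ n)) (mesh-antitone⁺ n k)

-- Finite sums and convolution

module Sums where
  open import Data.Rational.Base using (_+_; _-_; _*_; -_; _≤_; _<_; ∣_∣)
  open +-*-Solver using (solve; _:=_; _:+_; _:*_; _:-_; :-_; con)
  open Rational
  open Order

  ∑ : ℕ → (ℕ → ℚ) → ℚ
  ∑ zero    x = x 0
  ∑ (suc n) x = ∑ n x + x (suc n)

  ∑-cong : ∀ n {x y} → (∀ i → i ℕ.≤ n → x i ≡ y i) → ∑ n x ≡ ∑ n y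
  ∑-cong zero    e = e 0 z≤n
  ∑-cong (suc n) e = cong₂ _+_ (∑-cong n (λ i p → e i (ℕ.m≤n⇒m≤1+n p))) (e (suc n) ℕ.≤-refl)

  ∑-mono : ∀ n {x y} → (∀ i → i ℕ.≤ n → x i ≤ y i) → ∑ n x ≤ ∑ n y
  ∑-mono zero    e = e 0 z≤n
  ∑-mono (suc n) e = ℚ.+-mono-≤ (∑-mono n (λ i p → e i (ℕ.m≤n⇒m≤1+n p))) (e (suc n) ℕ.≤-refl)

  ∑-+ : ∀ n x y → ∑ n (λ i → x i + y i) ≡ ∑ n x + ∑ n y
  ∑-+ zero    x y = refl
  ∑-+ (suc n) x y = trans (cong (_+ (x (suc n) + y (suc n))) (∑-+ n x y))
    (solve 4 (λ a b c d → a :+ b :+ (c :+ d) := a :+ c :+ (b :+ d)) refl (∑ n x) (∑ n y) (x (suc n)) (y (suc n)))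

  ∑-* : ∀ n c x → ∑ n (λ i → c * x i) ≡ c * ∑ n x
  ∑-* zero    c x = refl
  ∑-* (suc n) c x = trans (cong (_+ c * x (suc n)) (∑-* n c x)) (sym (ℚ.*-distribˡ-+ c (∑ n x) (x (suc n))))

  ∑-neg : ∀ n x → ∑ n (λ i → - x i) ≡ - ∑ n x
  ∑-neg zero    x = refl
  ∑-neg (suc n) x = trans (cong (_+ - x (suc n)) (∑-neg n x)) (sym (ℚ.neg-distrib-+ (∑ n x) (x (suc n))))

  ∑-- : ∀ n x y → ∑ n (λ i → x i - y i) ≡ ∑ n x - ∑ n y
  ∑-- n x y = trans (∑-+ n x (λ i → - y i)) (cong (∑ n x +_) (∑-neg n y))

  ∑-zero : ∀ n {x} → (∀ i → i ℕ.≤ n → x i ≡ 0ℚ) → ∑ n x ≡ 0ℚ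
  ∑-zero zero    e = e 0 z≤n
  ∑-zero (suc n) e = cong₂ _+_ (∑-zero n (λ i p → e i (ℕ.m≤n⇒m≤1+n p))) (e (suc n) ℕ.≤-refl)

  ∑-nonNeg : ∀ n {x} → (∀ i → 0ℚ ≤ x i) → 0ℚ ≤ ∑ n x
  ∑-nonNeg zero    e = e 0
  ∑-nonNeg (suc n) e = ∑-nonNeg n e ⊕ e (suc n)

  ∑-head : ∀ n x → ∑ (suc n) x ≡ x 0 + ∑ n (λ i → x (suc i))
  ∑-head zero    x = refl
  ∑-head (suc n) x = trans (cong (_+ x (suc (suc n))) (∑-head n x)) (ℚ.+-assoc (x 0) _ _)

  ∑-reverse : ∀ n x → ∑ n x ≡ ∑ n (λ i → x (n ℕ.∸ i))
  ∑-reverse zero    x = refl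
  ∑-reverse (suc n) x = sym (trans (∑-head n (λ i → x (suc n ℕ.∸ i)))
    (trans (cong (x (suc n) +_) (sym (∑-reverse n x))) (ℚ.+-comm (x (suc n)) (∑ n x))))

  ∣∑∣ : ∀ n x → ∣ ∑ n x ∣ ≤ ∑ n (λ i → ∣ x i ∣)
  ∣∑∣ zero    x = ℚ.≤-refl
  ∣∑∣ (suc n) x = ℚ.≤-trans (ℚ.∣p+q∣≤∣p∣+∣q∣ (∑ n x) (x (suc n))) (ℚ.+-monoˡ-≤ ∣ x (suc n) ∣ (∣∑∣ n x))

  infixl 7 _⊛_
  _⊛_ : (ℕ → ℚ) → (ℕ → ℚ) → ℕ → ℚ
  (x ⊛ y) n = ∑ n (λ i → x i * y (n ℕ.∸ i))

  ⊛-comm : ∀ x y n → (x ⊛ y) n ≡ (y ⊛ x) n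
  ⊛-comm x y n = trans (∑-reverse n _) (∑-cong n λ i p →
    trans (cong (λ k → x (n ℕ.∸ i) * y k) (ℕ.m∸[m∸n]≡n p)) (ℚ.*-comm (x (n ℕ.∸ i)) (y i)))

  -- Taking partial sums is multiplication by 1/(1 - z), which may be moved onto one factor of a
  -- product.
  ∑-⊛ : ∀ x y n → ∑ n (x ⊛ y) ≡ (x ⊛ λ k → ∑ k y) n
  ∑-⊛ x y zero    = refl
  ∑-⊛ x y (suc n) = begin
    ∑ n (x ⊛ y) + (x ⊛ y) (suc n)
      ≡⟨ cong (_+ (x ⊛ y) (suc n)) (∑-⊛ x y n) ⟩
    ∑ n (λ i → x i * Y (n ℕ.∸ i)) + (∑ n (λ i → x i * y (suc n ℕ.∸ i)) + x (suc n) * y (n ℕ.∸ n))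
      ≡⟨ ℚ.+-assoc (∑ n (λ i → x i * Y (n ℕ.∸ i))) _ _ ⟨
    ∑ n (λ i → x i * Y (n ℕ.∸ i)) + ∑ n (λ i → x i * y (suc n ℕ.∸ i)) + x (suc n) * y (n ℕ.∸ n)
      ≡⟨ cong₂ _+_ (sym (∑-+ n (λ i → x i * Y (n ℕ.∸ i)) (λ i → x i * y (suc n ℕ.∸ i))))
                   (cong (x (suc n) *_) last) ⟩
    ∑ n (λ i → x i * Y (n ℕ.∸ i) + x i * y (suc n ℕ.∸ i)) + x (suc n) * Y (n ℕ.∸ n)
      ≡⟨ cong (_+ x (suc n) * Y (n ℕ.∸ n)) (∑-cong n step) ⟩
    ∑ n (λ i → x i * Y (suc n ℕ.∸ i)) + x (suc n) * Y (n ℕ.∸ n) ∎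
    where
    open ≡-Reasoning
    Y : ℕ → ℚ
    Y k = ∑ k y
    last : y (n ℕ.∸ n) ≡ Y (n ℕ.∸ n)
    last rewrite ℕ.n∸n≡0 n = refl
    step : ∀ i → i ℕ.≤ n → x i * Y (n ℕ.∸ i) + x i * y (suc n ℕ.∸ i) ≡ x i * Y (suc n ℕ.∸ i)
    step i p rewrite ℕ.+-∸-assoc 1 p = sym (ℚ.*-distribˡ-+ (x i) (Y (n ℕ.∸ i)) (y (suc (n ℕ.∸ i))))

  -- Termwise domination bounds every block of the sum; this transfers convergence from `a` to all
  -- the series and compares their Cauchy products.
  ∑-diff : ∀ {x y} → (∀ n → 0ℚ ≤ x n) → (∀ n → x n ≤ y n) → ∀ {i j} → i ℕ.≤ j →
           0ℚ ≤ ∑ j x - ∑ i x × ∑ j x - ∑ i x ≤ ∑ j y - ∑ i y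
  ∑-diff {x} {y} 0≤x x≤y {i} {j} p = subst
    (λ j → 0ℚ ≤ ∑ j x - ∑ i x × ∑ j x - ∑ i x ≤ ∑ j y - ∑ i y) (ℕ.m∸n+n≡m p) (go (j ℕ.∸ i))
    where
    go : ∀ k → 0ℚ ≤ ∑ (k ℕ.+ i) x - ∑ i x × ∑ (k ℕ.+ i) x - ∑ i x ≤ ∑ (k ℕ.+ i) y - ∑ i y
    go zero = ℚ.≤-reflexive (sym (ℚ.+-inverseʳ (∑ i x))) ,
      ℚ.≤-reflexive (trans (ℚ.+-inverseʳ (∑ i x)) (sym (ℚ.+-inverseʳ (∑ i y))))
    go (suc k) = let l , u = go k; z = suc (k ℕ.+ i) in
      ℚ.≤-trans l (slack (0≤x z) (solve 3 (λ s t u → s :+ u :- t := s :- t :+ u) refl (∑ (k ℕ.+ i) x) (∑ i x) (x z))) ,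
      slack (gap u ⊕ gap (x≤y z)) (solve 6 (λ s t u s′ t′ u′ → s′ :+ u′ :- t′ := s :+ u :- t :+
          (s′ :- t′ :- (s :- t) :+ (u′ :- u))) refl
        (∑ (k ℕ.+ i) x) (∑ i x) (x z) (∑ (k ℕ.+ i) y) (∑ i y) (y z))

  weighted : (ℕ → ℚ) → ℕ → ℚ
  weighted x n = nat n * x n

  -- Coefficient form of z(X²)′ = 2X · zX′: the weights i and n ∸ i of the two factors add up to n.
  weighted-⊛ : ∀ x n → (weighted x ⊛ x) n + (weighted x ⊛ x) n ≡ nat n * (x ⊛ x) n
  weighted-⊛ x n = begin
    (weighted x ⊛ x) n + (weighted x ⊛ x) n ≡⟨ cong ((weighted x ⊛ x) n +_) (⊛-comm (weighted x) x n) ⟩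
    (weighted x ⊛ x) n + (x ⊛ weighted x) n ≡⟨ ∑-+ n _ _ ⟨
    ∑ n (λ i → nat i * x i * x (n ℕ.∸ i) + x i * (nat (n ℕ.∸ i) * x (n ℕ.∸ i)))
      ≡⟨ ∑-cong n (λ i p → trans
           (solve 4 (λ k l u v → k :* u :* v :+ u :* (l :* v) := (k :+ l) :* (u :* v)) refl
              (nat i) (nat (n ℕ.∸ i)) (x i) (x (n ℕ.∸ i)))
           (cong (_* (x i * x (n ℕ.∸ i))) (nat-∸ p))) ⟩
    ∑ n (λ i → nat n * (x i * x (n ℕ.∸ i))) ≡⟨ ∑-* n (nat n) _ ⟩
    nat n * (x ⊛ x) n ∎
    where open ≡-Reasoning

  unit : ℕ → ℚ
  unit zero    = 1ℚ
  unit (suc n) = 0ℚ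

-- The scaled Catalan numbers C_{n-1}/4^n

module Catalan (a : ℕ → ℚ) (a₀ : a 0 ≡ 0ℚ) (a₁ : a 1 ≡ ½ ℚ.* ½)
               (a₂₊ : ∀ n → a (suc (suc n)) ≡ (a Sums.⊛ a) (suc (suc n)))
               (0≤a : ∀ n → 0ℚ ℚ.≤ a n) where
  open import Data.Rational.Base using (_+_; _-_; _*_; -_; _≤_; _<_; ∣_∣)
  open +-*-Solver using (solve; _:=_; _:+_; _:*_; _:-_; :-_; con)
  open Rational
  open Order
  open Sums

  ¼ : ℚ
  ¼ = ½ * ½

  a⊛a₁ : (a ⊛ a) 1 ≡ 0ℚ
  a⊛a₁ = trans (cong (λ z → z * a 1 + a 1 * z) a₀)
    (solve 1 (λ u → con 0ℚ :* u :+ u :* con 0ℚ := con 0ℚ) refl (a 1))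

  -- Coefficientwise, the differential equation (1 - z)A′ = (1 - 2A)/4 obtained
  -- by differentiating A = z/4 + A².
  recurrence₀ : ∀ n → nat (suc n) * a (suc n) ≡ (nat n - ½) * a n + ¼ * unit n
  recurrence₀ = <-rec _ go
    where
    open ≡-Reasoning
    go : ∀ n → (∀ {k} → k ℕ.< n → nat (suc k) * a (suc k) ≡ (nat k - ½) * a k + ¼ * unit k) →
         nat (suc n) * a (suc n) ≡ (nat n - ½) * a n + ¼ * unit n
    go zero    _  = trans (cong (nat 1 *_) a₁) (cong (λ z → (nat 0 - ½) * z + ¼ * 1ℚ) (sym a₀))
    go (suc n) ih = begin
      nat (suc N) * a (suc N)                     ≡⟨ cong (nat (suc N) *_) (a₂₊ n) ⟩
      nat (suc N) * (a ⊛ a) (suc N)               ≡⟨ weighted-⊛ a (suc N) ⟨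
      (weighted a ⊛ a) (suc N) + (weighted a ⊛ a) (suc N)
                                                  ≡⟨ cong (λ z → z + z) shift ⟩
      (W - ½ * C + ¼ * a N) + (W - ½ * C + ¼ * a N)
        ≡⟨ solve 3 (λ w c u → (w :- con ½ :* c :+ con ¼ :* u) :+ (w :- con ½ :* c :+ con ¼ :* u)
                           := (w :+ w) :- c :+ con ½ :* u) refl W C (a N) ⟩
      (W + W) - C + ½ * a N                       ≡⟨ cong (λ z → z - C + ½ * a N) (weighted-⊛ a N) ⟩
      nat N * C - C + ½ * a N                     ≡⟨ finish n ⟩
      (nat N - ½) * a N                           ≡⟨ ℚ.+-identityʳ _ ⟨
      (nat N - ½) * a N + 0ℚ                      ∎
      where
      N = suc n
      C = (a ⊛ a) N
      W = (weighted a ⊛ a) N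

      term : ∀ i → i ℕ.≤ N → weighted a (suc i) * a (N ℕ.∸ i)
             ≡ weighted a i * a (N ℕ.∸ i) - ½ * (a i * a (N ℕ.∸ i)) + ¼ * (unit i * a (N ℕ.∸ i))
      term i p with ℕ.m≤n⇒m<n∨m≡n p
      ... | inj₁ i<N = trans (cong (_* a (N ℕ.∸ i)) (ih i<N))
        (solve 4 (λ k u v d → ((k :- con ½) :* u :+ con ¼ :* d) :* v
                           := k :* u :* v :- con ½ :* (u :* v) :+ con ¼ :* (d :* v)) refl
          (nat i) (a i) (a (N ℕ.∸ i)) (unit i))
      ... | inj₂ refl = vanishing (trans (cong a (ℕ.n∸n≡0 n)) a₀)
        where
        vanishing : ∀ {z} → z ≡ 0ℚ → weighted a (suc N) * z ≡ weighted a N * z - ½ * (a N * z) + ¼ * (unit N * z)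
        vanishing refl =
          solve 4 (λ s w u d → s :* con 0ℚ := w :* con 0ℚ :- con ½ :* (u :* con 0ℚ) :+ con ¼ :* (d :* con 0ℚ)) refl
            (weighted a (suc N)) (weighted a N) (a N) (unit N)

      unit-⊛ : (unit ⊛ a) N ≡ a N
      unit-⊛ = trans (∑-head n (λ i → unit i * a (N ℕ.∸ i)))
        (trans (cong₂ _+_ (ℚ.*-identityˡ (a N)) (∑-zero n (λ i _ → ℚ.*-zeroˡ (a (N ℕ.∸ suc i))))) (ℚ.+-identityʳ (a N)))

      shift : (weighted a ⊛ a) (suc N) ≡ W - ½ * C + ¼ * a N
      shift = begin
        (weighted a ⊛ a) (suc N)
          ≡⟨ ∑-head N (λ i → weighted a i * a (suc N ℕ.∸ i)) ⟩
        nat 0 * a 0 * a (suc N) + ∑ N (λ i → weighted a (suc i) * a (N ℕ.∸ i))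
          ≡⟨ cong₂ _+_ (trans (cong (_* a (suc N)) (ℚ.*-zeroˡ (a 0))) (ℚ.*-zeroˡ (a (suc N)))) (∑-cong N term) ⟩
        0ℚ + ∑ N (λ i → weighted a i * a (N ℕ.∸ i) - ½ * (a i * a (N ℕ.∸ i)) + ¼ * (unit i * a (N ℕ.∸ i)))
          ≡⟨ ℚ.+-identityˡ _ ⟩
        ∑ N (λ i → weighted a i * a (N ℕ.∸ i) - ½ * (a i * a (N ℕ.∸ i)) + ¼ * (unit i * a (N ℕ.∸ i)))
          ≡⟨ ∑-+ N _ (λ i → ¼ * (unit i * a (N ℕ.∸ i))) ⟩
        ∑ N (λ i → weighted a i * a (N ℕ.∸ i) - ½ * (a i * a (N ℕ.∸ i))) + ∑ N (λ i → ¼ * (unit i * a (N ℕ.∸ i)))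
          ≡⟨ cong₂ _+_ (∑-- N _ (λ i → ½ * (a i * a (N ℕ.∸ i)))) (∑-* N ¼ _) ⟩
        W - ∑ N (λ i → ½ * (a i * a (N ℕ.∸ i))) + ¼ * (unit ⊛ a) N
          ≡⟨ cong₂ (λ u v → W - u + ¼ * v) (∑-* N ½ _) unit-⊛ ⟩
        W - ½ * C + ¼ * a N ∎

      finish : ∀ n → nat (suc n) * (a ⊛ a) (suc n) - (a ⊛ a) (suc n) + ½ * a (suc n) ≡ (nat (suc n) - ½) * a (suc n)
      -- C differs from `a N` at N = 1, but its total coefficient N - 1 vanishes there.
      finish zero    = trans (cong (λ c → nat 1 * c - c + ½ * a 1) a⊛a₁)
        (solve 1 (λ u → con 1ℚ :* con 0ℚ :- con 0ℚ :+ con ½ :* u := (con 1ℚ :- con ½) :* u) refl (a 1))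
      finish (suc n) = trans (cong (λ c → nat (suc (suc n)) * c - c + ½ * a (suc (suc n))) (sym (a₂₊ n)))
        (solve 2 (λ k u → k :* u :- u :+ con ½ :* u := (k :- con ½) :* u) refl (nat (suc (suc n))) (a (suc (suc n))))

  recurrence : ∀ n → nat (suc (suc n)) * a (suc (suc n)) ≡ (nat (suc n) - ½) * a (suc n)
  recurrence n = trans (recurrence₀ (suc n)) (ℚ.+-identityʳ _)

  1½ : ℚ
  1½ = 1ℚ + ½

  -- For k = n + 1, the coefficients k + 1 and k - ½ of the recurrence differ by 3/2; so the
  -- relative drop at k is 3/2 over k + 1.
  drop : ∀ n → a (suc n) - a (suc (suc n)) ≡ 1½ * mesh (suc n) * a (suc n)
  drop n = *-cancel-≡ (0<nat (suc n)) (begin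
    (a (suc n) - a (suc (suc n))) * s
      ≡⟨ solve 3 (λ s u v → (u :- v) :* s := s :* u :- s :* v) refl s (a (suc n)) (a (suc (suc n))) ⟩
    s * a (suc n) - s * a (suc (suc n))
      ≡⟨ cong₂ (λ p q → p * a (suc n) - q) (nat-suc (suc n)) (recurrence n) ⟩
    (nat (suc n) + 1ℚ) * a (suc n) - (nat (suc n) - ½) * a (suc n)
      ≡⟨ solve 2 (λ k u → (k :+ con 1ℚ) :* u :- (k :- con ½) :* u := con 1½ :* u :* con 1ℚ) refl (nat (suc n))
          (a (suc n)) ⟩
    1½ * a (suc n) * 1ℚ
      ≡⟨ cong (1½ * a (suc n) *_) (sym (mesh-inverse (suc n))) ⟩
    1½ * a (suc n) * (s * mesh (suc n))
      ≡⟨ solve 3 (λ s m u → con 1½ :* u :* (s :* m) := con 1½ :* m :* u :* s) refl s (mesh (suc n)) (a (suc n)) ⟩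
    1½ * mesh (suc n) * a (suc n) * s ∎)
    where
    open ≡-Reasoning
    s = nat (suc (suc n))

  0≤1½ : 0ℚ ≤ 1½
  0≤1½ = 0≤1 ⊕ 0≤½

  -- Monotonicity starts at degree 1, because `a 0` is 0.
  decreasing : ∀ n k → a (k ℕ.+ suc n) ≤ a (suc n)
  decreasing n zero    = ℚ.≤-refl
  decreasing n (suc k) rewrite ℕ.+-suc k n = ℚ.≤-trans
    (slack (0≤1½ ⊗ ℚ.<⇒≤ (0<mesh (suc (k ℕ.+ n))) ⊗ 0≤a (suc (k ℕ.+ n)))
      (trans (solve 2 (λ u v → u := v :+ (u :- v)) refl (a (suc (k ℕ.+ n))) (a (suc (suc (k ℕ.+ n)))))
             (cong (a (suc (suc (k ℕ.+ n))) +_) (drop (k ℕ.+ n)))))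
    (subst (λ j → a j ≤ a (suc n)) (ℕ.+-suc k n) (decreasing n k))

  decreasing′ : ∀ {i n} → i ℕ.< n → a n ≤ a (n ℕ.∸ i)
  decreasing′ {i} {suc n} (s≤s p) rewrite ℕ.+-∸-assoc 1 p =
    subst (λ j → a j ≤ a (suc (n ℕ.∸ i)))
      (trans (ℕ.+-suc i (n ℕ.∸ i)) (cong suc (ℕ.m+[n∸m]≡n p))) (decreasing (n ℕ.∸ i) i)

  -- Each of the k single drops is at most the first one, since `mesh` and `a` both decrease.
  total-drop : ∀ n k → a (suc n) ≤ a (k ℕ.+ suc n) + nat k * (1½ * mesh (suc n)) * a (suc n)
  total-drop n zero = ℚ.≤-reflexive
    (solve 2 (λ u m → u := u :+ con 0ℚ :* m :* u) refl (a (suc n)) (1½ * mesh (suc n)))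
  total-drop n (suc k) = ℚ.≤-trans (total-drop n k) (slack
    (0≤1½ ⊗ (gap step ⊕ ℚ.≤-refl))
    (begin
      v′ + nat (suc k) * (1½ * m) * u
        ≡⟨ cong₂ (λ p q → p + q * (1½ * m) * u) (trans (solve 2 (λ v w → w := v :- (v :- w)) refl v v′)
            (cong (λ z → v - z) drop′)) (nat-suc k) ⟩
      v - 1½ * m′ * v + (nat k + 1ℚ) * (1½ * m) * u
        ≡⟨ solve 5 (λ v m m′ u k → v :- con 1½ :* m′ :* v :+ (k :+ con 1ℚ) :* (con 1½ :* m) :* u
                        := v :+ k :* (con 1½ :* m) :* u :+ con 1½ :* (m :* u :- m′ :* v :+ con 0ℚ)) refl v m m′ u
                            (nat k) ⟩
      v + nat k * (1½ * m) * u + 1½ * (m * u - m′ * v + 0ℚ) ∎))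
    where
    open ≡-Reasoning
    u  = a (suc n)
    v  = a (k ℕ.+ suc n)
    v′ = a (suc k ℕ.+ suc n)
    m  = mesh (suc n)
    m′ = mesh (k ℕ.+ suc n)
    drop′ : v - v′ ≡ 1½ * m′ * v
    drop′ rewrite ℕ.+-suc k n = drop (k ℕ.+ n)
    step : m′ * v ≤ m * u
    step = *-mono-≤ (ℚ.<⇒≤ (0<mesh (k ℕ.+ suc n))) (mesh-antitone⁺ (suc n) k) (0≤a (k ℕ.+ suc n)) (decreasing n k)

  -- The sum of all `a i` with i > n in closed form. By the recurrence, 2(n+1) a_{n+1} loses exactly
  -- a_{n+1} when n grows by 1, so the series telescopes.
  tail : ℕ → ℚ
  tail n = nat (suc n) * a (suc n) + nat (suc n) * a (suc n)

  ∑a : ∀ n → ∑ n a ≡ ½ - tail n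
  ∑a zero = trans a₀ (cong (λ z → ½ - (nat 1 * z + nat 1 * z)) (sym a₁))
  ∑a (suc n) = begin
    ∑ n a + a (suc n)     ≡⟨ cong (_+ a (suc n)) (∑a n) ⟩
    ½ - (s * u + s * u) + u
      ≡⟨ solve 2 (λ s u → con ½ :- (s :* u :+ s :* u) :+ u
                   := con ½ :- ((s :- con ½) :* u :+ (s :- con ½) :* u)) refl s u ⟩
    ½ - ((s - ½) * u + (s - ½) * u) ≡⟨ cong (λ z → ½ - (z + z)) (recurrence n) ⟨
    ½ - tail (suc n)      ∎
    where
    open ≡-Reasoning
    s = nat (suc n)
    u = a (suc n)

  0≤tail : ∀ n → 0ℚ ≤ tail n
  0≤tail n = 0≤nat (suc n) ⊗ 0≤a (suc n) ⊕ 0≤nat (suc n) ⊗ 0≤a (suc n)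

  -- The invariant n (n aₙ)² ≤ 1/16 gives n aₙ = O(n^{-1/2}).
  invariant : ∀ n → nat (suc n) * (weighted a (suc n) * weighted a (suc n)) ≤ ¼ * ¼
  invariant zero = ℚ.≤-reflexive (cong (λ z → nat 1 * (nat 1 * z * (nat 1 * z))) a₁)
  -- With k = n the step amounts to (k+1)³ - (k+2)(k+½)² = ¾k + ½, which is nonnegative.
  invariant (suc n) = ℚ.≤-trans (slack
      (0≤a (suc n) ⊗ 0≤a (suc n) ⊗ ((0≤½ ⊕ 0≤½ ⊗ 0≤½) ⊗ 0≤nat n ⊕ 0≤½))
      (begin
        s * (s * u * (s * u))
          ≡⟨ cong (λ s → s * (s * u * (s * u))) (nat-suc n) ⟩
        (nat n + 1ℚ) * ((nat n + 1ℚ) * u * ((nat n + 1ℚ) * u))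
          ≡⟨ solve 2 (λ k u → (k :+ con 1ℚ) :* ((k :+ con 1ℚ) :* u :* ((k :+ con 1ℚ) :* u))
              := (k :+ con 1ℚ :+ con 1ℚ) :* ((k :+ con 1ℚ :- con ½) :* u :* ((k :+ con 1ℚ :- con ½) :* u))
                 :+ u :* u :* ((con ½ :+ con ½ :* con ½) :* k :+ con ½)) refl (nat n) u ⟩
        (nat n + 1ℚ + 1ℚ) * ((nat n + 1ℚ - ½) * u * ((nat n + 1ℚ - ½) * u)) + e
          ≡⟨ cong (λ s → (s + 1ℚ) * ((s - ½) * u * ((s - ½) * u)) + e) (nat-suc n) ⟨
        (s + 1ℚ) * ((s - ½) * u * ((s - ½) * u)) + e
          ≡⟨ cong₂ (λ p q → p * (q * q) + e) (nat-suc (suc n)) (recurrence n) ⟨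
        nat (suc (suc n)) * (weighted a (suc (suc n)) * weighted a (suc (suc n))) + e ∎))
    (invariant n)
    where
    open ≡-Reasoning
    s = nat (suc n)
    u = a (suc n)
    e = u * u * ((½ + ½ * ½) * nat n + ½)

  -- The invariant bounds the square of half the tail by `mesh n` / 16; the constant is then
  -- dropped.
  tail-null : ∀ {ε} → 0ℚ < ε → ∃[ N ] (∀ n → N ℕ.≤ n → tail n ≤ ε)
  tail-null {ε} 0<ε =
    let N , F = archimedean {½ * ε * (½ * ε)} (0<* 0<h 0<h)
    in N , λ n p → subst (tail n ≤_) (half+half ε) (ℚ.+-mono-≤ (half n (F n p)) (half n (F n p)))
    where
    0<h = 0<* 0<½ 0<ε
    half : ∀ n → mesh n < ½ * ε * (½ * ε) → weighted a (suc n) ≤ ½ * ε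
    half n p = square-cancel-≤ (ℚ.<⇒≤ 0<h) (ℚ.≤-trans square≤mesh (ℚ.<⇒≤ p))
      where
      t = weighted a (suc n)
      square≤mesh : t * t ≤ mesh n
      square≤mesh = slack (ℚ.<⇒≤ (0<mesh n) ⊗ (gap (invariant n) ⊕ ℚ.nonNegative⁻¹ (1ℚ - ¼ * ¼)))
        (sym (begin
          t * t + mesh n * (¼ * ¼ - nat (suc n) * (t * t) + (1ℚ - ¼ * ¼))
            ≡⟨ solve 3 (λ s m t → t :* t :+ m :* (con ¼ :* con ¼ :- s :* (t :* t) :+ (con 1ℚ :- con ¼ :* con ¼))
                 := t :* t :+ m :- s :* m :* (t :* t)) refl (nat (suc n)) (mesh n) t ⟩
          t * t + mesh n - nat (suc n) * mesh n * (t * t)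
            ≡⟨ cong (λ z → t * t + mesh n - z * (t * t)) (mesh-inverse n) ⟩
          t * t + mesh n - 1ℚ * (t * t)
            ≡⟨ solve 2 (λ m t → t :+ m :- con 1ℚ :* t := m) refl (mesh n) (t * t) ⟩
          mesh n ∎))
        where open ≡-Reasoning

-- The ends and the middle of a convolution

module Truncation where
  open import Data.Rational.Base using (_+_; _-_; _*_; -_; _≤_; _<_; ∣_∣)
  open +-*-Solver using (solve; _:=_; _:+_; _:*_; _:-_; :-_; con)
  open Rational
  open Order
  open Sums

  -- The indicator of i ≤ K as a rational weight: cutting a sum becomes a ring identity under `∑`
  -- instead of a change of its range.
  κ : ℕ → ℕ → ℚ
  κ K       zero    = 1ℚ
  κ zero    (suc i) = 0ℚ
  κ (suc K) (suc i) = κ K i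

  κ-≤ : ∀ {K i} → i ℕ.≤ K → κ K i ≡ 1ℚ
  κ-≤ z≤n             = refl
  κ-≤ (s≤s p)         = κ-≤ p

  κ-> : ∀ {K i} → K ℕ.< i → κ K i ≡ 0ℚ
  κ-> {zero}  (s≤s p) = refl
  κ-> {suc K} (s≤s p) = κ-> p

  0≤κ : ∀ K i → 0ℚ ≤ κ K i
  0≤κ K       zero    = 0≤1
  0≤κ zero    (suc i) = ℚ.≤-refl
  0≤κ (suc K) (suc i) = 0≤κ K i

  0≤1-κ : ∀ K i → 0ℚ ≤ 1ℚ - κ K i
  0≤1-κ K       zero    = ℚ.≤-refl
  0≤1-κ zero    (suc i) = 0≤1
  0≤1-κ (suc K) (suc i) = 0≤1-κ K i

  κκ : ∀ {K n i} → K ℕ.+ K ℕ.< n → κ K i * κ K (n ℕ.∸ i) ≡ 0ℚ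
  κκ {K} {n} {i} p with ℕ.≤-<-connex i K
  ... | inj₂ K<i = trans (cong (_* κ K (n ℕ.∸ i)) (κ-> K<i)) (ℚ.*-zeroˡ (κ K (n ℕ.∸ i)))
  ... | inj₁ i≤K = trans (cong (κ K i *_) (κ-> (ℕ.m+n≤o⇒m≤o∸n (suc K) (ℕ.≤-trans (s≤s (ℕ.+-monoʳ-≤ K i≤K)) p))))
                         (ℚ.*-zeroʳ (κ K i))

  ∑κ : ∀ {K} x j → ∑ (j ℕ.+ K) (λ i → κ K i * x i) ≡ ∑ K x
  ∑κ {K} x zero    = ∑-cong K λ i p → trans (cong (_* x i) (κ-≤ p)) (ℚ.*-identityˡ (x i))
  ∑κ {K} x (suc j) = trans
    (cong₂ _+_ (∑κ x j) (trans (cong (_* x (suc j ℕ.+ K)) (κ-> (s≤s (ℕ.m≤n+m K j)))) (ℚ.*-zeroˡ (x (suc j ℕ.+ K)))))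
    (ℚ.+-identityʳ (∑ K x))

  ∑κ-≥ : ∀ {K n} x → K ℕ.≤ n → ∑ n (λ i → κ K i * x i) ≡ ∑ K x
  ∑κ-≥ {K} {n} x p = subst (λ k → ∑ k (λ i → κ K i * x i) ≡ ∑ K x) (ℕ.m∸n+n≡m p) (∑κ x (n ℕ.∸ K))

  head mid : ℕ → (ℕ → ℚ) → (ℕ → ℚ) → ℕ → ℚ
  head K x y n = ∑ n λ i → κ K i * x i * y (n ℕ.∸ i)
  mid  K x y n = ∑ n λ i → (1ℚ - κ K i) * (1ℚ - κ K (n ℕ.∸ i)) * (x i * y (n ℕ.∸ i))

  -- For the indicators k and l of the two ends, 1 = k + l + (1-k)(1-l) - kl, and kl vanishes
  -- because 2K < n keeps the ends disjoint. The second end is reversed into a `head`.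
  ⊛-split : ∀ K x y {n} → K ℕ.+ K ℕ.< n → (x ⊛ y) n ≡ head K x y n + head K y x n + mid K x y n
  ⊛-split K x y {n} p = begin
    (x ⊛ y) n
      ≡⟨ ∑-cong n (λ i _ → trans
           (solve 4 (λ k l u v → u :* v := k :* u :* v :+ l :* v :* u :+ (con 1ℚ :- k) :* (con 1ℚ :- l) :* (u :* v)
               :- k :* l :* (u :* v)) refl
              (κ K i) (κ K (n ℕ.∸ i)) (x i) (y (n ℕ.∸ i)))
           (trans (cong (λ z → P i + Q i + R i - z * (x i * y (n ℕ.∸ i))) (κκ {i = i} p))
             (solve 2 (λ s z → s :- con 0ℚ :* z := s) refl (P i + Q i + R i) (x i * y (n ℕ.∸ i))))) ⟩
    ∑ n (λ i → P i + Q i + R i)     ≡⟨ ∑-+ n (λ i → P i + Q i) R ⟩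
    ∑ n (λ i → P i + Q i) + ∑ n R   ≡⟨ cong (_+ ∑ n R) (∑-+ n P Q) ⟩
    ∑ n P + ∑ n Q + ∑ n R           ≡⟨ cong (λ z → ∑ n P + z + ∑ n R) flip ⟩
    head K x y n + head K y x n + mid K x y n ∎
    where
    open ≡-Reasoning
    P Q R : ℕ → ℚ
    P i = κ K i * x i * y (n ℕ.∸ i)
    Q i = κ K (n ℕ.∸ i) * y (n ℕ.∸ i) * x i
    R i = (1ℚ - κ K i) * (1ℚ - κ K (n ℕ.∸ i)) * (x i * y (n ℕ.∸ i))
    flip : ∑ n Q ≡ head K y x n
    flip = trans (∑-reverse n Q) (∑-cong n λ i q →
      cong (λ k → κ K k * y k * x (n ℕ.∸ i)) (ℕ.m∸[m∸n]≡n q))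

  -- Over an end of fixed length, y is nearly the constant c, which comes out of the sum and leaves
  -- the partial sum of x.
  head-approx : ∀ K {x y} {n c β} → (∀ i → 0ℚ ≤ x i) → K ℕ.≤ n →
                (∀ i → i ℕ.≤ K → ∣ y (n ℕ.∸ i) - c ∣ ≤ β) →
                ∣ head K x y n - c * ∑ K x ∣ ≤ β * ∑ K x
  head-approx K {x} {y} {n} {c} {β} 0≤x K≤n close = begin
    ∣ head K x y n - c * ∑ K x ∣
      ≡⟨ cong (λ z → ∣ head K x y n - z ∣) (scaled c) ⟩
    ∣ head K x y n - ∑ n (λ i → c * (κ K i * x i)) ∣
      ≡⟨ cong ∣_∣ (∑-- n (λ i → κ K i * x i * y (n ℕ.∸ i)) (λ i → c * (κ K i * x i))) ⟨
    ∣ ∑ n (λ i → κ K i * x i * y (n ℕ.∸ i) - c * (κ K i * x i)) ∣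
      ≤⟨ ∣∑∣ n (λ i → κ K i * x i * y (n ℕ.∸ i) - c * (κ K i * x i)) ⟩
    ∑ n (λ i → ∣ κ K i * x i * y (n ℕ.∸ i) - c * (κ K i * x i) ∣)
      ≤⟨ ∑-mono n (λ i _ → term i) ⟩
    ∑ n (λ i → β * (κ K i * x i))
      ≡⟨ scaled β ⟨
    β * ∑ K x ∎
    where
    open ℚ.≤-Reasoning
    scaled : ∀ c → c * ∑ K x ≡ ∑ n (λ i → c * (κ K i * x i))
    scaled c = trans (cong (c *_) (sym (∑κ-≥ x K≤n))) (sym (∑-* n c (λ i → κ K i * x i)))
    term : ∀ i → ∣ κ K i * x i * y (n ℕ.∸ i) - c * (κ K i * x i) ∣ ≤ β * (κ K i * x i)
    term i = subst (_≤ β * (κ K i * x i)) (sym eq) bound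
      where
      eq : ∣ κ K i * x i * y (n ℕ.∸ i) - c * (κ K i * x i) ∣ ≡ ∣ y (n ℕ.∸ i) - c ∣ * (κ K i * x i)
      eq = trans (cong ∣_∣ (solve 3 (λ k y c → k :* y :- c :* k := (y :- c) :* k) refl (κ K i * x i) (y (n ℕ.∸ i)) c))
        (trans (ℚ.∣p*q∣≡∣p∣*∣q∣ (y (n ℕ.∸ i) - c) (κ K i * x i))
               (cong (∣ y (n ℕ.∸ i) - c ∣ *_) (ℚ.0≤p⇒∣p∣≡p (0≤κ K i ⊗ 0≤x i))))
      bound : ∣ y (n ℕ.∸ i) - c ∣ * (κ K i * x i) ≤ β * (κ K i * x i)
      bound with ℕ.≤-<-connex i K
      ... | inj₁ i≤K = *-mono-≤ (ℚ.0≤∣p∣ (y (n ℕ.∸ i) - c)) (close i i≤K) (0≤κ K i ⊗ 0≤x i) ℚ.≤-refl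
      ... | inj₂ K<i rewrite κ-> K<i = ℚ.≤-reflexive
        (solve 3 (λ u b x → u :* (con 0ℚ :* x) := b :* (con 0ℚ :* x)) refl ∣ y (n ℕ.∸ i) - c ∣ β (x i))

  mid-nonNeg : ∀ K {x y} n → (∀ i → 0ℚ ≤ x i) → (∀ i → 0ℚ ≤ y i) → 0ℚ ≤ mid K x y n
  mid-nonNeg K n 0≤x 0≤y = ∑-nonNeg n λ i → 0≤1-κ K i ⊗ 0≤1-κ K (n ℕ.∸ i) ⊗ (0≤x i ⊗ 0≤y (n ℕ.∸ i))

  mid-mono : ∀ K {x y x′ y′} n → (∀ i → 0ℚ ≤ x i) → (∀ i → x i ≤ x′ i) →
             (∀ i → 0ℚ ≤ y i) → (∀ i → y i ≤ y′ i) → mid K x y n ≤ mid K x′ y′ n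
  mid-mono K n 0≤x x≤ 0≤y y≤ = ∑-mono n λ i _ →
    *-mono-≤ (0≤1-κ K i ⊗ 0≤1-κ K (n ℕ.∸ i)) ℚ.≤-refl (0≤x i ⊗ 0≤y (n ℕ.∸ i))
      (*-mono-≤ (0≤x i) (x≤ i) (0≤y (n ℕ.∸ i)) (y≤ (n ℕ.∸ i)))

-- Transfer of asymptotics through D = rz + D F

module Transfer (a : ℕ → ℚ) (a₀ : a 0 ≡ 0ℚ) (a₁ : a 1 ≡ ½ ℚ.* ½)
               (a₂₊ : ∀ n → a (suc (suc n)) ≡ (a Sums.⊛ a) (suc (suc n)))
               (0≤a : ∀ n → 0ℚ ℚ.≤ a n) where
  open import Data.Rational.Base using (_+_; _-_; _*_; -_; _≤_; _<_; ∣_∣)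
  open +-*-Solver using (solve; _:=_; _:+_; _:*_; _:-_; :-_; con)
  open Rational
  open Order
  open Sums
  open Truncation
  open Catalan a a₀ a₁ a₂₊ 0≤a

  -- As `a` decreases, each end of the convolution is at least a N (½ - tail K). Together they use
  -- up all of a N = (a ⊛ a) N except 2 `tail K` · a N.
  mid-a : ∀ K n → K ℕ.+ K ℕ.≤ n → mid K a a (suc (suc n)) ≤ (tail K + tail K) * a (suc (suc n))
  mid-a K n p = slack (gap heavy ⊕ gap heavy) (begin
    (tail K + tail K) * a N
      ≡⟨ solve 3 (λ t u h → (t :+ t) :* u := u :- h :- h :+
          (h :- u :* (con ½ :- t) :+ (h :- u :* (con ½ :- t)))) refl (tail K) (a N) H ⟩
    a N - H - H + e      ≡⟨ cong (λ z → z - H - H + e) (trans (a₂₊ n) (⊛-split K a a (s≤s (ℕ.m≤n⇒m≤1+n p)))) ⟩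
    H + H + M - H - H + e
      ≡⟨ solve 3 (λ h m e → h :+ h :+ m :- h :- h :+ e := m :+ e) refl H M e ⟩
    M + e                ∎)
    where
    open ≡-Reasoning
    N = suc (suc n)
    H = head K a a N
    M = mid K a a N
    e = (H - a N * (½ - tail K)) + (H - a N * (½ - tail K))
    K≤N : K ℕ.≤ N
    K≤N = ℕ.m≤n⇒m≤1+n (ℕ.m≤n⇒m≤1+n (ℕ.m+n≤o⇒m≤o K p))
    heavy : a N * (½ - tail K) ≤ H
    heavy = subst (_≤ H) (trans (∑-* N (a N) (λ i → κ K i * a i))
        (cong (a N *_) (trans (∑κ-≥ a K≤N) (∑a K))))
      (∑-mono N λ i _ → term i)
      where
      term : ∀ i → a N * (κ K i * a i) ≤ κ K i * a i * a (N ℕ.∸ i)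
      term i with ℕ.≤-<-connex i K
      ... | inj₁ i≤K = subst (_≤ κ K i * a i * a (N ℕ.∸ i)) (ℚ.*-comm (κ K i * a i) (a N))
        (*-mono-≤ (0≤κ K i ⊗ 0≤a i) ℚ.≤-refl (0≤a N)
          (decreasing′ (s≤s (ℕ.≤-trans i≤K (ℕ.m≤n⇒m≤1+n (ℕ.m+n≤o⇒m≤o K p))))))
      ... | inj₂ K<i rewrite κ-> K<i = ℚ.≤-reflexive
        (solve 3 (λ u v x → u :* (con 0ℚ :* x) := con 0ℚ :* x :* v) refl (a N) (a (N ℕ.∸ i)) (a i))

  -- The drop over i steps is at most η/2 times the larger value; since η ≤ 1, the larger value is
  -- at most twice the smaller, so the drop is at most η times the smaller one.
  slow : ∀ K {η} → 0ℚ < η → η ≤ 1ℚ → ∃[ N ] (∀ n i → N ℕ.≤ n → i ℕ.≤ K → a (n ℕ.∸ i) - a n ≤ η * a n)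
  slow K {η} 0<η η≤1 = suc (M ℕ.+ K) , λ n i p q →
    subst (λ j → a (n ℕ.∸ i) - a j ≤ η * a j) (ℕ.m+[n∸m]≡n (i≤n n i p q))
      (subst (λ j → a j - a (i ℕ.+ j) ≤ η * a (i ℕ.+ j)) (sym (decomp n i p q))
          (bound i (M ℕ.+ (n ℕ.∸ i ℕ.∸ suc M)) q (ℕ.m≤m+n M _)))
    where
    c = nat (suc K) * 1½
    0<c : 0ℚ < c
    0<c = 0<* (0<nat K) (ℚ.positive⁻¹ 1½)
    -- At most K drops, each of relative size at most 1½ `mesh M`, stay below c `mesh M` < η/2.
    A = archimedean {½ * η * recip c} (0<* (0<* 0<½ 0<η) (0<recip 0<c))
    M = proj₁ A
    i≤n : ∀ n i → suc (M ℕ.+ K) ℕ.≤ n → i ℕ.≤ K → i ℕ.≤ n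
    i≤n n i p q = ℕ.≤-trans q (ℕ.≤-trans (ℕ.m≤n+m K M) (ℕ.≤-trans (ℕ.n≤1+n _) p))
    decomp : ∀ n i → suc (M ℕ.+ K) ℕ.≤ n → i ℕ.≤ K → n ℕ.∸ i ≡ suc (M ℕ.+ (n ℕ.∸ i ℕ.∸ suc M))
    decomp n i p q = sym (ℕ.m+[n∸m]≡n {suc M} (ℕ.m+n≤o⇒m≤o∸n (suc M) (ℕ.≤-trans (s≤s (ℕ.+-monoʳ-≤ M q)) p)))
    bound : ∀ i p → i ℕ.≤ K → M ℕ.≤ p → a (suc p) - a (i ℕ.+ suc p) ≤ η * a (i ℕ.+ suc p)
    bound i p i≤K M≤p = slack (r₂ ⊕ 0≤η ⊗ r₃) (solve 3
        (λ u v η → η :* v := u :- v :+ ((con ½ :* η :* u :- (u :- v)) :+ η :* (v :- con ½ :* u)) ) refl u v η)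
      where
      u = a (suc p)
      v = a (i ℕ.+ suc p)
      q = nat i * (1½ * mesh (suc p))
      0≤η = ℚ.<⇒≤ 0<η
      q≤ : q ≤ ½ * η
      q≤ = ℚ.≤-trans
        (subst (q ≤_) (sym (ℚ.*-assoc (nat (suc K)) 1½ (mesh M)))
        (*-mono-≤ (0≤nat i) (nat-mono (ℕ.m≤n⇒m≤1+n i≤K)) (0≤1½ ⊗ ℚ.<⇒≤ (0<mesh (suc p)))
          (*-mono-≤ 0≤1½ ℚ.≤-refl (ℚ.<⇒≤ (0<mesh (suc p)))
            (subst (λ j → mesh (suc j) ≤ mesh M) (ℕ.m∸n+n≡m M≤p) (mesh-antitone⁺ M (suc (p ℕ.∸ M)))))))
        (ℚ.<⇒≤ (*-small c η {mesh M} 0<c (proj₂ A M ℕ.≤-refl)))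
      r₁ : u ≤ v + q * u
      r₁ = total-drop p i
      r₂ : 0ℚ ≤ ½ * η * u - (u - v)
      r₂ = subst (0ℚ ≤_) (solve 4 (λ h q u v → (h :- q) :* u :+ (v :+ q :* u :- u) := h :* u :- (u :- v)) refl
          (½ * η) q u v)
        (gap q≤ ⊗ 0≤a (suc p) ⊕ gap r₁)
      r₃ : 0ℚ ≤ v - ½ * u
      r₃ = subst (0ℚ ≤_) (solve 3 (λ η u v → con ½ :* η :* u :- (u :- v) :+ con ½ :* (con 1ℚ :- η) :* u := v
          :- con ½ :* u) refl η u v)
        (r₂ ⊕ 0≤½ ⊗ gap η≤1 ⊗ 0≤a (suc p))

  -- Finite-precision form of x n ~ t a n, in which t need only approximate the true ratio.
  Near : (ℕ → ℚ) → ℚ → ℚ → Set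
  Near x t ε = ∃[ N ] (∀ n → N ℕ.≤ n → ∣ x n - t * a n ∣ ≤ ε * a n)

  ¾ : ℚ
  ¾ = ½ + ½ * ½

  2ℚ 5ℚ : ℚ
  2ℚ = 1ℚ + 1ℚ
  5ℚ = 2ℚ + 2ℚ + 1ℚ

  -- In the application h, f and d are the coefficients of F_k, F_{k+1} and D_k.
  module _ (f h : ℕ → ℚ) (0≤f : ∀ n → 0ℚ ≤ f n) (f≤h : ∀ n → f n ≤ h n) (h≤a : ∀ n → h n ≤ a n)
           (fixed : ∀ n → h (suc (suc n)) - f (suc (suc n)) ≡ ((λ i → h i - f i) ⊛ f) (suc (suc n)))
           where

    d : ℕ → ℚ
    d i = h i - f i

    0≤d : ∀ i → 0ℚ ≤ d i
    0≤d i = gap (f≤h i)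

    d≤a : ∀ i → d i ≤ a i
    d≤a i = slack (0≤f i ⊕ gap (h≤a i)) (solve 3 (λ f h a → a := h :- f :+ (f :+ (a :- h))) refl (f i) (h i) (a i))

    f≤a : ∀ i → f i ≤ a i
    f≤a i = ℚ.≤-trans (f≤h i) (h≤a i)

    -- `balance` is the relation that defines t from s, cleared of its denominator and with the
    -- values at z = 1 replaced by partial sums up to K.
    module _ {s t ε : ℚ} (0≤t : 0ℚ ≤ t) (t≤1 : t ≤ 1ℚ) (0≤s : 0ℚ ≤ s) (s≤1 : s ≤ 1ℚ)
             (0<ε : 0ℚ < ε) (ε≤1 : ε ≤ 1ℚ) (K : ℕ) (small : tail K + tail K ≤ ε)
             (balance : ∣ s * (1ℚ - ∑ K f) - t * (1ℚ - ∑ K f + ∑ K d) ∣ ≤ ε)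
             (near : Near h s ε) where

      0≤ε : 0ℚ ≤ ε
      0≤ε = ℚ.<⇒≤ 0<ε

      D F : ℚ
      D = ∑ K d
      F = ∑ K f

      D+F≤½ : D + F ≤ ½
      D+F≤½ = subst (_≤ ½) (∑-+ K d f) (ℚ.≤-trans
        (∑-mono K (λ i _ → subst (_≤ a i) (solve 2 (λ f h → h := h :- f :+ f) refl (f i) (h i)) (h≤a i)))
        (slack (0≤tail K) (trans (solve 1 (λ t → con ½ := con ½ :- t :+ t) refl (tail K))
            (cong (_+ tail K) (sym (∑a K))))))

      -- Replacing `a (n ∸ i)` by `a n` costs ε/2 in the main term, as s ≤ 1, and multiplies the
      -- error B by at most 1 + ε/2 ≤ 3/2.
      shifted : ∀ {x : ℕ → ℚ} {s B} n i → 0ℚ ≤ B → 0ℚ ≤ s → s ≤ 1ℚ → a n ≤ a (n ℕ.∸ i) →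
                a (n ℕ.∸ i) - a n ≤ ½ * ε * a n → ∣ x (n ℕ.∸ i) - s * a (n ℕ.∸ i) ∣ ≤ B * a (n ℕ.∸ i) →
                ∣ x (n ℕ.∸ i) - s * a n ∣ ≤ ((1ℚ + ½) * B + ½ * ε) * a n
      shifted {x} {s} {B} n i 0≤B 0≤s s≤1 mono close p = ℚ.≤-trans
        (subst (λ z → ∣ z ∣ ≤ B * u + (u - v)) (solve 4
            (λ x s u v → x :- s :* u :+ s :* (u :- v) := x :- s :* v) refl (x (n ℕ.∸ i)) s u v)
          (p ⊞ ∣∣-bound (0≤s ⊗ gap mono) (slack (gap s≤1 ⊗ gap mono)
            (solve 3 (λ s u v → u :- v := s :* (u :- v) :+ (con 1ℚ :- s) :* (u :- v)) refl s u v))))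
        (slack ((0≤1 ⊕ 0≤B) ⊗ gap close ⊕ 0≤B ⊗ 0≤½ ⊗ gap ε≤1 ⊗ 0≤a n)
          (solve 4 (λ B ε u v → ((con 1ℚ :+ con ½) :* B :+ con ½ :* ε) :* v
             := B :* u :+ (u :- v) :+ ((con 1ℚ :+ B) :* (con ½ :* ε :* v :- (u :- v)) :+ B :* con ½ :*
                 (con 1ℚ :- ε) :* v))
             refl B ε u v))
        where
        u = a (n ℕ.∸ i)
        v = a n

      -- The error B enters through both ends of the convolution, enlarged by 3/2 in `shifted` and
      -- with mass D + F ≤ ½: this is the factor ¾. The rest is 3ε from h, the middle and `balance`,
      -- 2εF ≤ ε from h inside d, and ε/4 from `shifted`; the sum 17ε/4 is rounded up to 5ε.
      improve : ∀ {B} → 0ℚ ≤ B → Near f t B → Near f t (¾ * B + 5ℚ * ε)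
      -- Adding K to N₁ and N₂ keeps every index n ∸ i with i ≤ K in the range of the estimates for
      -- f and h; 2K + 2 keeps the two ends disjoint.
      improve {B} 0≤B (N₁ , near-f) = suc (suc (K ℕ.+ K)) ℕ.+ (K ℕ.+ N₁ ℕ.+ (K ℕ.+ N₂) ℕ.+ N₃) , go
        where
        N₂ = proj₁ near
        S = slow K {½ * ε} (0<* 0<½ 0<ε) (slack (gap ε≤1 ⊕ 0≤½ ⊗ 0≤ε)
          (solve 1 (λ ε → con 1ℚ := con ½ :* ε :+ (con 1ℚ :- ε :+ con ½ :* ε)) refl ε))
        N₃ = proj₁ S
        β = (1ℚ + ½) * B + ½ * ε

        go′ : ∀ n → K ℕ.+ K ℕ.≤ n → K ℕ.+ N₁ ℕ.≤ suc (suc n) → K ℕ.+ N₂ ℕ.≤ suc (suc n) → N₃ ℕ.≤ suc (suc n) →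
              ∣ f (suc (suc n)) - t * a (suc (suc n)) ∣ ≤ (¾ * B + 5ℚ * ε) * a (suc (suc n))
        go′ n p p₁ p₂ p₃ = subst (λ z → ∣ z ∣ ≤ (¾ * B + 5ℚ * ε) * v) (sym eq) (ℚ.≤-trans sum-bound
            (slack (0≤a N ⊗ ((0≤1 ⊕ 0≤½) ⊗ 0≤B ⊕ 0≤½ ⊗ 0≤ε) ⊗ gap D+F≤½ ⊕ 0≤a N ⊗ (0≤1 ⊕ 0≤1) ⊗ 0≤ε ⊗
                (gap D+F≤½ ⊕ ∑-nonNeg K 0≤d) ⊕ 0≤a N ⊗ ℚ.nonNegative⁻¹ ¾ ⊗ 0≤ε)
              (solve 5 (λ B ε v D F →
                let b = (con 1ℚ :+ con ½) :* B :+ con ½ :* ε in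
                (con ¾ :* B :+ con 5ℚ :* ε) :* v :=
                ε :* v :+ b :* v :* D :+ (b :+ con 2ℚ :* ε) :* v :* F :+ ε :* v :+ ε :* v
                :+ (v :* b :* (con ½ :- (D :+ F)) :+ v :* con 2ℚ :* ε :* (con ½ :- (D :+ F) :+ D) :+ v :* con ¾ :* ε))
                refl B ε v D F)))
          where
          N = suc (suc n)
          v = a N
          H₁ = head K d f N
          H₂ = head K f d N
          M = mid K d f N
          G = s * (1ℚ - F) - t * (1ℚ - F + D)
          K<N : K ℕ.< N
          K<N = s≤s (ℕ.m≤n⇒m≤1+n (ℕ.m+n≤o⇒m≤o K p))
          below : ∀ {i} → i ℕ.≤ K → i ℕ.< N
          below i≤K = ℕ.≤-<-trans i≤K K<N
          past : ∀ {i L} → i ℕ.≤ K → K ℕ.+ L ℕ.≤ N → L ℕ.≤ N ℕ.∸ i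
          past {i} {L} i≤K q = ℕ.m+n≤o⇒m≤o∸n L (ℕ.≤-trans
              (ℕ.≤-trans (ℕ.≤-reflexive (ℕ.+-comm L i)) (ℕ.+-monoˡ-≤ L i≤K)) q)
          f-shifted : ∀ i → i ℕ.≤ K → ∣ f (N ℕ.∸ i) - t * v ∣ ≤ β * v
          f-shifted i q = shifted {f} N i 0≤B 0≤t t≤1 (decreasing′ (below q)) (proj₂ S N i p₃ q)
            (near-f (N ℕ.∸ i) (past q p₁))
          h-shifted : ∀ i → i ℕ.≤ K → ∣ h (N ℕ.∸ i) - s * v ∣ ≤ 2ℚ * ε * v
          h-shifted i q = subst (∣ h (N ℕ.∸ i) - s * v ∣ ≤_)
            (solve 2 (λ ε v → ((con 1ℚ :+ con ½) :* ε :+ con ½ :* ε) :* v := con 2ℚ :* ε :* v) refl ε v)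
            (shifted {h} N i 0≤ε 0≤s s≤1 (decreasing′ (below q)) (proj₂ S N i p₃ q) (proj₂ near (N ℕ.∸ i) (past q p₂)))
          d-shifted : ∀ i → i ℕ.≤ K → ∣ d (N ℕ.∸ i) - (s - t) * v ∣ ≤ (β + 2ℚ * ε) * v
          d-shifted i q = subst₂ (λ x y → ∣ x ∣ ≤ y)
            (solve 5 (λ f h s t v → :- (f :- t :* v) :+ (h :- s :* v) := h :- f :- (s :- t) :* v) refl
                (f (N ℕ.∸ i)) (h (N ℕ.∸ i)) s t v)
            (sym (ℚ.*-distribʳ-+ v β (2ℚ * ε)))
            (∣∣-neg (f-shifted i q) ⊞ h-shifted i q)
          -- f N is h N minus the split convolution. The main terms removed from h and from the two
          -- ends combine with t v into G v, which `balance` makes small.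
          eq : f N - t * v ≡ (h N - s * v) + - (H₁ - t * v * D) + - (H₂ - (s - t) * v * F) + - M + G * v
          eq = trans (trans (solve 3 (λ f h tv → f :- tv := h :- (h :- f) :- tv) refl (f N) (h N) (t * v))
            (cong (λ z → h N - z - t * v) (trans (fixed n) (⊛-split K d f (s≤s (ℕ.m≤n⇒m≤1+n p))))))
            (solve 9 (λ h H₁ H₂ M s t v D F → h :- (H₁ :+ H₂ :+ M) :- t :* v
              := (h :- s :* v) :+ :- (H₁ :- t :* v :* D) :+ :- (H₂ :- (s :- t) :* v :* F) :+ :- M
                 :+ (s :* (con 1ℚ :- F) :- t :* (con 1ℚ :- F :+ D)) :* v) refl (h N) H₁ H₂ M s t v D F)
          K≤N = ℕ.<⇒≤ K<N
          mid-bound : ∣ M ∣ ≤ ε * v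
          mid-bound = ∣∣-bound (mid-nonNeg K N 0≤d 0≤f) (ℚ.≤-trans
            (mid-mono K N 0≤d d≤a 0≤f f≤a)
            (ℚ.≤-trans (mid-a K n p) (*-mono-≤ (0≤tail K ⊕ 0≤tail K) small (0≤a N) ℚ.≤-refl)))
          G-bound : ∣ G * v ∣ ≤ ε * v
          G-bound = subst (_≤ ε * v) (trans (cong (∣ G ∣ *_) (sym (ℚ.0≤p⇒∣p∣≡p (0≤a N)))) (sym (ℚ.∣p*q∣≡∣p∣*∣q∣ G v)))
            (*-mono-≤ (ℚ.0≤∣p∣ G) balance (0≤a N) ℚ.≤-refl)
          sum-bound : ∣ (h N - s * v) + - (H₁ - t * v * D) + - (H₂ - (s - t) * v * F) + - M + G * v ∣
                      ≤ ε * v + β * v * D + (β + 2ℚ * ε) * v * F + ε * v + ε * v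
          sum-bound = proj₂ near N (ℕ.m+n≤o⇒n≤o K p₂)
            ⊞ ∣∣-neg (head-approx K {d} {f} {N} 0≤d K≤N f-shifted)
            ⊞ ∣∣-neg (head-approx K {f} {d} {N} 0≤f K≤N d-shifted)
            ⊞ ∣∣-neg mid-bound
            ⊞ G-bound

        go : ∀ n → suc (suc (K ℕ.+ K)) ℕ.+ (K ℕ.+ N₁ ℕ.+ (K ℕ.+ N₂) ℕ.+ N₃) ℕ.≤ n →
             ∣ f n - t * a n ∣ ≤ (¾ * B + 5ℚ * ε) * a n
        go (suc (suc n)) (s≤s (s≤s p)) = go′ n (ℕ.m+n≤o⇒m≤o (K ℕ.+ K) p)
            (ℕ.≤-trans (ℕ.m+n≤o⇒m≤o (K ℕ.+ N₁) (ℕ.m+n≤o⇒m≤o (K ℕ.+ N₁ ℕ.+ (K ℕ.+ N₂)) rest)) up)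
            (ℕ.≤-trans (ℕ.m+n≤o⇒n≤o (K ℕ.+ N₁) (ℕ.m+n≤o⇒m≤o (K ℕ.+ N₁ ℕ.+ (K ℕ.+ N₂)) rest)) up)
            (ℕ.≤-trans (ℕ.m+n≤o⇒n≤o (K ℕ.+ N₁ ℕ.+ (K ℕ.+ N₂)) rest) up)
          where
          rest : K ℕ.+ N₁ ℕ.+ (K ℕ.+ N₂) ℕ.+ N₃ ℕ.≤ n
          rest = ℕ.m+n≤o⇒n≤o (K ℕ.+ K) p
          up : n ℕ.≤ suc (suc n)
          up = ℕ.m≤n⇒m≤1+n (ℕ.n≤1+n n)

      ¾^ : ℕ → ℚ
      ¾^ zero    = 1ℚ
      ¾^ (suc k) = ¾ * ¾^ k

      0≤¾^ : ∀ k → 0ℚ ≤ ¾^ k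
      0≤¾^ zero    = 0≤1
      0≤¾^ (suc k) = ℚ.nonNegative⁻¹ ¾ ⊗ 0≤¾^ k

      -- 20ε is the fixed point of B ↦ ¾B + 5ε, the map that `improve` iterates.
      20ℚ : ℚ
      20ℚ = 5ℚ * (2ℚ + 2ℚ)

      iterate : ∀ k → Near f t (¾^ k + 20ℚ * ε)
      -- No asymptotic information is needed to start: f n and t a n both lie between 0 and a n.
      iterate zero = 0 , λ n _ → ∣∣≤
        (slack (0≤t ⊗ 0≤a n ⊕ gap (f≤a n) ⊕ ℚ.nonNegative⁻¹ 20ℚ ⊗ 0≤ε ⊗ 0≤a n)
          (solve 4 (λ f t a ε → (con 1ℚ :+ con 20ℚ :* ε) :* a := f :- t :* a :+
              (t :* a :+ (a :- f) :+ con 20ℚ :* ε :* a))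
            refl (f n) t (a n) ε))
        (slack (gap t≤1 ⊗ 0≤a n ⊕ 0≤f n ⊕ ℚ.nonNegative⁻¹ 20ℚ ⊗ 0≤ε ⊗ 0≤a n)
          (solve 4 (λ f t a ε → (con 1ℚ :+ con 20ℚ :* ε) :* a := :- (f :- t :* a) :+
              ((con 1ℚ :- t) :* a :+ f :+ con 20ℚ :* ε :* a))
            refl (f n) t (a n) ε))
      iterate (suc k) = subst (Near f t)
        (solve 2 (λ p ε → con ¾ :* (p :+ con 20ℚ :* ε) :+ con 5ℚ :* ε := con ¾ :* p :+ con 20ℚ :* ε) refl (¾^ k) ε)
        (improve (0≤¾^ k ⊕ ℚ.nonNegative⁻¹ 20ℚ ⊗ 0≤ε) (iterate k))

      3ℚ : ℚ
      3ℚ = 2ℚ + 1ℚ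

      -- 3 is the least c for which ¾(k + 1 + c) ≤ k + c holds for all k ≥ 0. Decay of order 1/k
      -- suffices for a comparison with `mesh`.
      ¾^-decay : ∀ k → ¾^ k * (nat k + 3ℚ) ≤ 3ℚ
      ¾^-decay zero    = ℚ.≤-refl
      ¾^-decay (suc k) = ℚ.≤-trans (slack (0≤¾^ k ⊗ (0≤½ ⊗ 0≤½) ⊗ 0≤nat k) (sym (trans
        (cong (λ z → ¾ * ¾^ k * (z + 3ℚ) + ¾^ k * (½ * ½) * nat k) (nat-suc k))
        (solve 2 (λ p k → con ¾ :* p :* (k :+ con 1ℚ :+ con 3ℚ) :+ p :* (con ½ :* con ½) :* k := p :*
            (k :+ con 3ℚ)) refl (¾^ k) (nat k)))))
        (¾^-decay k)

      ¾^≤mesh : ∀ k → ¾^ k ≤ 3ℚ * mesh k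
      ¾^≤mesh k = slack (0≤m ⊗ (gap (¾^-decay k) ⊕ 0≤¾^ k ⊗ (0≤1 ⊕ 0≤1)))
        (begin
          3ℚ * m ≡⟨ solve 2 (λ m p → con 3ℚ :* m := p :+ (con 3ℚ :* m :- p :* con 1ℚ)) refl m (¾^ k) ⟩
          ¾^ k + (3ℚ * m - ¾^ k * 1ℚ)
            ≡⟨ cong (λ z → ¾^ k + (3ℚ * m - ¾^ k * z)) (trans (sym (mesh-inverse k)) (cong (_* m) (nat-suc k))) ⟩
          ¾^ k + (3ℚ * m - ¾^ k * ((nat k + 1ℚ) * m))
            ≡⟨ solve 3 (λ m p k → p :+ (con 3ℚ :* m :- p :* ((k :+ con 1ℚ) :* m))
                 := p :+ m :* ((con 3ℚ :- p :* (k :+ con 3ℚ)) :+ p :* con 2ℚ)) refl m (¾^ k) (nat k) ⟩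
          ¾^ k + m * ((3ℚ - ¾^ k * (nat k + 3ℚ)) + ¾^ k * 2ℚ) ∎)
        where
        open ≡-Reasoning
        m = mesh k
        0≤m = ℚ.<⇒≤ (0<mesh k)

      -- After enough rounds ¾^k ≤ 3 `mesh k` is at most 3ε, which joins the stationary error 20ε.
      transfer : Near f t ((3ℚ + 20ℚ) * ε)
      transfer =
        let k , small-mesh = archimedean 0<ε
            N , F = iterate k
        in N , λ n p → ℚ.≤-trans (F n p) (*-mono-≤ (0≤¾^ k ⊕ ℚ.nonNegative⁻¹ 20ℚ ⊗ 0≤ε)
             (slack (gap (¾^≤mesh k) ⊕ ℚ.nonNegative⁻¹ 3ℚ ⊗ gap (ℚ.<⇒≤ (small-mesh k ℕ.≤-refl)))
               (solve 3 (λ p m ε → (con 3ℚ :+ con 20ℚ) :* ε := p :+ con 20ℚ :* ε :+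
                   (con 3ℚ :* m :- p :+ con 3ℚ :* (ε :- m))) refl (¾^ k) (mesh k) ε))
             (0≤a n) ℚ.≤-refl)

-- Sums over lists and counting by indicators

module ListSums where
  open import Data.Rational.Base using (_+_; _-_; _*_; -_; _≤_; _<_; ∣_∣)
  open +-*-Solver using (solve; _:=_; _:+_; _:*_; _:-_; :-_; con)
  open Rational
  open Order
  open Sums

  ∑ˡ : ∀ {A : Set} → List A → (A → ℚ) → ℚ
  ∑ˡ []       φ = 0ℚ
  ∑ˡ (x ∷ xs) φ = φ x + ∑ˡ xs φ

  ∑ˡ-cong : ∀ {A : Set} xs {φ ψ : A → ℚ} → (∀ x → φ x ≡ ψ x) → ∑ˡ xs φ ≡ ∑ˡ xs ψ
  ∑ˡ-cong []       e = refl
  ∑ˡ-cong (x ∷ xs) e = cong₂ _+_ (e x) (∑ˡ-cong xs e)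

  ∑ˡ-++ : ∀ {A : Set} xs {ys} (φ : A → ℚ) → ∑ˡ (xs ++ ys) φ ≡ ∑ˡ xs φ + ∑ˡ ys φ
  ∑ˡ-++ []       φ = sym (ℚ.+-identityˡ _)
  ∑ˡ-++ (x ∷ xs) φ = trans (cong (φ x +_) (∑ˡ-++ xs φ)) (sym (ℚ.+-assoc (φ x) _ _))

  ∑ˡ-map : ∀ {A B : Set} (f : A → B) xs φ → ∑ˡ (map f xs) φ ≡ ∑ˡ xs (λ x → φ (f x))
  ∑ˡ-map f []       φ = refl
  ∑ˡ-map f (x ∷ xs) φ = cong (φ (f x) +_) (∑ˡ-map f xs φ)

  ∑ˡ-concatMap : ∀ {A B : Set} (f : A → List B) xs φ → ∑ˡ (concatMap f xs) φ ≡ ∑ˡ xs (λ x → ∑ˡ (f x) φ)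
  ∑ˡ-concatMap f []       φ = refl
  ∑ˡ-concatMap f (x ∷ xs) φ = trans (∑ˡ-++ (f x) φ) (cong (∑ˡ (f x) φ +_) (∑ˡ-concatMap f xs φ))

  ∑ˡ-product : ∀ {A B C : Set} (f : A → B → C) xs ys φ →
               ∑ˡ (cartesianProductWith f xs ys) φ ≡ ∑ˡ xs λ x → ∑ˡ ys λ y → φ (f x y)
  ∑ˡ-product f []       ys φ = refl
  ∑ˡ-product f (x ∷ xs) ys φ = trans (∑ˡ-++ (map (f x) ys) φ)
    (cong₂ _+_ (∑ˡ-map (f x) ys φ) (∑ˡ-product f xs ys φ))

  ∑ˡ-* : ∀ {A : Set} xs c (φ : A → ℚ) → ∑ˡ xs (λ x → c * φ x) ≡ c * ∑ˡ xs φ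
  ∑ˡ-* []       c φ = sym (ℚ.*-zeroʳ c)
  ∑ˡ-* (x ∷ xs) c φ = trans (cong (c * φ x +_) (∑ˡ-* xs c φ)) (sym (ℚ.*-distribˡ-+ c (φ x) _))

  ∑ˡ-+ : ∀ {A : Set} xs (φ ψ : A → ℚ) → ∑ˡ xs (λ x → φ x + ψ x) ≡ ∑ˡ xs φ + ∑ˡ xs ψ
  ∑ˡ-+ []       φ ψ = refl
  ∑ˡ-+ (x ∷ xs) φ ψ = trans (cong (φ x + ψ x +_) (∑ˡ-+ xs φ ψ))
    (solve 4 (λ a b c d → a :+ b :+ (c :+ d) := a :+ c :+ (b :+ d)) refl (φ x) (ψ x) (∑ˡ xs φ) (∑ˡ xs ψ))

  ∑ˡ-- : ∀ {A : Set} xs (φ ψ : A → ℚ) → ∑ˡ xs (λ x → φ x - ψ x) ≡ ∑ˡ xs φ - ∑ˡ xs ψ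
  ∑ˡ-- []       φ ψ = refl
  ∑ˡ-- (x ∷ xs) φ ψ = trans (cong (φ x - ψ x +_) (∑ˡ-- xs φ ψ))
    (solve 4 (λ a b c d → a :- b :+ (c :- d) := a :+ c :- (b :+ d)) refl (φ x) (ψ x) (∑ˡ xs φ) (∑ˡ xs ψ))

  ∑ˡ-zero : ∀ {A : Set} xs {φ : A → ℚ} → (∀ x → φ x ≡ 0ℚ) → ∑ˡ xs φ ≡ 0ℚ
  ∑ˡ-zero []       e = refl
  ∑ˡ-zero (x ∷ xs) e = cong₂ _+_ (e x) (∑ˡ-zero xs e)

  ∑ˡ-swap : ∀ {A B : Set} (xs : List A) (ys : List B) (φ : A → B → ℚ) →
            ∑ˡ xs (λ x → ∑ˡ ys (φ x)) ≡ ∑ˡ ys (λ y → ∑ˡ xs (λ x → φ x y))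
  ∑ˡ-swap []       ys φ = sym (∑ˡ-zero ys λ _ → refl)
  ∑ˡ-swap (x ∷ xs) ys φ = trans (cong (∑ˡ ys (φ x) +_) (∑ˡ-swap xs ys φ)) (sym (∑ˡ-+ ys (φ x) _))

  ∑ˡ-nonNeg : ∀ {A : Set} xs {φ : A → ℚ} → (∀ x → 0ℚ ≤ φ x) → 0ℚ ≤ ∑ˡ xs φ
  ∑ˡ-nonNeg []       e = ℚ.≤-refl
  ∑ˡ-nonNeg (x ∷ xs) e = e x ⊕ ∑ˡ-nonNeg xs e

  ∑ˡ-mono : ∀ {A : Set} xs {φ ψ : A → ℚ} → (∀ x → φ x ≤ ψ x) → ∑ˡ xs φ ≤ ∑ˡ xs ψ
  ∑ˡ-mono []       e = ℚ.≤-refl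
  ∑ˡ-mono (x ∷ xs) e = ℚ.+-mono-≤ (e x) (∑ˡ-mono xs e)

  indicator : ∀ {P : Set} → Dec P → ℚ
  indicator (yes _) = 1ℚ
  indicator (no  _) = 0ℚ

  length-filter : ∀ {A : Set} {P : A → Set} (P? : ∀ x → Dec (P x)) xs →
                  nat (length (filter P? xs)) ≡ ∑ˡ xs (λ x → indicator (P? x))
  length-filter P? []       = refl
  length-filter P? (x ∷ xs) with P? x
  ... | yes _ = trans (nat-suc (length (filter P? xs)))
      (trans (ℚ.+-comm (nat (length (filter P? xs))) 1ℚ) (cong (1ℚ +_) (length-filter P? xs)))
  ... | no  _ = trans (length-filter P? xs) (sym (ℚ.+-identityˡ _))

  nat-sum : ∀ {A : Set} (f : A → ℕ) xs → nat (sum (map f xs)) ≡ ∑ˡ xs (λ x → nat (f x))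
  nat-sum f []       = refl
  nat-sum f (x ∷ xs) = trans (nat-+ (f x) _) (cong (nat (f x) +_) (nat-sum f xs))

  ∑ˡ-point : ∀ {A : Set} {n} (f : Fin n → A) {φ : A → ℚ} v → φ (f v) ≡ 1ℚ → (∀ j → j ≢ v → φ (f j) ≡ 0ℚ) →
             ∑ˡ (tabulate f) φ ≡ 1ℚ
  ∑ˡ-point {n = suc n} f {φ} Fin.zero one none =
    trans (cong₂ _+_ one (vanish (λ j → f (Fin.suc j)) λ j → none (Fin.suc j) λ ())) (ℚ.+-identityʳ 1ℚ)
    where
    vanish : ∀ {n} (f : Fin n → _) → (∀ j → φ (f j) ≡ 0ℚ) → ∑ˡ (tabulate f) φ ≡ 0ℚ
    vanish {zero}  f e = refl
    vanish {suc n} f e = cong₂ _+_ (e Fin.zero) (vanish (λ j → f (Fin.suc j)) (λ j → e (Fin.suc j)))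
  ∑ˡ-point {n = suc n} f (Fin.suc v) one none =
    trans (cong₂ _+_ (none Fin.zero λ ()) (∑ˡ-point (λ j → f (Fin.suc j)) v one λ j ne → none (Fin.suc j) λ e → ne
        (Fin.suc-injective e)))
          (ℚ.+-identityˡ 1ℚ)

  ∑ˡ-splits : ∀ n (x y : ℕ → ℚ) → ∑ˡ (splits n) (λ (a , b , _) → x a * y b) ≡ (x ⊛ y) n
  ∑ˡ-splits zero    x y = ℚ.+-identityʳ (x 0 * y 0)
  ∑ˡ-splits (suc n) x y = trans
    (cong (x 0 * y (suc n) +_) (trans (∑ˡ-map _ (splits n) _) (∑ˡ-splits n (λ i → x (suc i)) y)))
    (sym (∑-head n (λ i → x i * y (suc n ℕ.∸ i))))

-- Independence of the enumeration from its height bound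

module Enumeration where
  product-[] : ∀ {A B C : Set} (f : A → B → C) xs → cartesianProductWith f xs [] ≡ []
  product-[] f []       = refl
  product-[] f (x ∷ xs) = product-[] f xs

  bracketings≤0 : ∀ h → bracketings≤ h 0 ≡ []
  bracketings≤0 zero = refl
  bracketings≤0 (suc h) rewrite bracketings≤0 h = refl

  mutual
    -- In a split of n into positive parts both parts are smaller than n, so induction applies to
    -- each. A part 0 empties the product, since no bracketing has 0 leaves.
    stable : ∀ h n → n ℕ.≤ h → bracketings≤ (suc h) n ≡ bracketings≤ h n
    stable zero    zero z≤n = refl
    stable (suc h) n    p   = cong (atoms n ++_)
      (cong List.concat (List.map-cong (λ s → join-stable h p s) (splits n)))

    join-stable : ∀ h {n} → n ℕ.≤ suc h → (s : ∃₂ λ a b → a ℕ.+ b ≡ n) → join (suc h) s ≡ join h s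
    join-stable h p (zero , b , refl)
      rewrite bracketings≤0 (suc h) | bracketings≤0 h = refl
    join-stable h p (suc a , zero , refl) = trans (empty (suc h)) (sym (empty h))
      where
      empty : ∀ h → cartesianProductWith _⇒_ (bracketings≤ h (suc a)) (bracketings≤ h 0) ≡ []
      empty h = trans (cong (cartesianProductWith _⇒_ (bracketings≤ h (suc a))) (bracketings≤0 h))
                      (product-[] _⇒_ (bracketings≤ h (suc a)))
    join-stable h p (suc a , suc b , refl) =
      cong₂ (cartesianProductWith _⇒_) (stable h (suc a) (ℕ.≤-pred (ℕ.≤-trans (s≤s (ℕ.m≤m+n (suc a) b)) q)))
        (stable h (suc b) (ℕ.≤-pred (ℕ.≤-trans (s≤s (s≤s (ℕ.m≤n+m b a))) q)))
      where
      q : suc (suc (a ℕ.+ b)) ℕ.≤ suc h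
      q = subst (ℕ._≤ suc h) (ℕ.+-suc (suc a) b) p

  bracketings-stable : ∀ {h n} → n ℕ.≤ h → bracketings≤ h n ≡ bracketings n
  bracketings-stable {h} {n} p = subst (λ k → bracketings≤ k n ≡ bracketings n) (ℕ.m∸n+n≡m p) (go (h ℕ.∸ n))
    where
    go : ∀ k → bracketings≤ (k ℕ.+ n) n ≡ bracketings n
    go zero    = refl
    go (suc k) = trans (stable (k ℕ.+ n) n (ℕ.m≤n+m n k)) (go k)

  take-++ : ∀ {A : Set} a {b} (ρ : Vec A a) (σ : Vec A b) → Vec.take a (ρ Vec.++ σ) ≡ ρ
  take-++ zero    []      σ = refl
  take-++ (suc a) (x ∷ ρ) σ = cong (x ∷_) (take-++ a ρ σ)

  drop-++ : ∀ {A : Set} a {b} (ρ : Vec A a) (σ : Vec A b) → Vec.drop a (ρ Vec.++ σ) ≡ σ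
  drop-++ zero    []      σ = refl
  drop-++ (suc a) (x ∷ ρ) σ = drop-++ a ρ σ

-- Generating functions of truth values

module Weights (m : ℕ) .{{_ : NonTrivial m}} (r : ℚ) where
  open import Data.Rational.Base using (_+_; _-_; _*_; -_; _≤_; _<_; ∣_∣)
  open +-*-Solver using (solve; _:=_; _:+_; _:*_; _:-_; :-_; con)
  open Rational
  open Order
  open Sums
  open ListSums
  open Enumeration

  value : ∀ {n} → (Fin m → ℚ) → Bracketing n → ℚ
  value {n} φ t = ∑ˡ (valuations m n) λ ρ → φ (eval t ρ)

  infixr 8 r^_
  r^_ : ℕ → ℚ
  r^ zero  = 1ℚ
  r^ suc n = r * r^ n

  r^-+ : ∀ a b → r^ (a ℕ.+ b) ≡ r^ a * r^ b
  r^-+ zero    b = sym (ℚ.*-identityˡ (r^ b))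
  r^-+ (suc a) b = trans (cong (r *_) (r^-+ a b)) (sym (ℚ.*-assoc r (r^ a) (r^ b)))

  -- Coefficient of z^n in the generating function at rz, as a linear functional of φ. Indicators φ
  -- of sets of truth values give the scaled counts.
  weight : (Fin m → ℚ) → ℕ → ℚ
  weight φ n = r^ n * ∑ˡ (bracketings n) (value φ)

  ∑-valuations : ∀ a b φ → ∑ˡ (valuations m (a ℕ.+ b)) φ ≡
                 ∑ˡ (valuations m a) λ ρ → ∑ˡ (valuations m b) λ σ → φ (ρ Vec.++ σ)
  ∑-valuations zero    b φ = sym (ℚ.+-identityʳ _)
  ∑-valuations (suc a) b φ = begin
    ∑ˡ (valuations m (suc a ℕ.+ b)) φ
      ≡⟨ ∑ˡ-product _∷_ (allFin m) (valuations m (a ℕ.+ b)) φ ⟩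
    ∑ˡ (allFin m) (λ v → ∑ˡ (valuations m (a ℕ.+ b)) λ ρ → φ (v ∷ ρ))
      ≡⟨ ∑ˡ-cong (allFin m) (λ v → ∑-valuations a b (λ ρ → φ (v ∷ ρ))) ⟩
    ∑ˡ (allFin m) (λ v → ∑ˡ (valuations m a) λ ρ → ∑ˡ (valuations m b) λ σ → φ (v ∷ (ρ Vec.++ σ)))
      ≡⟨ ∑ˡ-product _∷_ (allFin m) (valuations m a) (λ ρ → ∑ˡ (valuations m b) λ σ → φ (ρ Vec.++ σ)) ⟨
    ∑ˡ (valuations m (suc a)) (λ ρ → ∑ˡ (valuations m b) λ σ → φ (ρ Vec.++ σ)) ∎
    where open ≡-Reasoning

  module _ {φ α β : Fin m → ℚ} (factor : ∀ p q → φ (p ⇒ᴳ q) ≡ α p * β q) where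

    -- The two sides have disjoint variables, so a valuation of the implication is an independent
    -- pair of valuations and the factorisation of φ passes to the sums.
    value-⇒ : ∀ {a b} (s : Bracketing a) (t : Bracketing b) → value φ (s ⇒ t) ≡ value α s * value β t
    value-⇒ {a} {b} s t = begin
      value φ (s ⇒ t)
        ≡⟨ ∑-valuations a b (λ ρ → φ (eval (s ⇒ t) ρ)) ⟩
      ∑ˡ (valuations m a) (λ ρ → ∑ˡ (valuations m b) λ σ → φ
          (eval s (Vec.take a (ρ Vec.++ σ)) ⇒ᴳ eval t (Vec.drop a (ρ Vec.++ σ))))
        ≡⟨ ∑ˡ-cong (valuations m a) (λ ρ → ∑ˡ-cong (valuations m b) λ σ →
             trans (cong₂ (λ x y → φ (eval s x ⇒ᴳ eval t y)) (take-++ a ρ σ) (drop-++ a ρ σ))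
                 (factor (eval s ρ) (eval t σ))) ⟩
      ∑ˡ (valuations m a) (λ ρ → ∑ˡ (valuations m b) λ σ → α (eval s ρ) * β (eval t σ))
        ≡⟨ ∑ˡ-cong (valuations m a) (λ ρ → trans (∑ˡ-* (valuations m b) (α (eval s ρ)) (λ σ → β (eval t σ)))
             (ℚ.*-comm (α (eval s ρ)) (value β t))) ⟩
      ∑ˡ (valuations m a) (λ ρ → value β t * α (eval s ρ))
        ≡⟨ ∑ˡ-* (valuations m a) (value β t) (λ ρ → α (eval s ρ)) ⟩
      value β t * value α s
        ≡⟨ ℚ.*-comm (value β t) (value α s) ⟩
      value α s * value β t ∎
      where open ≡-Reasoning

    private
      X Y : ℕ → ℚ
      X a = ∑ˡ (bracketings a) (value α)
      Y b = ∑ˡ (bracketings b) (value β)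

    ∑-join : ∀ n {k} (s : ∃₂ λ a b → a ℕ.+ b ≡ k) → k ℕ.≤ suc n →
             ∑ˡ (join n s) (value φ) ≡ X (proj₁ s) * Y (proj₁ (proj₂ s))
    ∑-join n (a , b , refl) p = begin
      ∑ˡ (join n (a , b , refl)) (value φ)
        ≡⟨ ∑ˡ-product _⇒_ (bracketings≤ n a) (bracketings≤ n b) (value φ) ⟩
      ∑ˡ (bracketings≤ n a) (λ s → ∑ˡ (bracketings≤ n b) λ t → value φ (s ⇒ t))
        ≡⟨ ∑ˡ-cong (bracketings≤ n a) (λ s → trans (∑ˡ-cong (bracketings≤ n b) (λ t → value-⇒ s t))
             (trans (∑ˡ-* (bracketings≤ n b) (value α s) (value β))
               (ℚ.*-comm (value α s) (∑ˡ (bracketings≤ n b) (value β))))) ⟩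
      ∑ˡ (bracketings≤ n a) (λ s → ∑ˡ (bracketings≤ n b) (value β) * value α s)
        ≡⟨ ∑ˡ-* (bracketings≤ n a) (∑ˡ (bracketings≤ n b) (value β)) (value α) ⟩
      ∑ˡ (bracketings≤ n b) (value β) * ∑ˡ (bracketings≤ n a) (value α)
        ≡⟨ ℚ.*-comm (∑ˡ (bracketings≤ n b) (value β)) (∑ˡ (bracketings≤ n a) (value α)) ⟩
      ∑ˡ (bracketings≤ n a) (value α) * ∑ˡ (bracketings≤ n b) (value β)
        ≡⟨ proper a b p ⟩
      X a * Y b ∎
      where
      open ≡-Reasoning
      proper : ∀ a b → a ℕ.+ b ℕ.≤ suc n →
               ∑ˡ (bracketings≤ n a) (value α) * ∑ˡ (bracketings≤ n b) (value β) ≡ X a * Y b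
      -- Here b may be n + 1, outside the range of `bracketings-stable`, but the other factor is an
      -- empty sum on both sides.
      proper zero b p rewrite bracketings≤0 n =
        trans (ℚ.*-zeroˡ (∑ˡ (bracketings≤ n b) (value β))) (sym (ℚ.*-zeroˡ (Y b)))
      proper (suc a) zero p rewrite bracketings≤0 n =
        trans (ℚ.*-zeroʳ (∑ˡ (bracketings≤ n (suc a)) (value α))) (sym (ℚ.*-zeroʳ (X (suc a))))
      proper (suc a) (suc b) (s≤s p) = cong₂ (λ xs ys → ∑ˡ xs (value α) * ∑ˡ ys (value β))
        (bracketings-stable (ℕ.≤-trans (ℕ.≤-trans (s≤s (ℕ.m≤m+n a b)) (ℕ.≤-reflexive (sym (ℕ.+-suc a b)))) p))
        (bracketings-stable (ℕ.≤-trans (ℕ.m≤n+m (suc b) a) p))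

    weight-⊛ : ∀ n → weight φ (suc (suc n)) ≡ (weight α ⊛ weight β) (suc (suc n))
    weight-⊛ n = begin
      r^ N * ∑ˡ (bracketings N) (value φ)
        ≡⟨ cong (r^ N *_) (∑ˡ-concatMap (join (suc n)) (splits N) (value φ)) ⟩
      r^ N * ∑ˡ (splits N) (λ s → ∑ˡ (join (suc n) s) (value φ))
        ≡⟨ ∑ˡ-* (splits N) (r^ N) (λ s → ∑ˡ (join (suc n) s) (value φ)) ⟨
      ∑ˡ (splits N) (λ s → r^ N * ∑ˡ (join (suc n) s) (value φ))
        ≡⟨ ∑ˡ-cong (splits N) step ⟩
      ∑ˡ (splits N) (λ (a , b , _) → weight α a * weight β b)
        ≡⟨ ∑ˡ-splits N (weight α) (weight β) ⟩
      (weight α ⊛ weight β) N ∎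
      where
      open ≡-Reasoning
      N = suc (suc n)
      step : (s : ∃₂ λ a b → a ℕ.+ b ≡ N) →
             r^ N * ∑ˡ (join (suc n) s) (value φ) ≡ weight α (proj₁ s) * weight β (proj₁ (proj₂ s))
      step s@(a , b , e) = trans
        (cong₂ _*_ (trans (cong r^_ (sym e)) (r^-+ a b)) (∑-join (suc n) s ℕ.≤-refl))
        (solve 4 (λ p q x y → p :* q :* (x :* y) := p :* x :* (q :* y)) refl (r^ a) (r^ b) (X a) (Y b))

  weight-1 : ∀ φ → weight φ 1 ≡ r * ∑ˡ (allFin m) φ
  weight-1 φ = begin
    r * 1ℚ * (value φ leaf + 0ℚ)
      ≡⟨ solve 2 (λ r v → r :* con 1ℚ :* (v :+ con 0ℚ) := r :* v) refl r (value φ leaf) ⟩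
    r * value φ leaf
      ≡⟨ cong (r *_) (trans (∑ˡ-product _∷_ (allFin m) (valuations m 0) (λ ρ → φ (eval leaf ρ)))
           (∑ˡ-cong (allFin m) (λ v → ℚ.+-identityʳ (φ v)))) ⟩
    r * ∑ˡ (allFin m) φ ∎
    where open ≡-Reasoning

  weight-- : ∀ φ ψ n → weight (λ v → φ v - ψ v) n ≡ weight φ n - weight ψ n
  weight-- φ ψ n = trans
    (cong (r^ n *_) (trans (∑ˡ-cong (bracketings n)
        (λ t → ∑ˡ-- (valuations m n) (λ ρ → φ (eval t ρ)) (λ ρ → ψ (eval t ρ))))
      (∑ˡ-- (bracketings n) (value φ) (value ψ))))
    (solve 3 (λ p x y → p :* (x :- y) := p :* x :- p :* y) refl (r^ n) (∑ˡ (bracketings n) (value φ))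
        (∑ˡ (bracketings n) (value ψ)))

  module _ (0<r : 0ℚ < r) where

    0<r^ : ∀ n → 0ℚ < r^ n
    0<r^ zero    = ℚ.positive⁻¹ 1ℚ
    0<r^ (suc n) = 0<* 0<r (0<r^ n)

    weight-nonNeg : ∀ {φ} → (∀ v → 0ℚ ≤ φ v) → ∀ n → 0ℚ ≤ weight φ n
    weight-nonNeg p n = ℚ.<⇒≤ (0<r^ n) ⊗ ∑ˡ-nonNeg (bracketings n)
        (λ t → ∑ˡ-nonNeg (valuations m n) (λ ρ → p (eval t ρ)))

    weight-mono : ∀ {φ ψ} → (∀ v → φ v ≤ ψ v) → ∀ n → weight φ n ≤ weight ψ n
    weight-mono {φ} {ψ} p n = ℚ.*-monoˡ-≤-nonNeg (r^ n) {{ℚ.nonNegative (ℚ.<⇒≤ (0<r^ n))}}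
      (∑ˡ-mono (bracketings n) (λ t → ∑ˡ-mono (valuations m n) (λ ρ → p (eval t ρ))))

  nat-g : ∀ n j → nat (g m n j) ≡ ∑ˡ (bracketings n) (value (λ v → indicator (v Fin.≟ j)))
  nat-g n j = trans (length-filter (λ (t , ρ) → eval t ρ Fin.≟ j) (cartesianProduct (bracketings n) (valuations m n)))
    (∑ˡ-product _,_ (bracketings n) (valuations m n) (λ (t , ρ) → indicator (eval t ρ Fin.≟ j)))

  indicator-yes : ∀ {P : Set} (d : Dec P) → P → indicator d ≡ 1ℚ
  indicator-yes (yes _) p = refl
  indicator-yes (no ¬p) p = contradiction p ¬p

  indicator-no : ∀ {P : Set} (d : Dec P) → (P → 0ℚ ≡ 1ℚ) → indicator d ≡ 0ℚ
  indicator-no (yes p) ¬p = sym (¬p p)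
  indicator-no (no _)  ¬p = refl

  nat-total : ∀ n → nat (total m n) ≡ ∑ˡ (bracketings n) (value (λ _ → 1ℚ))
  nat-total n = begin
    nat (sum (map (g m n) (allFin m)))
      ≡⟨ nat-sum (g m n) (allFin m) ⟩
    ∑ˡ (allFin m) (λ j → nat (g m n j))
      ≡⟨ ∑ˡ-cong (allFin m) (nat-g n) ⟩
    ∑ˡ (allFin m) (λ j → ∑ˡ (bracketings n) λ t → ∑ˡ (valuations m n) λ ρ → indicator (eval t ρ Fin.≟ j))
      ≡⟨ ∑ˡ-swap (allFin m) (bracketings n) (λ j t → ∑ˡ (valuations m n) λ ρ → indicator (eval t ρ Fin.≟ j)) ⟩
    ∑ˡ (bracketings n) (λ t → ∑ˡ (allFin m) λ j → ∑ˡ (valuations m n) λ ρ → indicator (eval t ρ Fin.≟ j))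
      ≡⟨ ∑ˡ-cong (bracketings n) (λ t → trans (∑ˡ-swap (allFin m) (valuations m n)
          (λ j ρ → indicator (eval t ρ Fin.≟ j)))
           (∑ˡ-cong (valuations m n) λ ρ → one (eval t ρ))) ⟩
    ∑ˡ (bracketings n) (value (λ _ → 1ℚ)) ∎
    where
    open ≡-Reasoning
    one : ∀ v → ∑ˡ (allFin m) (λ j → indicator (v Fin.≟ j)) ≡ 1ℚ
    one v = ∑ˡ-point (λ j → j) v (indicator-yes (v Fin.≟ v) refl)
      (λ j ne → indicator-no (v Fin.≟ j) λ e → contradiction (sym e) ne)

-- The levels of the chain and their recursions

module Levels (m : ℕ) .{{_ : NonTrivial m}} where
  open import Data.Rational.Base using (_+_; _-_; _*_; -_; _≤_; _<_; ∣_∣)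
  open +-*-Solver using (solve; _:=_; _:+_; _:*_; _:-_; :-_; con)
  open Rational
  open Order
  open Sums
  open ListSums

  r : ℚ
  r = ½ * ½ * 1/ m

  open Weights m r

  ge : ℕ → ℕ → ℚ
  ge zero    i       = 1ℚ
  ge (suc k) zero    = 0ℚ
  ge (suc k) (suc i) = ge k i

  ge-yes : ∀ {k i} → k ℕ.≤ i → ge k i ≡ 1ℚ
  ge-yes z≤n     = refl
  ge-yes (s≤s p) = ge-yes p

  ge-no : ∀ {k i} → i ℕ.< k → ge k i ≡ 0ℚ
  ge-no {suc k} {zero}  p       = refl
  ge-no {suc k} {suc i} (s≤s p) = ge-no p

  0≤ge : ∀ k i → 0ℚ ≤ ge k i
  0≤ge zero    i       = 0≤1
  0≤ge (suc k) zero    = ℚ.≤-refl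
  0≤ge (suc k) (suc i) = 0≤ge k i

  ge-antitone : ∀ k i → ge (suc k) i ≤ ge k i
  ge-antitone zero    zero    = 0≤1
  ge-antitone zero    (suc i) = ℚ.≤-refl
  ge-antitone (suc k) zero    = ℚ.≤-refl
  ge-antitone (suc k) (suc i) = ge-antitone k i

  -- The indicator of i = k, written as a difference so that its weights are differences of `upper`.
  eq : ℕ → ℕ → ℚ
  eq k i = ge k i - ge (suc k) i

  eq-diag : ∀ k → eq k k ≡ 1ℚ
  eq-diag zero    = refl
  eq-diag (suc k) = eq-diag k

  eq-above : ∀ {k i} → k ℕ.< i → eq k i ≡ 0ℚ
  eq-above {k} {i} p = cong₂ _-_ (ge-yes (ℕ.<⇒≤ p)) (ge-yes p)

  eq-below : ∀ {k i} → i ℕ.< k → eq k i ≡ 0ℚ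
  eq-below {k} {i} p = cong₂ _-_ (ge-no p) (ge-no (ℕ.m≤n⇒m≤1+n p))

  toℕ-top : ∀ m .{{_ : NonTrivial m}} → suc (toℕ (top {m})) ≡ m
  toℕ-top (suc k) = cong suc (Fin.toℕ-fromℕ k)

  -- A value below the top can only come from the case p > q, where the result is q. So the result
  -- is k exactly if q = k and p ≥ k + 1, a condition on p times a condition on q.
  eq-⇒ : ∀ {k} → suc k ℕ.< m → ∀ p q →
         eq k (toℕ (p ⇒ᴳ q)) ≡ ge (suc k) (toℕ p) * eq k (toℕ q)
  eq-⇒ {k} k<top p q with p Fin.≤? q
  ... | yes p≤q = trans (eq-above {k} (ℕ.≤-pred (subst (suc k ℕ.<_) (sym (toℕ-top m)) k<top))) (sym (product p≤q))
    where
    product : toℕ p ℕ.≤ toℕ q → ge (suc k) (toℕ p) * eq k (toℕ q) ≡ 0ℚ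
    product p≤q with ℕ.≤-<-connex (suc k) (toℕ p)
    ... | inj₁ k<p = trans (cong (ge (suc k) (toℕ p) *_) (eq-above {k} (ℕ.≤-trans k<p p≤q)))
        (ℚ.*-zeroʳ (ge (suc k) (toℕ p)))
    ... | inj₂ p<k = trans (cong (_* eq k (toℕ q)) (ge-no p<k)) (ℚ.*-zeroˡ (eq k (toℕ q)))
  ... | no  p≰q with ℕ.≤-<-connex k (toℕ q)
  ...   | inj₁ k≤q = sym (trans (cong (_* eq k (toℕ q)) (ge-yes (ℕ.≤-<-trans k≤q (ℕ.≰⇒> p≰q))))
      (ℚ.*-identityˡ (eq k (toℕ q))))
  ...   | inj₂ q<k = trans (eq-below q<k) (sym (trans (cong (ge (suc k) (toℕ p) *_) (eq-below q<k))
      (ℚ.*-zeroʳ (ge (suc k) (toℕ p)))))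

  -- The coefficients of G_k + ⋯ + G_{m-1}, scaled so that the dominant
  -- singularity is at 1.
  upper : ℕ → ℕ → ℚ
  upper k = weight (λ v → ge k (toℕ v))

  exact : ℕ → ℕ → ℚ
  exact k n = upper k n - upper (suc k) n

  nat-1/ : ∀ m .{{_ : NonTrivial m}} → nat m * 1/ m ≡ 1ℚ
  nat-1/ (suc k) = mesh-inverse k

  0<r : 0ℚ < r
  0<r = 0<* (ℚ.positive⁻¹ (½ * ½)) (0<1/ m)

  upper-nonNeg : ∀ k n → 0ℚ ≤ upper k n
  upper-nonNeg k = weight-nonNeg 0<r (λ v → 0≤ge k (toℕ v))

  upper-antitone : ∀ k n → upper (suc k) n ≤ upper k n
  upper-antitone k = weight-mono 0<r (λ v → ge-antitone k (toℕ v))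

  exact-weight : ∀ k n → weight (λ v → eq k (toℕ v)) n ≡ exact k n
  exact-weight k = weight-- (λ v → ge k (toℕ v)) (λ v → ge (suc k) (toℕ v))

  exact-⊛ : ∀ {k} → suc k ℕ.< m → ∀ n → exact k (suc (suc n)) ≡ (exact k ⊛ upper (suc k)) (suc (suc n))
  exact-⊛ {k} k<top n = begin
    exact k N                                              ≡⟨ exact-weight k N ⟨
    weight (λ v → eq k (toℕ v)) N
        ≡⟨ weight-⊛ {λ v → eq k (toℕ v)} {λ v → ge (suc k) (toℕ v)} {λ v → eq k (toℕ v)} (eq-⇒ k<top) n ⟩
    (upper (suc k) ⊛ weight (λ v → eq k (toℕ v))) N        ≡⟨ ⊛-comm (upper (suc k)) (weight (λ v → eq k (toℕ v))) N ⟩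
    (weight (λ v → eq k (toℕ v)) ⊛ upper (suc k)) N        ≡⟨ ∑-cong N
        (λ i _ → cong (_* upper (suc k) (N ℕ.∸ i)) (exact-weight k i)) ⟩
    (exact k ⊛ upper (suc k)) N                            ∎
    where
    open ≡-Reasoning
    N = suc (suc n)

  exact-1 : ∀ {k} → k ℕ.< m → exact k 1 ≡ r
  exact-1 {k} k<m = trans (sym (exact-weight k 1)) (trans (weight-1 (λ v → eq k (toℕ v)))
    (trans (cong (r *_) (∑ˡ-point (λ j → j) (fromℕ< k<m)
      (trans (cong (eq k) (Fin.toℕ-fromℕ< k<m)) (eq-diag k)) off)) (ℚ.*-identityʳ r)))
    where
    off : ∀ j → j ≢ fromℕ< k<m → eq k (toℕ j) ≡ 0ℚ
    off j ne with ℕ.<-cmp (toℕ j) k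
    ... | tri< p _ _ = eq-below p
    ... | tri≈ _ p _ = contradiction (Fin.toℕ-injective (trans p (sym (Fin.toℕ-fromℕ< k<m)))) ne
    ... | tri> _ _ p = eq-above {k} p

  ∑ˡ-one : ∀ {A : Set} {n} (f : Fin n → A) → ∑ˡ (tabulate f) (λ _ → 1ℚ) ≡ nat n
  ∑ˡ-one {n = zero}  f = refl
  ∑ˡ-one {n = suc n} f = trans (cong (1ℚ +_) (∑ˡ-one (λ j → f (Fin.suc j))))
      (trans (ℚ.+-comm 1ℚ (nat n)) (sym (nat-suc n)))

  upper₀-1 : upper 0 1 ≡ ½ * ½
  upper₀-1 = trans (weight-1 (λ _ → 1ℚ)) (trans (cong (r *_) (∑ˡ-one {n = m} (λ j → j)))
    (trans (solve 2 (λ i n → con (½ * ½) :* i :* n := con (½ * ½) :* (n :* i)) refl (1/ m) (nat m))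
           (cong (½ * ½ *_) (nat-1/ m))))

  upper₀-⊛ : ∀ n → upper 0 (suc (suc n)) ≡ (upper 0 ⊛ upper 0) (suc (suc n))
  upper₀-⊛ = weight-⊛ {λ _ → 1ℚ} {λ _ → 1ℚ} {λ _ → 1ℚ} (λ _ _ → refl)

  upper₀-positive : ∀ n → 0ℚ < upper 0 (suc n)
  upper₀-positive n = 0<* (0<r^ 0<r (suc n)) (subst (0ℚ <_) (nat-total (suc n))
    (positive (total m (suc n)) {{total-nonZero m n}}))
    where
    positive : ∀ k .{{_ : NonZero k}} → 0ℚ < nat k
    positive (suc k) = 0<nat k

  /ℕ-* : ∀ i t .{{_ : NonZero t}} → (ℤ.+ i ℚ./ t) * nat t ≡ nat i
  /ℕ-* i (suc t) = ℚ.toℚᵘ-injective (begin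
    ℚ.toℚᵘ ((ℤ.+ i ℚ./ suc t) * nat (suc t))
      ≈⟨ ℚ.toℚᵘ-homo-* (ℤ.+ i ℚ./ suc t) (nat (suc t)) ⟩
    ℚ.toℚᵘ (ℤ.+ i ℚ./ suc t) ℚᵘ.* ℚ.toℚᵘ (nat (suc t))
      ≈⟨ ℚᵘ.*-cong (ℚ.toℚᵘ-fromℚᵘ (ℚᵘ.mkℚᵘ (ℤ.+ i) t)) (ℚ.toℚᵘ-fromℚᵘ (ℚᵘ.mkℚᵘ (ℤ.+ suc t) 0)) ⟩
    ℚᵘ.mkℚᵘ (ℤ.+ i) t ℚᵘ.* ℚᵘ.mkℚᵘ (ℤ.+ suc t) 0
      ≈⟨ ℚᵘ.*≡* (trans (ℤ.*-identityʳ (ℤ.+ i ℤ.* ℤ.+ suc t))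
           (cong (ℤ.+ i ℤ.*_) (cong (λ k → ℤ.+ suc k) (sym (ℕ.*-identityʳ t))))) ⟩
    ℚᵘ.mkℚᵘ (ℤ.+ i) 0
      ≈⟨ ℚ.toℚᵘ-fromℚᵘ (ℚᵘ.mkℚᵘ (ℤ.+ i) 0) ⟨
    ℚ.toℚᵘ (nat i) ∎)
    where open ℚᵘ.≃-Reasoning

  -- The scaling `r^ n` cancels from the quotient. The product form also covers n = 0, where
  -- `topShare` has its dummy value.
  topShare-* : ∀ n → topShare m n * upper 0 n ≡ upper (m ℕ.∸ 1) n
  topShare-* zero    = refl
  topShare-* (suc n) = begin
    s * (r^ N * ∑ˡ (bracketings N) (value (λ _ → 1ℚ)))
      ≡⟨ cong (λ z → s * (r^ N * z)) (nat-total N) ⟨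
    s * (r^ N * nat (total m N))
      ≡⟨ solve 3 (λ s p t → s :* (p :* t) := p :* (s :* t)) refl s (r^ N) (nat (total m N)) ⟩
    r^ N * (s * nat (total m N))
      ≡⟨ cong (r^ N *_) (/ℕ-* (g m N top) (total m N) {{total-nonZero m n}}) ⟩
    r^ N * nat (g m N top)
      ≡⟨ cong (r^ N *_) (trans (nat-g N top) (∑ˡ-cong (bracketings N) λ t → ∑ˡ-cong (valuations m N) λ ρ → maximal
          (eval t ρ))) ⟩
    upper (m ℕ.∸ 1) N ∎
    where
    open ≡-Reasoning
    N = suc n
    s = topShare m N
    toℕ-top′ : toℕ (top {m}) ≡ m ℕ.∸ 1
    toℕ-top′ = cong (ℕ._∸ 1) (toℕ-top m)
    maximal : ∀ v → indicator (v Fin.≟ top) ≡ ge (m ℕ.∸ 1) (toℕ v)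
    maximal v with v Fin.≟ top
    ... | yes refl = sym (ge-yes (ℕ.≤-reflexive (sym toℕ-top′)))
    ... | no  ne   = sym (ge-no (subst (toℕ v ℕ.<_) toℕ-top′
      (ℕ.≤∧≢⇒< (ℕ.≤-pred (ℕ.≤-trans (Fin.toℕ<n v) (ℕ.≤-reflexive (sym (toℕ-top m)))))
          (λ e → ne (Fin.toℕ-injective e)))))

open import Defs
open import Data.Nat.Base using (ℕ; _<_; _∸_; NonTrivial)

-- Order and arithmetic of Cauchy reals

module Reals where
  open Rational hiding (∣∣-∣∣≤)
  open Order
  open +-*-Solver using (solve; _:=_; _:+_; _:*_; _:-_; :-_; con)

  -- Wrapping the two relations, and indexing them by sequences alone, lets Agda
  -- infer what they relate: a Cauchy proof cannot be recovered by unification.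
  infix 4 _≈ₛ_ _≲ₛ_ _≈_ _≲_
  record _≈ₛ_ (f g : ℕ → ℚ) : Set where
    constructor equal
    field unwrap : ∀ {ε} → 0ℚ ℚ.< ε → ∃[ N ] (∀ n → N ℕ.≤ n → ℚ.∣ f n ℚ.- g n ∣ ℚ.< ε)

  record _≲ₛ_ (f g : ℕ → ℚ) : Set where
    constructor below
    field unwrap : ∀ {ε} → 0ℚ ℚ.< ε → ∃[ N ] (∀ n → N ℕ.≤ n → f n ℚ.≤ g n ℚ.+ ε)

  _≈_ _≲_ : ℝ → ℝ → Set
  x ≈ y = seq x ≈ₛ seq y
  x ≲ y = seq x ≲ₛ seq y

  half< : ∀ {ε} → 0ℚ ℚ.< ε → ½ ℚ.* ε ℚ.< ε
  half< {ε} 0<ε = subst₂ ℚ._<_ (ℚ.+-identityʳ (½ ℚ.* ε)) (half+half ε) (ℚ.+-monoʳ-< (½ ℚ.* ε) (0<* 0<½ 0<ε))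

  eventually : ∀ {f g} N → (∀ n → N ℕ.≤ n → f n ≡ g n) → f ≈ₛ g
  eventually {f} {g} N e = equal λ {ε} 0<ε → N , λ n p →
    subst (λ z → ℚ.∣ z ∣ ℚ.< ε) (sym (trans (cong (ℚ._- g n) (e n p)) (ℚ.+-inverseʳ (g n)))) 0<ε

  pointwise : ∀ {f g} → (∀ n → f n ≡ g n) → f ≈ₛ g
  pointwise e = eventually 0 λ n _ → e n

  ≈-refl : ∀ {f} → f ≈ₛ f
  ≈-refl = pointwise λ _ → refl

  same : ∀ x → x ≈ x
  same x = ≈-refl

  ≈-sym : ∀ {f g} → f ≈ₛ g → g ≈ₛ f
  ≈-sym {f} {g} (equal p) = equal λ {ε} 0<ε → let N , F = p 0<ε in N , λ n q →
    subst (ℚ._< ε) (∣-∣-swap (f n) (g n)) (F n q)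

  ≈-trans : ∀ {f g h} → f ≈ₛ g → g ≈ₛ h → f ≈ₛ h
  ≈-trans {f} {g} {h} (equal p) (equal q) = equal λ {ε} 0<ε →
    let M , F = p (0<* 0<½ 0<ε)
        N , G = q (0<* 0<½ 0<ε)
    in M ℕ.⊔ N , λ n r → subst (ℚ.∣ f n ℚ.- h n ∣ ℚ.<_) (half+half ε)
      (ℚ.≤-<-trans (subst (λ d → ℚ.∣ d ∣ ℚ.≤ ℚ.∣ f n ℚ.- g n ∣ ℚ.+ ℚ.∣ g n ℚ.- h n ∣)
          (solve 3 (λ x y z → x :- y :+ (y :- z) := x :- z) refl (f n) (g n) (h n))
          (ℚ.∣p+q∣≤∣p∣+∣q∣ (f n ℚ.- g n) (g n ℚ.- h n)))
        (ℚ.+-mono-< (F n (⊔≤ˡ r)) (G n (⊔≤ʳ r))))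

  ≈⇒≲ : ∀ {f g} → f ≈ₛ g → f ≲ₛ g
  ≈⇒≲ (equal p) = below λ 0<ε → let N , F = p 0<ε in N , λ n q → ∣-∣≤⇒≤ (ℚ.<⇒≤ (F n q))

  ≲-trans : ∀ {f g h} → f ≲ₛ g → g ≲ₛ h → f ≲ₛ h
  ≲-trans {f} {g} {h} (below p) (below q) = below λ {ε} 0<ε →
    let M , F = p (0<* 0<½ 0<ε)
        N , G = q (0<* 0<½ 0<ε)
    in M ℕ.⊔ N , λ n r → ℚ.≤-trans (F n (⊔≤ˡ r)) (subst (g n ℚ.+ ½ ℚ.* ε ℚ.≤_)
      (trans (ℚ.+-assoc (h n) (½ ℚ.* ε) (½ ℚ.* ε)) (cong (h n ℚ.+_) (half+half ε)))
      (ℚ.+-monoˡ-≤ (½ ℚ.* ε) (G n (⊔≤ʳ r))))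

  ≲-preorder : Preorder _ _ _
  ≲-preorder = record
    { Carrier    = ℝ
    ; _≈_        = _≈_
    ; _≲_        = _≲_
    ; isPreorder = record
      { isEquivalence = record { refl = ≈-refl ; sym = ≈-sym ; trans = ≈-trans }
      ; reflexive     = ≈⇒≲
      ; trans         = ≲-trans
      }
    }

  module ≲-Reasoning = PreorderReasoning ≲-preorder

  ≲-antisym : ∀ {f g} → f ≲ₛ g → g ≲ₛ f → f ≈ₛ g
  ≲-antisym {f} {g} (below p) (below q) = equal λ {ε} 0<ε →
    let M , F = p (0<* 0<½ 0<ε)
        N , G = q (0<* 0<½ 0<ε)
    in M ℕ.⊔ N , λ n r → ∣∣<
      (ℚ.≤-<-trans (F n (⊔≤ˡ r)) (ℚ.+-monoʳ-< (g n) (half< 0<ε)))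
      (ℚ.≤-<-trans (G n (⊔≤ʳ r)) (ℚ.+-monoʳ-< (f n) (half< 0<ε)))

  pointwise-≲ : ∀ {f g} → (∀ n → f n ℚ.≤ g n) → f ≲ₛ g
  pointwise-≲ e = below λ 0<ε → 0 , λ n _ → ℚ.≤-trans (e n) (slack (ℚ.<⇒≤ 0<ε) refl)

  +-cong : ∀ {f f′ g g′} → f ≈ₛ f′ → g ≈ₛ g′ → (λ n → f n ℚ.+ g n) ≈ₛ (λ n → f′ n ℚ.+ g′ n)
  +-cong {f} {f′} {g} {g′} (equal p) (equal q) = equal λ {ε} 0<ε →
    let M , F = p (0<* 0<½ 0<ε)
        N , G = q (0<* 0<½ 0<ε)
    in M ℕ.⊔ N , λ n r → subst (ℚ.∣ f n ℚ.+ g n ℚ.- (f′ n ℚ.+ g′ n) ∣ ℚ.<_) (half+half ε)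
      (ℚ.≤-<-trans (subst (λ d → ℚ.∣ d ∣ ℚ.≤ ℚ.∣ f n ℚ.- f′ n ∣ ℚ.+ ℚ.∣ g n ℚ.- g′ n ∣)
          (solve 4 (λ a b c d → a :- b :+ (c :- d) := a :+ c :- (b :+ d)) refl (f n) (f′ n) (g n) (g′ n))
          (ℚ.∣p+q∣≤∣p∣+∣q∣ (f n ℚ.- f′ n) (g n ℚ.- g′ n)))
        (ℚ.+-mono-< (F n (⊔≤ˡ r)) (G n (⊔≤ʳ r))))

  neg-cong : ∀ {f g} → f ≈ₛ g → (λ n → ℚ.- f n) ≈ₛ (λ n → ℚ.- g n)
  neg-cong {f} {g} (equal p) = equal λ {ε} 0<ε → let N , F = p 0<ε in N , λ n q →
    subst (ℚ._< ε) (trans (∣-∣-swap (f n) (g n))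
      (cong ℚ.∣_∣ (solve 2 (λ a b → b :- a := :- a :- :- b) refl (f n) (g n)))) (F n q)

  minus-cong : ∀ {f f′ g g′} → f ≈ₛ f′ → g ≈ₛ g′ → (λ n → f n ℚ.- g n) ≈ₛ (λ n → f′ n ℚ.- g′ n)
  minus-cong p q = +-cong p (neg-cong q)

  *-comm : ∀ (f g : ℕ → ℚ) → (λ n → f n ℚ.* g n) ≈ₛ (λ n → g n ℚ.* f n)
  *-comm f g = pointwise λ n → ℚ.*-comm (f n) (g n)

  *-congˡ : ∀ x {f g} → f ≈ₛ g → (λ n → seq x n ℚ.* f n) ≈ₛ (λ n → seq x n ℚ.* g n)
  *-congˡ x {f} {g} (equal p) = equal λ {ε} 0<ε →
    let B , 0<B , M , bd = bounded (seq x) (cauchy x)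
        N , F = p (0<* (0<* 0<½ 0<ε) (0<recip 0<B))
    in M ℕ.⊔ N , λ n r → ℚ.≤-<-trans
      (subst (ℚ._≤ B ℚ.* ℚ.∣ f n ℚ.- g n ∣)
        (trans (sym (ℚ.∣p*q∣≡∣p∣*∣q∣ (seq x n) (f n ℚ.- g n)))
          (cong ℚ.∣_∣ (solve 3 (λ x y z → x :* (y :- z) := x :* y :- x :* z) refl (seq x n) (f n) (g n))))
        (*-mono-≤ (ℚ.0≤∣p∣ (seq x n)) (bd n (⊔≤ˡ r)) (ℚ.0≤∣p∣ (f n ℚ.- g n)) ℚ.≤-refl))
      (ℚ.<-trans (*-small B ε 0<B (F n (⊔≤ʳ r))) (half< 0<ε))

  *-congʳ : ∀ x {f g} → f ≈ₛ g → (λ n → f n ℚ.* seq x n) ≈ₛ (λ n → g n ℚ.* seq x n)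
  *-congʳ x {f} {g} p = ≈-trans (*-comm f (seq x)) (≈-trans (*-congˡ x p) (*-comm (seq x) g))

  ∣∣-cong : ∀ {f g} → f ≈ₛ g → (λ n → ℚ.∣ f n ∣) ≈ₛ (λ n → ℚ.∣ g n ∣)
  ∣∣-cong {f} {g} (equal p) = equal λ 0<ε → let N , F = p 0<ε in N , λ n q →
    ℚ.≤-<-trans (∣∣-Lipschitz (f n) (g n)) (F n q)

  ∣∣-* : ∀ x y → ∣ x * y ∣ ≈ ∣ x ∣ * ∣ y ∣
  ∣∣-* x y = pointwise λ n → ℚ.∣p*q∣≡∣p∣*∣q∣ (seq x n) (seq y n)

  -- Nonnegativity of every approximant, which depends on the representation and is stronger than x
  -- ≥ 0; it lets absolute values and products be treated termwise.
  NonNeg : ℝ → Set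
  NonNeg x = ∀ n → 0ℚ ℚ.≤ seq x n

  ∣∣-nonNeg : ∀ x → NonNeg ∣ x ∣
  ∣∣-nonNeg x n = ℚ.0≤∣p∣ (seq x n)

  √-nonNeg : ∀ x → NonNeg (√ x)
  √-nonNeg x n = root-nonNeg (seq x n) n

  ∣∣-id : ∀ x → NonNeg x → ∣ x ∣ ≈ x
  ∣∣-id x 0≤x = pointwise λ n → ℚ.0≤p⇒∣p∣≡p (0≤x n)

  +-mono : ∀ {f f′ g g′} → f ≲ₛ f′ → g ≲ₛ g′ → (λ n → f n ℚ.+ g n) ≲ₛ (λ n → f′ n ℚ.+ g′ n)
  +-mono {f} {f′} {g} {g′} (below p) (below q) = below λ {ε} 0<ε →
    let M , F = p (0<* 0<½ 0<ε)
        N , G = q (0<* 0<½ 0<ε)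
    in M ℕ.⊔ N , λ n r → subst (f n ℚ.+ g n ℚ.≤_)
      (trans (solve 3 (λ a b e → a :+ e :+ (b :+ e) := a :+ b :+ (e :+ e)) refl (f′ n) (g′ n) (½ ℚ.* ε))
             (cong (f′ n ℚ.+ g′ n ℚ.+_) (half+half ε)))
      (ℚ.+-mono-≤ (F n (⊔≤ˡ r)) (G n (⊔≤ʳ r)))

  *-monoʳ : ∀ z {f g} → NonNeg z → f ≲ₛ g → (λ n → f n ℚ.* seq z n) ≲ₛ (λ n → g n ℚ.* seq z n)
  *-monoʳ z {f} {g} 0≤z (below p) = below λ {ε} 0<ε →
    let B , 0<B , M , bd = bounded (seq z) (cauchy z)
        N , F = p (0<* 0<ε (0<recip 0<B))
    in M ℕ.⊔ N , λ n r → ℚ.≤-trans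
      (ℚ.*-monoʳ-≤-nonNeg (seq z n) {{ℚ.nonNegative (0≤z n)}} (F n (⊔≤ʳ r)))
      (slack (ℚ.<⇒≤ (0<* 0<ε (0<recip 0<B)) ⊗ gap (ℚ.≤-trans (≤∣∣ (seq z n)) (bd n (⊔≤ˡ r))))
        (trans (cong (g n ℚ.* seq z n ℚ.+_) (trans (sym (ℚ.*-identityʳ ε))
            (cong (ε ℚ.*_) (sym (recip-inverse λ B≡0 → ℚ.<⇒≢ 0<B (sym B≡0))))))
          (solve 5 (λ y z e r B → y :* z :+ e :* (r :* B) := (y :+ e :* r) :* z :+ e :* r :* (B :- z)) refl
            (g n) (seq z n) ε (recip B) B)))

  *-monoˡ : ∀ z {f g} → NonNeg z → f ≲ₛ g → (λ n → seq z n ℚ.* f n) ≲ₛ (λ n → seq z n ℚ.* g n)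
  *-monoˡ z {f} {g} 0≤z p = ≲-trans (≈⇒≲ (*-comm (seq z) f)) (≲-trans (*-monoʳ z 0≤z p) (≈⇒≲ (*-comm g (seq z))))

  *-cancelʳ : ∀ {f g h} → IsPositive h → (λ n → f n ℚ.* h n) ≲ₛ (λ n → g n ℚ.* h n) → f ≲ₛ g
  *-cancelʳ {f} {g} {h} (δ , 0<δ , M , δ≤h) (below p) = below λ {ε} 0<ε →
    let N , F = p (0<* 0<ε 0<δ)
    in M ℕ.⊔ N , λ n r → *-cancel-≤ (ℚ.<-≤-trans 0<δ (δ≤h n (⊔≤ˡ r)))
      (ℚ.≤-trans (F n (⊔≤ʳ r)) (slack (ℚ.<⇒≤ 0<ε ⊗ gap (δ≤h n (⊔≤ˡ r)))
        (solve 4 (λ y z e d → (y :+ e) :* z := y :* z :+ e :* d :+ e :* (z :- d)) refl (g n) (h n) ε δ)))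

  *-cancel-≈ : ∀ {f g h} → IsPositive h → (λ n → f n ℚ.* h n) ≈ₛ (λ n → g n ℚ.* h n) → f ≈ₛ g
  *-cancel-≈ pos e = ≲-antisym (*-cancelʳ pos (≈⇒≲ e)) (*-cancelʳ pos (≈⇒≲ (≈-sym e)))

  /-* : ∀ x y (pos : Positive y) → x / y [ pos ] * y ≈ x
  /-* x y pos@(δ , 0<δ , M , δ≤y) = eventually M λ n p → trans
    (ℚ.*-assoc (seq x n) (recip (seq y n)) (seq y n))
    (trans (cong (seq x n ℚ.*_) (recip-inverse λ y≡0 → ℚ.<⇒≢ (ℚ.<-≤-trans 0<δ (δ≤y n p)) (sym y≡0)))
           (ℚ.*-identityʳ (seq x n)))

  +-positive : ∀ {f g : ℕ → ℚ} → IsPositive f → (∀ n → 0ℚ ℚ.≤ g n) → IsPositive (λ n → f n ℚ.+ g n)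
  +-positive (δ , 0<δ , M , δ≤f) 0≤g = δ , 0<δ , M , λ n p → ℚ.≤-trans (δ≤f n p) (slack (0≤g n) refl)

  -- The real number 0, represented by the precision of `root`. Adding it to a root turns the
  -- termwise bound `root-upper` into a bound between reals.
  meshℝ : ℝ
  meshℝ = mkℝ mesh λ 0<ε → let N , F = archimedean 0<ε in N , λ i j p q →
    ∣∣< (ℚ.<-trans (F i p) (less (0<mesh j))) (ℚ.<-trans (F j q) (less (0<mesh i)))
    where
    less : ∀ {a b} → 0ℚ ℚ.< a → b ℚ.< a ℚ.+ b
    less {a} {b} 0<a = subst (ℚ._< a ℚ.+ b) (ℚ.+-identityˡ b) (ℚ.+-monoˡ-< b 0<a)

  +meshℝ : ∀ x → x + meshℝ ≈ x
  +meshℝ x = equal λ {ε} 0<ε → let N , F = archimedean 0<ε in N , λ n p →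
    subst (ℚ._< ε) (sym (trans (cong ℚ.∣_∣ (solve 2 (λ x m → x :+ m :- x := m) refl (seq x n) (mesh n)))
      (ℚ.0≤p⇒∣p∣≡p (ℚ.<⇒≤ (0<mesh n))))) (F n p)

  √-square : ∀ x → NonNeg x → √ x * √ x ≈ x
  √-square x 0≤x = ≲-antisym
    (pointwise-≲ λ n → subst (root (seq x n) n ℚ.* root (seq x n) n ℚ.≤_) (ℚ.p≥q⇒p⊔q≡p (0≤x n))
        (root-lower (seq x n) n))
    (≲-trans (pointwise-≲ {seq x} {seq ((√ x + meshℝ) * (√ x + meshℝ))} λ n → ℚ.≤-trans (ℚ.p≤p⊔q (seq x n) 0ℚ)
        (ℚ.<⇒≤ (root-upper (seq x n) n)))
      (≈⇒≲ (≈-trans (*-congʳ (√ x + meshℝ) (+meshℝ (√ x))) (*-congˡ (√ x) (+meshℝ (√ x))))))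

  -- From y² = x follows y(√x + y) = √x(√x + y), and positivity of x keeps the common factor away
  -- from 0.
  √-unique : ∀ x y → NonNeg x → Positive x → NonNeg y → y * y ≈ x → y ≈ √ x
  √-unique x y 0≤x pos 0≤y e = *-cancel-≈ (+-positive (√-positive x pos) 0≤y) (begin-equality
    y * (√ x + y)         ≈⟨ pointwise (λ n → solve 2 (λ s y → y :* (s :+ y) := s :* y :+ y :* y) refl
        (seq (√ x) n) (seq y n)) ⟩
    √ x * y + y * y       ≈⟨ +-cong (same (√ x * y)) (≈-trans e (≈-sym (√-square x 0≤x))) ⟩
    √ x * y + √ x * √ x   ≈⟨ pointwise (λ n → solve 2 (λ s y → s :* y :+ s :* s := s :* (s :+ y)) refl
        (seq (√ x) n) (seq y n)) ⟩
    √ x * (√ x + y)       ∎)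
    where open ≲-Reasoning

  ∣∣≲√ : ∀ x y → (∀ n → seq x n ℚ.* seq x n ℚ.≤ seq y n) → ∣ x ∣ ≲ √ y
  ∣∣≲√ x y p = ≲-trans (pointwise-≲ {seq ∣ x ∣} {seq (√ y + meshℝ)} λ n →
      square-cancel-≤ (root-nonNeg (seq y n) n ⊕ ℚ.<⇒≤ (0<mesh n))
        (ℚ.≤-trans (ℚ.≤-reflexive (abs-square (seq x n))) (ℚ.≤-trans (p n)
          (ℚ.≤-trans (ℚ.p≤p⊔q (seq y n) 0ℚ) (ℚ.<⇒≤ (root-upper (seq y n) n))))))
    (≈⇒≲ (+meshℝ (√ y)))
    where
    abs-square : ∀ a → ℚ.∣ a ∣ ℚ.* ℚ.∣ a ∣ ≡ a ℚ.* a
    abs-square a with ℚ.∣p∣≡p∨∣p∣≡-p a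
    ... | inj₁ e = cong₂ ℚ._*_ e e
    ... | inj₂ e = trans (cong₂ ℚ._*_ e e) (solve 1 (λ a → :- a :* :- a := a :* a) refl a)

-- Differentiation of Ψ

module Derivative (m : ℕ) .{{_ : NonTrivial m}} where
  open Rational using (0<*; 0≤square)
  open Order
  open Reals
  open +-*-Solver using (solve; _:=_; _:+_; _:*_; _:-_; :-_; con)

  disc-nonNeg : ∀ v → NonNeg (discriminant m v)
  disc-nonNeg v n = 0≤square (1ℚ ℚ.- seq v n) ⊕ ℚ.<⇒≤ (0<1/ m)

  S : ℝ → ℝ
  S v = √ (discriminant m v)

  S-positive : ∀ v → Positive (S v)
  S-positive v = √-positive (discriminant m v) (discriminant-positive m v)

  S-square : ∀ v → S v * S v ≈ discriminant m v
  S-square v = √-square (discriminant m v) (disc-nonNeg v)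

  S-nonNeg : ∀ v → NonNeg (S v)
  S-nonNeg v = √-nonNeg (discriminant m v)

  ∣1-v∣≲S : ∀ v → ∣ 1ℝ - v ∣ ≲ S v
  ∣1-v∣≲S v = ∣∣≲√ (1ℝ - v) (discriminant m v) λ n → slack (ℚ.<⇒≤ (0<1/ m)) refl

  S-difference : ∀ x y → (S y - S x) * (S x + S y) ≈ (y - x) * ((x - 1ℝ) + (y - 1ℝ))
  S-difference x y = begin-equality
    (S y - S x) * (S x + S y)
      ≈⟨ pointwise (λ n → solve 2 (λ s t → (t :- s) :* (s :+ t) := t :* t :- s :* s) refl (seq (S x) n) (seq (S y) n)) ⟩
    S y * S y - S x * S x
      ≈⟨ minus-cong (S-square y) (S-square x) ⟩
    discriminant m y - discriminant m x
      ≈⟨ pointwise (λ n → solve 3 (λ x y c → (con 1ℚ :- y) :* (con 1ℚ :- y) :+ c :-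
          ((con 1ℚ :- x) :* (con 1ℚ :- x) :+ c)
           := (y :- x) :* ((x :- con 1ℚ) :+ (y :- con 1ℚ))) refl (seq x n) (seq y n) (1/ m)) ⟩
    (y - x) * ((x - 1ℝ) + (y - 1ℝ)) ∎
    where open ≲-Reasoning

  -- By `∣1-v∣≲S` the second factor on the right of `S-difference` is at most S x + S y in absolute
  -- value, so this sum cancels.
  S-Lipschitz : ∀ x y → ∣ S y - S x ∣ ≲ ∣ y - x ∣
  S-Lipschitz x y = *-cancelʳ (+-positive (S-positive x) (S-nonNeg y)) (begin
    ∣ S y - S x ∣ * (S x + S y)
      ≈⟨ *-congˡ ∣ S y - S x ∣ (∣∣-id (S x + S y) sum-nonNeg) ⟨
    ∣ S y - S x ∣ * ∣ S x + S y ∣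
      ≈⟨ ∣∣-* (S y - S x) (S x + S y) ⟨
    ∣ (S y - S x) * (S x + S y) ∣
      ≈⟨ ∣∣-cong (S-difference x y) ⟩
    ∣ (y - x) * ((x - 1ℝ) + (y - 1ℝ)) ∣
      ≈⟨ ∣∣-* (y - x) ((x - 1ℝ) + (y - 1ℝ)) ⟩
    ∣ y - x ∣ * ∣ (x - 1ℝ) + (y - 1ℝ) ∣
      ≲⟨ *-monoˡ ∣ y - x ∣ (∣∣-nonNeg (y - x)) (pointwise-≲ λ n → subst
          (ℚ.∣ (seq x n ℚ.- 1ℚ) ℚ.+ (seq y n ℚ.- 1ℚ) ∣ ℚ.≤_)
           (cong₂ ℚ._+_ (Rational.∣-∣-swap (seq x n) 1ℚ) (Rational.∣-∣-swap (seq y n) 1ℚ))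
           (ℚ.∣p+q∣≤∣p∣+∣q∣ (seq x n ℚ.- 1ℚ) (seq y n ℚ.- 1ℚ))) ⟩
    ∣ y - x ∣ * (∣ 1ℝ - x ∣ + ∣ 1ℝ - y ∣)
      ≲⟨ *-monoˡ ∣ y - x ∣ (∣∣-nonNeg (y - x)) (+-mono (∣1-v∣≲S x) (∣1-v∣≲S y)) ⟩
    ∣ y - x ∣ * (S x + S y) ∎)
    where
    open ≲-Reasoning
    sum-nonNeg : NonNeg (S x + S y)
    sum-nonNeg n = S-nonNeg x n ⊕ S-nonNeg y n

  slope : ℝ → ℝ
  slope v = (1ℝ - v) / S v [ S-positive v ]

  2ℝ : ℝ
  2ℝ = 1ℝ + 1ℝ

  remainder : ℝ → ℝ → ℝ
  remainder x y = Ψ m y - Ψ m x - explicitFactor m x * (y - x)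

  -- Multiplying by S x + S y rationalises the difference of the roots, and 2 S x clears ½ and the
  -- denominator of `slope`. What remains is of second order, as S y - S x is of first order.
  remainder-identity : ∀ x y → remainder x y * (S x + S y) * (2ℝ * S x) ≈
                       - ((y - x) * ((y - x) * S x + (1ℝ - x) * (S y - S x)))
  remainder-identity x y = begin-equality
    remainder x y * (S x + S y) * (2ℝ * S x)
      ≈⟨ pointwise (λ n → solve 5 (λ x y s t d →
           (con ½ :* (con 1ℚ :+ y :- t) :- con ½ :* (con 1ℚ :+ x :- s) :- con ½ :* (con 1ℚ :+ d) :* (y :- x)) :*
               (s :+ t) :* ((con 1ℚ :+ con 1ℚ) :* s)
           := :- ((t :- s) :* (s :+ t) :* s :+ d :* s :* (y :- x) :* (s :+ t)))
           refl (seq x n) (seq y n) (seq (S x) n) (seq (S y) n) (seq (slope x) n)) ⟩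
    - ((S y - S x) * (S x + S y) * S x + slope x * S x * (y - x) * (S x + S y))
      ≈⟨ neg-cong (+-cong (*-congʳ (S x) (S-difference x y))
          (*-congʳ (S x + S y) (*-congʳ (y - x) (/-* (1ℝ - x) (S x) (S-positive x))))) ⟩
    - ((y - x) * ((x - 1ℝ) + (y - 1ℝ)) * S x + (1ℝ - x) * (y - x) * (S x + S y))
      ≈⟨ pointwise (λ n → solve 4 (λ x y s t →
           :- ((y :- x) :* ((x :- con 1ℚ) :+ (y :- con 1ℚ)) :* s :+ (con 1ℚ :- x) :* (y :- x) :* (s :+ t))
           := :- ((y :- x) :* ((y :- x) :* s :+ (con 1ℚ :- x) :* (t :- s)))) refl (seq x n) (seq y n) (seq (S x) n)
               (seq (S y) n)) ⟩
    - ((y - x) * ((y - x) * S x + (1ℝ - x) * (S y - S x))) ∎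
    where open ≲-Reasoning

  -- Both terms of the bracket in `remainder-identity` are at most |y - x| S x, the second by
  -- `∣1-v∣≲S` and `S-Lipschitz`; then 2 S x cancels.
  remainder-bound : ∀ x y → ∣ remainder x y ∣ * (S x + S y) ≲ ∣ y - x ∣ * ∣ y - x ∣
  remainder-bound x y = *-cancelʳ 2S-positive (begin
    ∣ remainder x y ∣ * (S x + S y) * (2ℝ * S x)
      ≈⟨ ≈-trans (*-congʳ ∣ 2ℝ * S x ∣ (*-congˡ ∣ remainder x y ∣ (∣∣-id (S x + S y) sum-nonNeg)))
          (*-congˡ (∣ remainder x y ∣ * (S x + S y)) (∣∣-id (2ℝ * S x) 2S-nonNeg)) ⟨
    ∣ remainder x y ∣ * ∣ S x + S y ∣ * ∣ 2ℝ * S x ∣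
      ≈⟨ *-congʳ ∣ 2ℝ * S x ∣ (∣∣-* (remainder x y) (S x + S y)) ⟨
    ∣ remainder x y * (S x + S y) ∣ * ∣ 2ℝ * S x ∣
      ≈⟨ ∣∣-* (remainder x y * (S x + S y)) (2ℝ * S x) ⟨
    ∣ remainder x y * (S x + S y) * (2ℝ * S x) ∣
      ≈⟨ ∣∣-cong (remainder-identity x y) ⟩
    ∣ - (t * (t * S x + (1ℝ - x) * (S y - S x))) ∣
      ≈⟨ pointwise (λ n → ℚ.∣-p∣≡∣p∣ (seq (t * (t * S x + (1ℝ - x) * (S y - S x))) n)) ⟩
    ∣ t * (t * S x + (1ℝ - x) * (S y - S x)) ∣
      ≈⟨ ∣∣-* t (t * S x + (1ℝ - x) * (S y - S x)) ⟩
    ∣ t ∣ * ∣ t * S x + (1ℝ - x) * (S y - S x) ∣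
      ≲⟨ *-monoˡ ∣ t ∣ (∣∣-nonNeg t) (pointwise-≲
           λ n → ℚ.∣p+q∣≤∣p∣+∣q∣ (seq (t * S x) n) (seq ((1ℝ - x) * (S y - S x)) n)) ⟩
    ∣ t ∣ * (∣ t * S x ∣ + ∣ (1ℝ - x) * (S y - S x) ∣)
      ≈⟨ *-congˡ ∣ t ∣ (+-cong (≈-trans (∣∣-* t (S x)) (*-congˡ ∣ t ∣ (∣∣-id (S x) (S-nonNeg x))))
          (∣∣-* (1ℝ - x) (S y - S x))) ⟩
    ∣ t ∣ * (∣ t ∣ * S x + ∣ 1ℝ - x ∣ * ∣ S y - S x ∣)
      ≲⟨ *-monoˡ ∣ t ∣ (∣∣-nonNeg t) (+-mono (≈⇒≲ (same (∣ t ∣ * S x))) (≲-trans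
           (*-monoʳ ∣ S y - S x ∣ (∣∣-nonNeg (S y - S x)) (∣1-v∣≲S x))
               (*-monoˡ (S x) (S-nonNeg x) (S-Lipschitz x y)))) ⟩
    ∣ t ∣ * (∣ t ∣ * S x + S x * ∣ t ∣)
      ≈⟨ pointwise (λ n → solve 2 (λ t s → t :* (t :* s :+ s :* t) := t :* t :* ((con 1ℚ :+ con 1ℚ) :* s)) refl
          (seq ∣ t ∣ n) (seq (S x) n)) ⟩
    ∣ t ∣ * ∣ t ∣ * (2ℝ * S x) ∎)
    where
    open ≲-Reasoning
    t = y - x
    sum-nonNeg : NonNeg (S x + S y)
    sum-nonNeg n = S-nonNeg x n ⊕ S-nonNeg y n
    2S-nonNeg : NonNeg (2ℝ * S x)
    2S-nonNeg n = (0≤1 ⊕ 0≤1) ⊗ S-nonNeg x n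
    2S-positive : Positive (2ℝ * S x)
    2S-positive = let δ , 0<δ , N , F = S-positive x in δ , 0<δ , N , λ n p → ℚ.≤-trans (F n p)
      (slack (S-nonNeg x n) (solve 1 (λ s → (con 1ℚ :+ con 1ℚ) :* s := s :+ s) refl (seq (S x) n)))

  Ψ-derivative : ∀ x → HasDerivativeAt (Ψ m) x (explicitFactor m x)
  Ψ-derivative x {ε} 0<ε =
    let δ , 0<δ , N , δ≤S = S-positive x
    -- δ is a lower bound for S x, so |y - x| ≤ εδ implies |y - x| ≤ ε(S x + S y), and the factor S
    -- x + S y of `remainder-bound` cancels.
    in ε ℚ.* δ , 0<* 0<ε 0<δ , λ y close → _≲ₛ_.unwrap (bound y δ N δ≤S (below close))
    where
    open ≲-Reasoning
    bound : ∀ y δ N → (∀ n → N ℕ.≤ n → δ ℚ.≤ seq (S x) n) → ∣ y - x ∣ ≲ fromℚ (ε ℚ.* δ) →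
            ∣ remainder x y ∣ ≲ fromℚ ε * ∣ y - x ∣
    bound y δ N δ≤S close = *-cancelʳ {seq ∣ remainder x y ∣} {seq (fromℚ ε * ∣ y - x ∣)}
        (+-positive (S-positive x) (S-nonNeg y)) (begin
      ∣ remainder x y ∣ * (S x + S y)
        ≲⟨ remainder-bound x y ⟩
      ∣ y - x ∣ * ∣ y - x ∣
        ≲⟨ *-monoʳ ∣ y - x ∣ (∣∣-nonNeg (y - x)) close ⟩
      fromℚ (ε ℚ.* δ) * ∣ y - x ∣
        ≲⟨ *-monoʳ ∣ y - x ∣ (∣∣-nonNeg (y - x)) δ≲ ⟩
      fromℚ ε * (S x + S y) * ∣ y - x ∣
        ≈⟨ pointwise (λ n → solve 3 (λ e s t → e :* s :* t := e :* t :* s) refl ε (seq (S x + S y) n)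
            (seq ∣ y - x ∣ n)) ⟩
      fromℚ ε * ∣ y - x ∣ * (S x + S y) ∎)
      where
      δ≲ : fromℚ (ε ℚ.* δ) ≲ fromℚ ε * (S x + S y)
      δ≲ = below λ 0<η → N , λ n p → ℚ.≤-trans
        (ℚ.*-monoˡ-≤-nonNeg ε {{ℚ.nonNegative (ℚ.<⇒≤ 0<ε)}} (ℚ.≤-trans (δ≤S n p) (slack (S-nonNeg y n) refl)))
        (slack (ℚ.<⇒≤ 0<η) refl)

-- The values F_k(1)

module Asymptotics (m : ℕ) .{{_ : NonTrivial m}} where
  open Rational hiding (∣∣-∣∣≤)
  open Order
  open Sums
  open Levels m
  open Reals
  open Derivative m
  open +-*-Solver using (solve; _:=_; _:+_; _:*_; _:-_; :-_; con)

  a : ℕ → ℚ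
  a = upper 0

  0≤a : ∀ n → 0ℚ ℚ.≤ a n
  0≤a = upper-nonNeg 0

  open Catalan a refl upper₀-1 upper₀-⊛ 0≤a
  open Transfer a refl upper₀-1 upper₀-⊛ 0≤a using (Near; transfer)

  upper≤a : ∀ k n → upper k n ℚ.≤ a n
  upper≤a zero    n = ℚ.≤-refl
  upper≤a (suc k) n = ℚ.≤-trans (upper-antitone k n) (upper≤a k n)

  exact-nonNeg : ∀ k n → 0ℚ ℚ.≤ exact k n
  exact-nonNeg k n = gap (upper-antitone k n)

  exact≤a : ∀ k n → exact k n ℚ.≤ a n
  exact≤a k n = ℚ.≤-trans (slack (upper-nonNeg (suc k) n)
      (solve 2 (λ h f → h := h :- f :+ f) refl (upper k n) (upper (suc k) n))) (upper≤a k n)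

  a-remaining : ∀ i j → ∑ j a ℚ.- ∑ i a ℚ.≤ tail i
  a-remaining i j = slack (0≤tail j) (trans
    (solve 2 (λ s t → s := con ½ :- t :- (con ½ :- s) :+ t) refl (tail i) (tail j))
    (cong (ℚ._+ tail j) (cong₂ ℚ._-_ (sym (∑a j)) (sym (∑a i)))))

  ∑-cauchy : ∀ {x} → (∀ n → 0ℚ ℚ.≤ x n) → (∀ n → x n ℚ.≤ a n) → IsCauchy (λ n → ∑ n x)
  ∑-cauchy {x} 0≤x x≤a {ε} 0<ε =
    let N , F = tail-null (0<* 0<½ 0<ε)
    in N , λ i j p q → ℚ.≤-<-trans (bound F i j p q) (half< 0<ε)
    where
    ordered : ∀ {N} → (∀ n → N ℕ.≤ n → tail n ℚ.≤ ½ ℚ.* ε) → ∀ i j → N ℕ.≤ i → i ℕ.≤ j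
        → ℚ.∣ ∑ j x ℚ.- ∑ i x ∣ ℚ.≤ ½ ℚ.* ε
    ordered F i j p i≤j = let l , u = ∑-diff 0≤x x≤a i≤j in
      ∣∣-bound l (ℚ.≤-trans u (ℚ.≤-trans (a-remaining i j) (F i p)))
    bound : ∀ {N} → (∀ n → N ℕ.≤ n → tail n ℚ.≤ ½ ℚ.* ε) → ∀ i j → N ℕ.≤ i → N ℕ.≤ j → ℚ.∣ ∑ i x ℚ.- ∑ j x ∣ ℚ.≤ ½ ℚ.* ε
    bound F i j p q with ℕ.≤-total i j
    ... | inj₁ i≤j = subst (ℚ._≤ ½ ℚ.* ε) (∣-∣-swap (∑ j x) (∑ i x)) (ordered F i j p i≤j)
    ... | inj₂ j≤i = ordered F j i q j≤i

  -- F_k(1), with the partial sums themselves as approximants: the K-th one is literally the sum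
  -- that `transfer` uses.
  P : ℕ → ℝ
  P k = mkℝ (λ n → ∑ n (upper k)) (∑-cauchy (upper-nonNeg k) (upper≤a k))

  ∑a≤½ : ∀ n → ∑ n a ℚ.≤ ½
  ∑a≤½ n = slack (0≤tail n) (trans (solve 1 (λ t → con ½ := con ½ :- t :+ t) refl (tail n))
      (cong (ℚ._+ tail n) (sym (∑a n))))

  P≤½ : ∀ k n → seq (P k) n ℚ.≤ ½
  P≤½ k n = ℚ.≤-trans (∑-mono n (λ i _ → upper≤a k i)) (∑a≤½ n)

  P-nonNeg : ∀ k → NonNeg (P k)
  P-nonNeg k n = ∑-nonNeg n (upper-nonNeg k)

  P-antitone : ∀ k n → seq (P (suc k)) n ℚ.≤ seq (P k) n
  P-antitone k n = ∑-mono n (λ i _ → upper-antitone k i)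

  P₀ : P 0 ≈ ½ℝ
  P₀ = equal λ {ε} 0<ε →
    let N , F = tail-null (0<* 0<½ 0<ε)
    in N , λ n p → ℚ.≤-<-trans
      (subst (λ z → ℚ.∣ z ∣ ℚ.≤ ½ ℚ.* ε)
        (sym (trans (cong (ℚ._- ½) (∑a n)) (solve 1 (λ t → con ½ :- t :- con ½ := :- t) refl (tail n))))
        (∣∣-neg {tail n} (∣∣-bound (0≤tail n) (F n p))))
      (half< 0<ε)

  -- The error in multiplying series by their partial sums; that it tends to 0 is the Cauchy product
  -- theorem needed at z = 1.
  defect : (ℕ → ℚ) → (ℕ → ℚ) → ℕ → ℚ
  defect x y n = ∑ n x ℚ.* ∑ n y ℚ.- ∑ n (x ⊛ y)

  defect-∑ : ∀ x y n → defect x y n ≡ ∑ n (λ i → x i ℚ.* (∑ n y ℚ.- ∑ (n ℕ.∸ i) y))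
  defect-∑ x y n = sym (begin
    ∑ n (λ i → x i ℚ.* (∑ n y ℚ.- ∑ (n ℕ.∸ i) y))
      ≡⟨ ∑-cong n (λ i _ → solve 3 (λ x s t → x :* (s :- t) := s :* x :- x :* t) refl (x i) (∑ n y) (∑ (n ℕ.∸ i) y)) ⟩
    ∑ n (λ i → ∑ n y ℚ.* x i ℚ.- x i ℚ.* ∑ (n ℕ.∸ i) y)
      ≡⟨ ∑-- n (λ i → ∑ n y ℚ.* x i) (λ i → x i ℚ.* ∑ (n ℕ.∸ i) y) ⟩
    ∑ n (λ i → ∑ n y ℚ.* x i) ℚ.- (x ⊛ λ k → ∑ k y) n
      ≡⟨ cong₂ ℚ._-_ (trans (∑-* n (∑ n y) x) (ℚ.*-comm (∑ n y) (∑ n x))) (sym (∑-⊛ x y n)) ⟩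
    defect x y n ∎)
    where open ≡-Reasoning

  -- In the form `defect-∑` the defect consists of terms times blocks, all nonnegative, and so is
  -- monotone in both sequences. The explicit defect of `a` controls every other.
  defect-bounds : ∀ {x y} → (∀ n → 0ℚ ℚ.≤ x n) → (∀ n → x n ℚ.≤ a n) → (∀ n → 0ℚ ℚ.≤ y n) → (∀ n → y n ℚ.≤ a n) →
                  ∀ n → 0ℚ ℚ.≤ defect x y n × defect x y n ℚ.≤ defect a a n
  defect-bounds {x} {y} 0≤x x≤a 0≤y y≤a n =
    subst (0ℚ ℚ.≤_) (sym (defect-∑ x y n)) (∑-nonNeg n λ i → 0≤x i ⊗ proj₁ (diff i)) ,
    subst₂ ℚ._≤_ (sym (defect-∑ x y n)) (sym (defect-∑ a a n))
      (∑-mono n λ i _ → *-mono-≤ (0≤x i) (x≤a i) (proj₁ (diff i)) (proj₂ (diff i)))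
    where
    diff : ∀ i → 0ℚ ℚ.≤ ∑ n y ℚ.- ∑ (n ℕ.∸ i) y × ∑ n y ℚ.- ∑ (n ℕ.∸ i) y ℚ.≤ ∑ n a ℚ.- ∑ (n ℕ.∸ i) a
    diff i = ∑-diff 0≤y y≤a (ℕ.m∸n≤m n i)

  ∑-fixed : ∀ {x y c} → x 0 ≡ 0ℚ → x 1 ≡ c → (x ⊛ y) 0 ≡ 0ℚ → (x ⊛ y) 1 ≡ 0ℚ →
            (∀ n → x (suc (suc n)) ≡ (x ⊛ y) (suc (suc n))) →
            ∀ n → ∑ (suc n) x ≡ c ℚ.+ ∑ (suc n) (x ⊛ y)
  ∑-fixed {x} {y} {c} e₀ e₁ f₀ f₁ e zero = trans (cong₂ ℚ._+_ e₀ e₁) (trans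
    (solve 1 (λ c → con 0ℚ :+ c := c :+ (con 0ℚ :+ con 0ℚ)) refl c) (cong (c ℚ.+_) (sym (cong₂ ℚ._+_ f₀ f₁))))
  ∑-fixed {x} {y} {c} e₀ e₁ f₀ f₁ e (suc n) = trans (cong₂ ℚ._+_ (∑-fixed {x} {y} e₀ e₁ f₀ f₁ e n) (e n))
    (ℚ.+-assoc c (∑ (suc n) (x ⊛ y)) ((x ⊛ y) (suc (suc n))))

  -- Summing the quadratic relation gives A - ¼ for the partial sum of a ⊛ a, so the defect is (½ -
  -- A)², where ½ - A is the tail.
  defect-a : ∀ n → defect a a (suc n) ≡ tail (suc n) ℚ.* tail (suc n)
  defect-a n = begin
    A ℚ.* A ℚ.- ∑ (suc n) (a ⊛ a)
      ≡⟨ solve 2 (λ A c → A :* A :- c := A :* A :- (con (½ ℚ.* ½) :+ c) :+ con (½ ℚ.* ½)) refl A (∑ (suc n) (a ⊛ a)) ⟩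
    A ℚ.* A ℚ.- (½ ℚ.* ½ ℚ.+ ∑ (suc n) (a ⊛ a)) ℚ.+ ½ ℚ.* ½
      ≡⟨ cong (λ z → A ℚ.* A ℚ.- z ℚ.+ ½ ℚ.* ½) (∑-fixed {a} {a} refl upper₀-1 refl a⊛a₁ upper₀-⊛ n) ⟨
    A ℚ.* A ℚ.- A ℚ.+ ½ ℚ.* ½
      ≡⟨ cong (λ A → A ℚ.* A ℚ.- A ℚ.+ ½ ℚ.* ½) (∑a (suc n)) ⟩
    (½ ℚ.- tail (suc n)) ℚ.* (½ ℚ.- tail (suc n)) ℚ.- (½ ℚ.- tail (suc n)) ℚ.+ ½ ℚ.* ½
      ≡⟨ solve 1 (λ t → (con ½ :- t) :* (con ½ :- t) :- (con ½ :- t) :+ con (½ ℚ.* ½) := t :* t) refl (tail (suc n)) ⟩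
    tail (suc n) ℚ.* tail (suc n) ∎
    where
    open ≡-Reasoning
    A = ∑ (suc n) a

  tail≤1 : ∀ n → tail n ℚ.≤ 1ℚ
  tail≤1 n = slack (∑-nonNeg n 0≤a ⊕ 0≤½) (trans
    (solve 1 (λ t → con 1ℚ := t :+ (con ½ :- t :+ con ½)) refl (tail n))
    (cong (λ z → tail n ℚ.+ (z ℚ.+ ½)) (sym (∑a n))))

  D : ℕ → ℝ
  D k = P k - P (suc k)

  -- At each partial sum the two sides differ exactly by a defect, which is at most tail² ≤ tail.
  D-fixed : ∀ {k} → suc k < m → D k ≈ fromℚ r + D k * P (suc k)
  D-fixed {k} k<top = equal λ {ε} 0<ε →
    let N , F = tail-null (0<* 0<½ 0<ε)
    in suc N , λ { (suc n) (s≤s p) → ℚ.≤-<-trans (bound n (½ ℚ.* ε) (F (suc n) (ℕ.m≤n⇒m≤1+n p)))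
      (half< 0<ε) }
    where
    x = exact k
    y = upper (suc k)
    x⊛y₁ : (x ⊛ y) 1 ≡ 0ℚ
    x⊛y₁ = trans (cong₂ ℚ._+_ (ℚ.*-zeroˡ (y 1)) (ℚ.*-zeroʳ (x 1))) refl
    bound : ∀ n h → tail (suc n) ℚ.≤ h → ℚ.∣ seq (D k) (suc n) ℚ.- (r ℚ.+ seq (D k) (suc n) ℚ.* ∑ (suc n) y) ∣ ℚ.≤ h
    bound n h small = subst (λ z → ℚ.∣ z ∣ ℚ.≤ h) (sym equation) (∣∣-neg {defect x y N}
      (∣∣-bound (proj₁ db) (ℚ.≤-trans (proj₂ db) (ℚ.≤-trans (ℚ.≤-reflexive (defect-a n))
        (ℚ.≤-trans (*-mono-≤ (0≤tail N) ℚ.≤-refl (0≤tail N) (tail≤1 N))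
            (ℚ.≤-trans (ℚ.≤-reflexive (ℚ.*-identityʳ (tail N))) small))))))
      where
      N = suc n
      db = defect-bounds {x} {y} (exact-nonNeg k) (exact≤a k) (upper-nonNeg (suc k)) (upper≤a (suc k)) N
      equation : seq (D k) N ℚ.- (r ℚ.+ seq (D k) N ℚ.* ∑ N y) ≡ ℚ.- defect x y N
      equation = begin
        seq (D k) N ℚ.- (r ℚ.+ seq (D k) N ℚ.* ∑ N y)
          ≡⟨ cong (λ d → d ℚ.- (r ℚ.+ d ℚ.* ∑ N y)) (∑-- N (upper k) (upper (suc k))) ⟨
        ∑ N x ℚ.- (r ℚ.+ ∑ N x ℚ.* ∑ N y)
          ≡⟨ cong (λ z → z ℚ.- (r ℚ.+ ∑ N x ℚ.* ∑ N y))
              (∑-fixed {x} {y} refl (exact-1 (ℕ.<-trans (ℕ.n<1+n k) k<top)) refl x⊛y₁ (exact-⊛ k<top) n) ⟩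
        r ℚ.+ ∑ N (x ⊛ y) ℚ.- (r ℚ.+ ∑ N x ℚ.* ∑ N y)
          ≡⟨ solve 3 (λ r c p → r :+ c :- (r :+ p) := :- (p :- c)) refl r (∑ N (x ⊛ y)) (∑ N x ℚ.* ∑ N y) ⟩
        ℚ.- defect x y N ∎
        where open ≡-Reasoning

  -- The expression that becomes the square root when the quadratic relation is solved for
  -- F_{k+1}(1). It is nonnegative because all values are at most ½, and this selects the minus sign
  -- in Ψ.
  Y : ℕ → ℝ
  Y k = 1ℝ + P k - (P (suc k) + P (suc k))

  Y-nonNeg : ∀ k → NonNeg (Y k)
  Y-nonNeg k n = subst (0ℚ ℚ.≤_)
    (solve 2 (λ v f → con ½ :- f :+ (con ½ :- f) :+ v := con 1ℚ :+ v :- (f :+ f)) refl (seq (P k) n)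
        (seq (P (suc k)) n))
    (gap (P≤½ (suc k) n) ⊕ gap (P≤½ (suc k) n) ⊕ P-nonNeg k n)

  -- Expanding gives (1 - P k)² + 4(D k - D k · P (k+1)), and `D-fixed` evaluates the bracket as r =
  -- 1/(4m).
  Y-square : ∀ {k} → suc k < m → Y k * Y k ≈ discriminant m (P k)
  Y-square {k} k<top = begin-equality
    Y k * Y k
      ≈⟨ pointwise (λ n → solve 2 (λ v f → (con 1ℚ :+ v :- (f :+ f)) :* (con 1ℚ :+ v :- (f :+ f))
           := (con 1ℚ :- v) :* (con 1ℚ :- v) :+ con 4ℚ :* ((v :- f) :- (v :- f) :* f)) refl (seq (P k) n)
               (seq (P (suc k)) n)) ⟩
    (1ℝ - P k) * (1ℝ - P k) + fromℚ 4ℚ * (D k - D k * P (suc k))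
      ≈⟨ +-cong (same ((1ℝ - P k) * (1ℝ - P k))) (*-congˡ (fromℚ 4ℚ)
          (+-cong (D-fixed k<top) (same (- (D k * P (suc k)))))) ⟩
    (1ℝ - P k) * (1ℝ - P k) + fromℚ 4ℚ * (fromℚ r + D k * P (suc k) - D k * P (suc k))
      ≈⟨ pointwise (λ n → solve 3 (λ u c z → u :+ con 4ℚ :* (con (½ ℚ.* ½) :* c :+ z :- z) := u :+ c) refl
           (seq ((1ℝ - P k) * (1ℝ - P k)) n) (1/ m) (seq (D k * P (suc k)) n)) ⟩
    discriminant m (P k) ∎
    where
    open ≲-Reasoning
    4ℚ : ℚ
    4ℚ = 1ℚ ℚ.+ 1ℚ ℚ.+ (1ℚ ℚ.+ 1ℚ)

  discriminant-cong : ∀ u v → u ≈ v → discriminant m u ≈ discriminant m v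
  discriminant-cong u v p = +-cong (≈-trans (*-congʳ (1ℝ - u) 1-p) (*-congˡ (1ℝ - v) 1-p)) (same (fromℚ (1/ m)))
    where
    1-p : 1ℝ - u ≈ 1ℝ - v
    1-p = minus-cong (same 1ℝ) p

  Y≈S : ∀ {k} → suc k < m → ∀ v → P k ≈ v → Y k ≈ S v
  Y≈S {k} k<top v p = √-unique (discriminant m v) (Y k) (disc-nonNeg v) (discriminant-positive m v) (Y-nonNeg k)
    (≈-trans (Y-square k<top) (discriminant-cong (P k) v p))

  P≈w : ∀ {k} → k < m → P k ≈ w m k
  P≈w {zero}  _     = P₀
  P≈w {suc k} k<top = begin-equality
    P (suc k)
      ≈⟨ pointwise (λ n → solve 2 (λ v f → f := con ½ :* (con 1ℚ :+ v :- (con 1ℚ :+ v :- (f :+ f)))) refl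
          (seq (P k) n) (seq (P (suc k)) n)) ⟩
    ½ℝ * (1ℝ + P k - Y k)
      ≈⟨ *-congˡ ½ℝ (minus-cong (+-cong (same 1ℝ) ih) (Y≈S k<top (w m k) ih)) ⟩
    w m (suc k) ∎
    where
    open ≲-Reasoning
    ih = P≈w (ℕ.<-trans (ℕ.n<1+n k) k<top)

  -- The ratios between levels and the limit

  -- The same number as `Y k`, arranged as it occurs in `balance` and so that its lower bound ½ is
  -- visible.
  denominator : ℕ → ℝ
  denominator k = 1ℝ - P (suc k) + D k

  ½≤denominator : ∀ k n → ½ ℚ.≤ seq (denominator k) n
  ½≤denominator k n = slack (gap (P≤½ (suc k) n) ⊕ gap (P-antitone k n))
    (solve 2 (λ v f → con 1ℚ :- f :+ (v :- f) := con ½ :+ ((con ½ :- f) :+ (v :- f))) refl (seq (P k) n)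
        (seq (P (suc k)) n))

  denominator-positive : ∀ k → Positive (denominator k)
  denominator-positive k = ½ , 0<½ , 0 , λ n _ → ½≤denominator k n

  factor : ℕ → ℝ
  factor k = (1ℝ - P (suc k)) / denominator k [ denominator-positive k ]

  -- The numerator 1 - P (k+1) is ½(Y k + 1 - P k), and the denominator is Y k = S v; the quotient
  -- is ½(1 + (1 - v)/S v).
  factor≈ : ∀ {k} → suc k < m → factor k ≈ explicitFactor m (w m k)
  factor≈ {k} k<top = *-cancel-≈ (denominator-positive k) (begin-equality
    factor k * denominator k
      ≈⟨ /-* (1ℝ - P (suc k)) (denominator k) (denominator-positive k) ⟩
    1ℝ - P (suc k)
      ≈⟨ pointwise (λ n → solve 2 (λ v f → con 1ℚ :- f := con ½ :* (con 1ℚ :+ v :- (f :+ f) :+ (con 1ℚ :- v))) refl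
          (seq (P k) n) (seq (P (suc k)) n)) ⟩
    ½ℝ * (Y k + (1ℝ - P k))
      ≈⟨ *-congˡ ½ℝ (+-cong root≈ (minus-cong (same 1ℝ) P≈)) ⟩
    ½ℝ * (S v + (1ℝ - v))
      ≈⟨ *-congˡ ½ℝ (+-cong (same (S v)) (/-* (1ℝ - v) (S v) (S-positive v))) ⟨
    ½ℝ * (S v + slope v * S v)
      ≈⟨ pointwise (λ n → solve 2 (λ s d → con ½ :* (s :+ d :* s) := con ½ :* (con 1ℚ :+ d) :* s) refl
          (seq (S v) n) (seq (slope v) n)) ⟩
    explicitFactor m v * S v
      ≈⟨ *-congˡ (explicitFactor m v) root≈ ⟨
    explicitFactor m v * Y k
      ≈⟨ *-congˡ (explicitFactor m v) (pointwise {seq (Y k)} {seq (denominator k)}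
          (λ n → solve 2 (λ v f → con 1ℚ :+ v :- (f :+ f) := con 1ℚ :- f :+ (v :- f)) refl (seq (P k) n)
          (seq (P (suc k)) n))) ⟩
    explicitFactor m v * denominator k ∎)
    where
    open ≲-Reasoning
    v = w m k
    P≈ = P≈w (ℕ.<-trans (ℕ.n<1+n k) k<top)
    root≈ = Y≈S k<top v P≈

  ∏-cong : ∀ n {f g : ℕ → ℝ} → (∀ k → k < n → f k ≈ g k) → ∏ n f ≈ ∏ n g
  ∏-cong zero    e = same 1ℝ
  ∏-cong (suc n) {f} {g} e = ≈-trans (*-congʳ (f n) (∏-cong n {f} {g} (λ k p → e k (ℕ.m≤n⇒m≤1+n p))))
      (*-congˡ (∏ n g) (e n ℕ.≤-refl))

  Θ : ℕ → ℝ
  Θ k = ∏ k factor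

  -- Exact at every n, since each approximant of the denominator is at least ½; this makes
  -- `balanced` an identity and not an estimate.
  factor-* : ∀ k n → seq (factor k) n ℚ.* seq (denominator k) n ≡ 1ℚ ℚ.- seq (P (suc k)) n
  factor-* k n = trans (ℚ.*-assoc num (recip den) den)
    (trans (cong (num ℚ.*_) (recip-inverse λ e → ℚ.<⇒≢ (ℚ.<-≤-trans 0<½ (½≤denominator k n)) (sym e)))
        (ℚ.*-identityʳ num))
    where
    num = 1ℚ ℚ.- seq (P (suc k)) n
    den = seq (denominator k) n

  factor-bounds : ∀ k n → 0ℚ ℚ.≤ seq (factor k) n × seq (factor k) n ℚ.≤ 1ℚ
  factor-bounds k n = 0≤num ⊗ ℚ.<⇒≤ (0<recip 0<den) ,
    *-cancel-≤ 0<den (subst₂ ℚ._≤_ (sym (factor-* k n)) (sym (ℚ.*-identityˡ (seq (denominator k) n)))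
      (slack (gap (P-antitone k n)) refl))
    where
    0<den : 0ℚ ℚ.< seq (denominator k) n
    0<den = ℚ.<-≤-trans 0<½ (½≤denominator k n)
    0≤num : 0ℚ ℚ.≤ 1ℚ ℚ.- seq (P (suc k)) n
    0≤num = gap (ℚ.≤-trans (P≤½ (suc k) n) (slack 0≤½ refl))

  Θ-bounds : ∀ k n → 0ℚ ℚ.≤ seq (Θ k) n × seq (Θ k) n ℚ.≤ 1ℚ
  Θ-bounds zero    n = 0≤1 , ℚ.≤-refl
  Θ-bounds (suc k) n = let l , u = Θ-bounds k n; l′ , u′ = factor-bounds k n in
    l ⊗ l′ , *-mono-≤ l u l′ u′

  Near-weaken : ∀ {x t ε ε′} → ε ℚ.≤ ε′ → Near x t ε → Near x t ε′
  Near-weaken ε≤ε′ (N , F) = N , λ n p → ℚ.≤-trans (F n p)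
    (ℚ.*-monoʳ-≤-nonNeg (a n) {{ℚ.nonNegative (0≤a n)}} ε≤ε′)

  -- The ratio is a real number while `Near` takes a rational, so the claim is made for all late
  -- approximants. The same K must serve at level k and as the truncation in `transfer`, which is
  -- why every K from some K₀ on is covered.
  near-upper : ∀ k → k < m → ∀ {ε} → 0ℚ ℚ.< ε →
               ∃[ K₀ ] (∀ K → K₀ ℕ.≤ K → Near (upper k) (seq (Θ k) K) ε)
  near-upper zero    _     {ε} 0<ε = 0 , λ K _ → 0 , λ n _ → subst (λ z → ℚ.∣ z ∣ ℚ.≤ ε ℚ.* a n)
    (solve 1 (λ a → con 0ℚ := a :- con 1ℚ :* a) refl (a n)) (ℚ.<⇒≤ 0<ε ⊗ 0≤a n)
  near-upper (suc k) k<top {ε} 0<ε =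
    let K₁ , near-k = near-upper k (ℕ.<-trans (ℕ.n<1+n k) k<top) 0<η
        K₂ , small  = tail-null (0<* 0<½ 0<η)
    in K₁ ℕ.⊔ K₂ , λ K p → Near-weaken {upper (suc k)} {seq (Θ (suc k)) K} scaled
      (step K (near-k K (⊔≤ˡ p)) (small K (⊔≤ʳ p)))
    where
    e = ε ℚ.⊓ 1ℚ
    -- `mesh 22` is 1/23, which undoes the factor 3 + 20 of `transfer`; the minimum with 1 in e
    -- provides its hypothesis η ≤ 1.
    η = mesh 22 ℚ.* e
    0<e : 0ℚ ℚ.< e
    0<e with ℚ.⊓-sel ε 1ℚ
    ... | inj₁ q = subst (0ℚ ℚ.<_) (sym q) 0<ε
    ... | inj₂ q = subst (0ℚ ℚ.<_) (sym q) (ℚ.positive⁻¹ 1ℚ)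
    0<η : 0ℚ ℚ.< η
    0<η = 0<* (0<mesh 22) 0<e
    23ℚ : ℚ
    23ℚ = nat 23
    η≤1 : η ℚ.≤ 1ℚ
    η≤1 = *-mono-≤ (ℚ.<⇒≤ (0<mesh 22)) (slack (ℚ.nonNegative⁻¹ (1ℚ ℚ.- mesh 22)) refl) (ℚ.<⇒≤ 0<e) (ℚ.p⊓q≤q ε 1ℚ)
    scaled : 23ℚ ℚ.* η ℚ.≤ ε
    scaled = ℚ.≤-trans (ℚ.≤-reflexive (solve 1 (λ e → con 23ℚ :* (con (mesh 22) :* e) := e) refl e)) (ℚ.p⊓q≤p ε 1ℚ)
    step : ∀ K → Near (upper k) (seq (Θ k) K) η → tail K ℚ.≤ ½ ℚ.* η → Near (upper (suc k)) (seq (Θ (suc k)) K)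
        (23ℚ ℚ.* η)
    step K near small = transfer (upper (suc k)) (upper k) (upper-nonNeg (suc k)) (upper-antitone k) (upper≤a k)
        (exact-⊛ k<top)
      {s} {seq (Θ (suc k)) K} {η} (proj₁ (Θ-bounds (suc k) K)) (proj₂ (Θ-bounds (suc k) K)) (proj₁ (Θ-bounds k K))
          (proj₂ (Θ-bounds k K))
      0<η η≤1 K (subst (tail K ℚ.+ tail K ℚ.≤_) (half+half η) (ℚ.+-mono-≤ small small))
      (subst (λ z → ℚ.∣ z ∣ ℚ.≤ η) (sym balanced) (ℚ.<⇒≤ 0<η)) near
      where
      s = seq (Θ k) K
      balanced : s ℚ.* (1ℚ ℚ.- ∑ K (upper (suc k))) ℚ.- seq (Θ (suc k)) K ℚ.*
          (1ℚ ℚ.- ∑ K (upper (suc k)) ℚ.+ ∑ K (exact k)) ≡ 0ℚ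
      balanced = begin
        s ℚ.* num ℚ.- s ℚ.* seq (factor k) K ℚ.* (num ℚ.+ ∑ K (exact k))
          ≡⟨ cong (λ z → s ℚ.* num ℚ.- s ℚ.* seq (factor k) K ℚ.* (num ℚ.+ z)) (∑-- K (upper k) (upper (suc k))) ⟩
        s ℚ.* num ℚ.- s ℚ.* seq (factor k) K ℚ.* seq (denominator k) K
          ≡⟨ cong (λ z → s ℚ.* num ℚ.- z) (trans (ℚ.*-assoc s (seq (factor k) K) (seq (denominator k) K))
              (cong (s ℚ.*_) (factor-* k K))) ⟩
        s ℚ.* num ℚ.- s ℚ.* num
          ≡⟨ ℚ.+-inverseʳ (s ℚ.* num) ⟩
        0ℚ ∎
        where
        open ≡-Reasoning
        num = 1ℚ ℚ.- ∑ K (upper (suc k))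

  suc[m∸1] : suc (m ∸ 1) ≡ m
  suc[m∸1] = trans (cong (λ k → suc (k ∸ 1)) (sym (toℕ-top m))) (toℕ-top m)

  topShare⟶Θ : (λ n → fromℚ (topShare m n)) ⟶ Θ (m ∸ 1)
  topShare⟶Θ {ε} 0<ε =
    let 0<h = 0<* 0<½ 0<ε
        K₁ , near = near-upper (m ∸ 1) (ℕ.≤-reflexive suc[m∸1]) 0<h
        K₂ , close = cauchy (Θ (m ∸ 1)) 0<h
        -- One fixed approximant of the limit mediates: the share is eventually within ε/2 of it,
        -- and so are all approximants from K₂ on. Starting at `suc N` excludes n = 0, where
        -- division by `a n` is impossible.
        K = K₁ ℕ.⊔ K₂
        N , F = near K (ℕ.m≤m⊔n K₁ K₂)
    in suc N , λ { (suc n) (s≤s p) {η} 0<η → K₂ , λ i q → ℚ.≤-trans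
      (combine n (seq (Θ (m ∸ 1)) K) (seq (Θ (m ∸ 1)) i) (F (suc n) (ℕ.m≤n⇒m≤1+n p))
          (ℚ.<⇒≤ (close K i (ℕ.m≤n⊔m K₁ K₂) q)))
      (slack (ℚ.<⇒≤ 0<η) refl) }
    where
    combine : ∀ n θ θ′ → ℚ.∣ upper (m ∸ 1) (suc n) ℚ.- θ ℚ.* a (suc n) ∣ ℚ.≤ ½ ℚ.* ε ℚ.* a (suc n) →
              ℚ.∣ θ ℚ.- θ′ ∣ ℚ.≤ ½ ℚ.* ε → ℚ.∣ topShare m (suc n) ℚ.- θ′ ∣ ℚ.≤ ε
    combine n θ θ′ p q = subst₂ (λ x y → ℚ.∣ x ∣ ℚ.≤ y)
      (solve 3 (λ s t t′ → s :- t :+ (t :- t′) := s :- t′) refl (topShare m (suc n)) θ θ′) (half+half ε)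
      (near-share ⊞ q)
      where
      u = a (suc n)
      near-share : ℚ.∣ topShare m (suc n) ℚ.- θ ∣ ℚ.≤ ½ ℚ.* ε
      near-share = *-cancel-≤ (upper₀-positive n) (subst (ℚ._≤ ½ ℚ.* ε ℚ.* u) (begin
        ℚ.∣ upper (m ∸ 1) (suc n) ℚ.- θ ℚ.* u ∣      ≡⟨ cong (λ z → ℚ.∣ z ℚ.- θ ℚ.* u ∣) (topShare-* (suc n)) ⟨
        ℚ.∣ topShare m (suc n) ℚ.* u ℚ.- θ ℚ.* u ∣   ≡⟨ cong ℚ.∣_∣
            (solve 3 (λ s t u → s :* u :- t :* u := (s :- t) :* u) refl (topShare m (suc n)) θ u) ⟩
        ℚ.∣ (topShare m (suc n) ℚ.- θ) ℚ.* u ∣       ≡⟨ ℚ.∣p*q∣≡∣p∣*∣q∣ (topShare m (suc n) ℚ.- θ) u ⟩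
        ℚ.∣ topShare m (suc n) ℚ.- θ ∣ ℚ.* ℚ.∣ u ∣   ≡⟨ cong (ℚ.∣ topShare m (suc n) ℚ.- θ ∣ ℚ.*_)
            (ℚ.0≤p⇒∣p∣≡p (0≤a (suc n))) ⟩
        ℚ.∣ topShare m (suc n) ℚ.- θ ∣ ℚ.* u         ∎) p)
        where open ≡-Reasoning

  derivative : ℕ → ℝ
  derivative k = explicitFactor m (w m k)

  factor≈derivative : ∀ k → k < m ∸ 1 → factor k ≈ derivative k
  factor≈derivative k p = factor≈ (subst (suc k <_) suc[m∸1] (s≤s p))

  Θ≃∏derivative : Θ (m ∸ 1) ≃ ∏[ k < m ∸ 1 ] derivative k
  Θ≃∏derivative = _≈ₛ_.unwrap (∏-cong (m ∸ 1) factor≈derivative)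

  Θ≃∏explicitFactor : Θ (m ∸ 1) ≃ ∏[ k < m ∸ 1 ] explicitFactor m (w m k)
  Θ≃∏explicitFactor = _≈ₛ_.unwrap (∏-cong (m ∸ 1) factor≈derivative)

proposition7 : ∀ (m : ℕ) .{{_ : NonTrivial m}} →
    Σ[ p ∈ ℝ ] ((λ n → fromℚ (topShare m n)) ⟶ p)
    × (Σ[ d ∈ (ℕ → ℝ) ] (∀ k → k < m ∸ 1 → HasDerivativeAt (Ψ m) (w m k) (d k))
    × p ≃ ∏[ k < m ∸ 1 ] d k)
    × p ≃ ∏[ k < m ∸ 1 ] explicitFactor m (w m k)
proposition7 m =
  Θ (m ∸ 1) ,
  topShare⟶Θ ,
  (derivative , (λ k _ → Derivative.Ψ-derivative m (w m k)) , Θ≃∏derivative) ,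
  Θ≃∏explicitFactor
  where
  open Asymptotics m
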